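{- For every positive integer $k$, the rational function $H_{2k-2}(x)$ has, in lowest terms, a factor $\Psi_k(x)$ in its denominator which does not cancel with its numerator; consequently $H_{2k-2}(x)$ is singular at the zeros of $\Psi_k(x)$.
   Context: Work on the square lattice $\mathbb{Z}^2$. A bond-animal is a connected union of bonds (edges) of the lattice, considered up to translation (the single vertex with no bonds is included). It is directed if it contains a vertex (the root) such that every bond of the animal can be reached from the root by a path in the animal using only north and east steps. For a directed bond-animal $A$ let $|A|_h$ and $|A|_v$ denote its numbers of horizontal and vertical bonds. The anisotropic generating function is $B(x,y)=\sum_A x^{|A|_h}y^{|A|_v}=\sum_{n\ge 0}H_n(x)y^n$, so $H_n(x)=\sum x^{|A|_h}$ over directed bond-animals with exactly $n$ vertical bonds; each $H_n(x)$ is a rational function of $x$. $\Psi_k(x)$ denotes the $k$-th cyclotomic polynomial, normalized so that $1-x^n=\prod_{k\mid n}\Psi_k(x)$ (so $\Psi_1(x)=1-x$, $\Psi_2(x)=1+x$). -}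

module Defs where

open import Data.Bool using (Bool; true; false; _∧_; _∨_; if_then_else_)
open import Data.Nat using (ℕ; zero; suc; _∸_; _≡ᵇ_)
open import Data.Nat.Divisibility using (_∣?_)
open import Data.Product using (_×_; _,_; Σ; ∃)
open import Data.List using (List; []; _∷_; _++_; map; length; filter; filterᵇ; foldr; upTo)
open import Data.Bool.ListAction using (any; all)
open import Data.Integer using (+_)
open import Data.Rational using (ℚ; 0ℚ; 1ℚ; _+_; _*_; _-_; _/_)
open import Relation.Binary.PropositionalEquality using (_≡_)
open import Relation.Nullary using (¬_)

-- Directed bond-animals on Z^2.
-- A directed bond-animal with at least one bond has a unique root (its
-- south-west-most source), so up to translation it is the same as a
-- finite set S of bonds such that every bond is reachable from the
-- origin by a north/east path inside S (root translated to (0,0)).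
-- The single-vertex animal corresponds to S = [].
-- With m horizontal and n vertical bonds, such an animal lies in the box
-- [0,m] x [0,n], so it is a subset of `boxBonds m n`.

data Dir : Set where
  hor ver : Dir

Vertex : Set
Vertex = ℕ × ℕ

Bond : Set
Bond = ℕ × ℕ × Dir

start : Bond → Vertex
start (x , y , _) = (x , y)

end : Bond → Vertex
end (x , y , hor) = (suc x , y)
end (x , y , ver) = (x , suc y)

isHor : Bond → Bool
isHor (_ , _ , hor) = true
isHor (_ , _ , ver) = false

isVer : Bond → Bool
isVer (_ , _ , hor) = false
isVer (_ , _ , ver) = true

eqV : Vertex → Vertex → Bool
eqV (a , b) (c , d) = (a ≡ᵇ c) ∧ (b ≡ᵇ d)

memV : Vertex → List Vertex → Bool
memV v vs = any (eqV v) vs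

boxBonds : ℕ → ℕ → List Bond
boxBonds m n =
  Data.List.concatMap (λ x → map (λ y → (x , y , hor)) (upTo (suc n))) (upTo m)
  ++ Data.List.concatMap (λ x → map (λ y → (x , y , ver)) (upTo n)) (upTo (suc m))

subsets : {A : Set} → List A → List (List A)
subsets [] = [] ∷ []
subsets (b ∷ bs) = subsets bs ++ map (b ∷_) (subsets bs)

step : List Bond → List Vertex → List Vertex
step S vs = vs ++ map end (filterᵇ (λ b → memV (start b) vs) S)

iter : ℕ → (List Vertex → List Vertex) → List Vertex → List Vertex
iter zero f v = v
iter (suc k) f v = f (iter k f v)

reachFromOrigin : List Bond → List Vertex
reachFromOrigin S = iter (suc (length S)) (step S) ((0 , 0) ∷ [])

isDirectedRooted : List Bond → Bool
isDirectedRooted S = all (λ b → memV (start b) (reachFromOrigin S)) S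

numAnimals : ℕ → ℕ → ℕ
numAnimals n m =
  length (filterᵇ
    (λ S → isDirectedRooted S
           ∧ (length (filterᵇ isHor S) ≡ᵇ m)
           ∧ (length (filterᵇ isVer S) ≡ᵇ n))
    (subsets (boxBonds m n)))

Series : Set
Series = ℕ → ℚ

ℕtoℚ : ℕ → ℚ
ℕtoℚ c = + c / 1

H : ℕ → Series
H n m = ℕtoℚ (numAnimals n m)

sumTo : (ℕ → ℚ) → ℕ → ℚ
sumTo f zero = f zero
sumTo f (suc k) = sumTo f k + f (suc k)

_⊛_ : Series → Series → Series
(f ⊛ g) m = sumTo (λ i → f i * g (m ∸ i)) m

oneS : Series
oneS m = if m ≡ᵇ 0 then 1ℚ else 0ℚ

prodS : List Series → Series
prodS = foldr _⊛_ oneS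

-- polynomials over ℚ as coefficient lists (constant term first)
Poly : Set
Poly = List ℚ

coeff : Poly → Series
coeff [] _ = 0ℚ
coeff (a ∷ p) zero = a
coeff (a ∷ p) (suc m) = coeff p m

oneMinusXPow : ℕ → Series
oneMinusXPow n m = (if m ≡ᵇ 0 then 1ℚ else 0ℚ) - (if m ≡ᵇ n then 1ℚ else 0ℚ)

divisors : ℕ → List ℕ
divisors n = filter (λ d → d ∣? n) (map suc (upTo n))

-- Ψ is the family of cyclotomic polynomials, normalized by
-- 1 - x^n = ∏_{d ∣ n} Ψ_d(x) for all n ≥ 1
-- (this determines Ψ_1, Ψ_2, ... uniquely).
IsCyclotomic : (ℕ → Poly) → Set
IsCyclotomic Ψ = ∀ n → 1 Data.Nat.≤ n →
  ∀ m → prodS (map (λ d → coeff (Ψ d)) (divisors n)) m ≡ oneMinusXPow n m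

_∣ₚ_ : Poly → Poly → Set
D ∣ₚ P = Σ Poly (λ E → ∀ m → (coeff D ⊛ coeff E) m ≡ coeff P m)

IsConstant : Poly → Set
IsConstant D = ∀ m → 1 Data.Nat.≤ m → coeff D m ≡ 0ℚ

CoprimeP : Poly → Poly → Set
CoprimeP P Q = ∀ D → D ∣ₚ P → D ∣ₚ Q → IsConstant D

HasUncancelledDenomFactor : Series → Poly → Set
HasUncancelledDenomFactor f Ψk =
  Σ Poly (λ P → Σ Poly (λ Q →
      (∀ m → (coeff Q ⊛ f) m ≡ coeff P m)
    × CoprimeP P Q
    × Ψk ∣ₚ Q
    × ¬ (Ψk ∣ₚ P)))

{-# OPTIONS --safe #-}
module Submission where

-- An animal is read column by column. The state between two columns records which rows are
-- crossed by a horizontal bond and, for every row, how many vertical bonds remain to be placed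
-- on top of it; the completions of a state have a generating series F that satisfies a
-- triangular linear system whose diagonal entries are 1 - x^j, j being the number of crossed
-- rows. Thus a pole at the primitive k-th roots of unity needs k rows crossed at once. Rows
-- separated by a level without remaining vertical bonds are independent, so k - 1 vertical bonds
-- are needed to the left to open the k rows and k - 1 to the right to tie them together: with
-- 2k - 2 vertical bonds only the animals with k rows and exactly two vertical bonds between
-- consecutive rows matter. Modulo series regular at Ψ_k, opening the rows multiplies by
-- 1 / ∏_{j<k} (1 - x^j), and tying them together is evaluated by merging the bottom rows one
-- after the other; each merger multiplies by a unit times N = 1 + x - x² - x^(s+1).
-- N is a unit modulo Ψ_k: if a k-periodic sequence is killed by N, then 1 + x - x² acts on it as
-- a translation and preserves its ℓ² norm over a period, which forces 2-periodicity. So Ψ_k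
-- divides the denominator exactly, without using that Ψ_k is irreducible.

open import Defs
open import Algebra.Bundles using (CommutativeRing)
import Algebra.Solver.Ring as RingSolver
open import Algebra.Solver.Ring.AlmostCommutativeRing using (fromCommutativeRing; _-Raw-AlmostCommutative⟶_)
import Algebra.Solver.Ring.Simple as SimpleSolver
open import Algebra.Structures using (IsCommutativeRing)
open import Data.Bool using (Bool; true; false; _∧_; _∨_; if_then_else_; T; T?)
open import Data.Bool.ListAction using (any; all)
import Data.Bool.Properties as Boolₚ
open import Data.Empty using (⊥; ⊥-elim)
import Data.Integer as ℤ
import Data.Integer.Properties as ℤₚ
open import Data.List using (List; []; _∷_; _++_; map; filter; filterᵇ; length; concatMap; upTo; applyUpTo; replicate; [_])
open import Data.List.Membership.Propositional using (_∈_)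
import Data.List.Membership.Propositional.Properties as ∈ₚ
import Data.List.Properties as Listₚ
open import Data.List.Relation.Binary.Permutation.Propositional using (_↭_; prep; swap; ↭-sym; ↭-refl; ↭-reflexive; ↭-trans)
import Data.List.Relation.Binary.Permutation.Propositional as Perm
import Data.List.Relation.Binary.Permutation.Propositional.Properties as Permₚ
open import Data.List.Relation.Binary.Sublist.Propositional using (_⊆_; []; _∷ʳ_; _∷_)
open import Data.List.Relation.Binary.Sublist.Propositional.Properties using (All-resp-⊆)
open import Data.List.Relation.Unary.All using (All; []; _∷_)
import Data.List.Relation.Unary.All as All
import Data.List.Relation.Unary.All.Properties as Allₚ
open import Data.List.Relation.Unary.AllPairs using (AllPairs; []; _∷_)
import Data.List.Relation.Unary.AllPairs.Properties as AllPairsₚ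
open import Data.List.Relation.Unary.Any using (here; there)
open import Data.Maybe using (Maybe; just; nothing; maybe′)
import Data.Maybe as Maybe
open import Data.Nat using (ℕ; zero; suc; _≤_; _<_; z≤n; s≤s; _+_; _*_; _∸_; _≡ᵇ_; _≟_; _≤?_; _<?_; NonZero; >-nonZero; ≢-nonZero)
import Data.Nat.Coprimality as Coprimality
open import Data.Nat.Divisibility using (_∣_; _∣?_; quotient; _∣0; 1∣_; ∣-refl; ∣-trans; ∣-antisym; ∣⇒≤; >⇒∤; ∣m+n∣m⇒∣n; ∣m∣n⇒∣m+n; *-pres-∣; *-cancelˡ-∣; *-cancelʳ-∣; *-monoʳ-∣; m∣m*n; n∣m*n)
open import Data.Nat.GCD using (gcd; gcd[m,n]∣m; gcd[m,n]∣n; gcd[m,n]≢0; gcd-greatest; gcd-GCD; c*gcd[m,n]≡gcd[cm,cn]; module Bézout)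
open import Data.Nat.Induction using (<-rec)
open import Data.Nat.ListAction using (sum)
open import Data.Nat.ListAction.Properties using (sum-++)
import Data.Nat.Properties as ℕₚ
open import Data.Nat.Solver using (module +-*-Solver)
open import Data.Product using (_,_; Σ; _×_; proj₁; proj₂)
open import Data.Rational using (ℚ; 0ℚ; 1ℚ; 1/_) renaming (_+_ to _+ℚ_; _*_ to _*ℚ_; -_ to -ℚ_; _≤_ to _≤ℚ_)
import Data.Rational as ℚ
import Data.Rational.Properties as ℚₚ
open import Data.Sum using (_⊎_; inj₁; inj₂)
open import Data.Unit using (⊤)
open import Function using (_∘_)
open import Level using (0ℓ)
open import Relation.Binary.Definitions using (WeaklyDecidable; tri<; tri≈; tri>)
open import Relation.Binary.PropositionalEquality using (_≡_; _≢_; refl; sym; trans; cong; cong₂; subst; subst₂; module ≡-Reasoning)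
open import Relation.Nullary using (¬_; Dec; yes; no; does; _×-dec_)

module ℚ-Solver = SimpleSolver (fromCommutativeRing ℚₚ.+-*-commutativeRing) ℚₚ._≟_

infix 4 _≈_
record _≈_ (f g : Series) : Set where
  constructor mk≈
  field at : ∀ m → f m ≡ g m
open _≈_ public

infixl 6 _⊕_
infix 8 ⊖_

infixl 7 _·_

-- Opaque, because unification would otherwise unfold the convolution.
opaque
  _⊕_ : Series → Series → Series
  (f ⊕ g) m = f m +ℚ g m

  ⊖_ : Series → Series
  (⊖ f) m = -ℚ f m

  _·_ : Series → Series → Series
  _·_ = _⊛_

  ⊕-at : ∀ f g m → (f ⊕ g) m ≡ f m +ℚ g m
  ⊕-at f g m = refl

  ⊖-at : ∀ f m → (⊖ f) m ≡ -ℚ f m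
  ⊖-at f m = refl

  ·-at : ∀ f g m → (f · g) m ≡ (f ⊛ g) m
  ·-at f g m = refl

const : ℚ → Series
const c zero = c
const c (suc m) = 0ℚ

zeroS : Series
zeroS m = 0ℚ

tail : Series → Series
tail f m = f (suc m)

≈-refl : ∀ {f} → f ≈ f
≈-refl = mk≈ λ _ → refl

≈-sym : ∀ {f g} → f ≈ g → g ≈ f
≈-sym e = mk≈ λ m → sym (at e m)

≈-trans : ∀ {f g h} → f ≈ g → g ≈ h → f ≈ h
≈-trans e e′ = mk≈ λ m → trans (at e m) (at e′ m)

sumTo-cong : ∀ {f g} m → (∀ i → f i ≡ g i) → sumTo f m ≡ sumTo g m
sumTo-cong zero e = e 0
sumTo-cong (suc m) e = cong₂ _+ℚ_ (sumTo-cong m e) (e (suc m))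

sumTo-head : ∀ f m → sumTo f (suc m) ≡ f 0 +ℚ sumTo (λ i → f (suc i)) m
sumTo-head f zero = refl
sumTo-head f (suc m) = trans (cong (_+ℚ f (suc (suc m))) (sumTo-head f m)) (ℚₚ.+-assoc (f 0) _ _)

⊛-suc : ∀ f g m → (f ⊛ g) (suc m) ≡ f 0 *ℚ g (suc m) +ℚ (tail f ⊛ g) m
⊛-suc f g m = sumTo-head (λ i → f i *ℚ g (suc m ∸ i)) m

⊛-congᵐ : ∀ {f f′ g g′} → f ≈ f′ → g ≈ g′ → ∀ m → (f ⊛ g) m ≡ (f′ ⊛ g′) m
⊛-congᵐ e e′ m = sumTo-cong m λ i → cong₂ _*ℚ_ (at e i) (at e′ _)

⊛-cong : ∀ {f f′ g g′} → f ≈ f′ → g ≈ g′ → f ⊛ g ≈ f′ ⊛ g′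
⊛-cong e e′ = mk≈ (⊛-congᵐ e e′)

⊛-comm : ∀ f g m → (f ⊛ g) m ≡ (g ⊛ f) m
⊛-comm f g zero = ℚₚ.*-comm (f 0) (g 0)
⊛-comm f g (suc zero) = begin
  f 0 *ℚ g 1 +ℚ f 1 *ℚ g 0 ≡⟨ ℚₚ.+-comm (f 0 *ℚ g 1) (f 1 *ℚ g 0) ⟩
  f 1 *ℚ g 0 +ℚ f 0 *ℚ g 1 ≡⟨ cong₂ _+ℚ_ (ℚₚ.*-comm (f 1) (g 0)) (ℚₚ.*-comm (f 0) (g 1)) ⟩
  g 0 *ℚ f 1 +ℚ g 1 *ℚ f 0 ∎
  where open ≡-Reasoning
⊛-comm f g (suc (suc m)) = begin
  (f ⊛ g) (suc (suc m))                       ≡⟨ ⊛-suc f g (suc m) ⟩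
  f 0 *ℚ g (suc (suc m)) +ℚ (tail f ⊛ g) (suc m)
    ≡⟨ cong (f 0 *ℚ g (suc (suc m)) +ℚ_) (trans (⊛-comm (tail f) g (suc m)) (⊛-suc g (tail f) m)) ⟩
  f 0 *ℚ g (suc (suc m)) +ℚ (g 0 *ℚ f (suc (suc m)) +ℚ (tail g ⊛ tail f) m)
    ≡⟨ cong (λ t → f 0 *ℚ g (suc (suc m)) +ℚ (g 0 *ℚ f (suc (suc m)) +ℚ t)) (⊛-comm (tail g) (tail f) m) ⟩
  f 0 *ℚ g (suc (suc m)) +ℚ (g 0 *ℚ f (suc (suc m)) +ℚ (tail f ⊛ tail g) m)
    ≡⟨ solve 3 (λ a b c → a :+ (b :+ c) := b :+ (a :+ c)) refl (f 0 *ℚ g (suc (suc m))) (g 0 *ℚ f (suc (suc m))) _ ⟩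
  g 0 *ℚ f (suc (suc m)) +ℚ (f 0 *ℚ g (suc (suc m)) +ℚ (tail f ⊛ tail g) m)
    ≡⟨ cong (g 0 *ℚ f (suc (suc m)) +ℚ_) (sym (trans (⊛-comm (tail g) f (suc m)) (⊛-suc f (tail g) m))) ⟩
  g 0 *ℚ f (suc (suc m)) +ℚ (tail g ⊛ f) (suc m) ≡⟨ sym (⊛-suc g f (suc m)) ⟩
  (g ⊛ f) (suc (suc m)) ∎
  where
    open ≡-Reasoning
    open ℚ-Solver

⊛-distribʳ : ∀ h f g m → ((λ i → f i +ℚ g i) ⊛ h) m ≡ (f ⊛ h) m +ℚ (g ⊛ h) m
⊛-distribʳ h f g zero = ℚₚ.*-distribʳ-+ (h 0) (f 0) (g 0)
⊛-distribʳ h f g (suc m) = begin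
  ((λ i → f i +ℚ g i) ⊛ h) (suc m)   ≡⟨ ⊛-suc (λ i → f i +ℚ g i) h m ⟩
  (f 0 +ℚ g 0) *ℚ h (suc m) +ℚ ((λ i → tail f i +ℚ tail g i) ⊛ h) m
    ≡⟨ cong ((f 0 +ℚ g 0) *ℚ h (suc m) +ℚ_) (⊛-distribʳ h (tail f) (tail g) m) ⟩
  (f 0 +ℚ g 0) *ℚ h (suc m) +ℚ ((tail f ⊛ h) m +ℚ (tail g ⊛ h) m)
    ≡⟨ solve 5 (λ a b c d e → (a :+ b) :* c :+ (d :+ e) := (a :* c :+ d) :+ (b :* c :+ e)) refl (f 0) (g 0) (h (suc m)) _ _ ⟩
  (f 0 *ℚ h (suc m) +ℚ (tail f ⊛ h) m) +ℚ (g 0 *ℚ h (suc m) +ℚ (tail g ⊛ h) m)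
    ≡⟨ sym (cong₂ _+ℚ_ (⊛-suc f h m) (⊛-suc g h m)) ⟩
  (f ⊛ h) (suc m) +ℚ (g ⊛ h) (suc m) ∎
  where
    open ≡-Reasoning
    open ℚ-Solver

scale-⊛ : ∀ c f g m → ((λ i → c *ℚ f i) ⊛ g) m ≡ c *ℚ (f ⊛ g) m
scale-⊛ c f g zero = ℚₚ.*-assoc c (f 0) (g 0)
scale-⊛ c f g (suc m) = begin
  ((λ i → c *ℚ f i) ⊛ g) (suc m)   ≡⟨ ⊛-suc (λ i → c *ℚ f i) g m ⟩
  (c *ℚ f 0) *ℚ g (suc m) +ℚ ((λ i → c *ℚ tail f i) ⊛ g) m
    ≡⟨ cong₂ _+ℚ_ (ℚₚ.*-assoc c (f 0) (g (suc m))) (scale-⊛ c (tail f) g m) ⟩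
  c *ℚ (f 0 *ℚ g (suc m)) +ℚ c *ℚ (tail f ⊛ g) m
    ≡⟨ sym (ℚₚ.*-distribˡ-+ c _ _) ⟩
  c *ℚ (f 0 *ℚ g (suc m) +ℚ (tail f ⊛ g) m) ≡⟨ cong (c *ℚ_) (sym (⊛-suc f g m)) ⟩
  c *ℚ (f ⊛ g) (suc m) ∎
  where open ≡-Reasoning

⊛-assoc : ∀ f g h m → ((f ⊛ g) ⊛ h) m ≡ (f ⊛ (g ⊛ h)) m
⊛-assoc f g h zero = ℚₚ.*-assoc (f 0) (g 0) (h 0)
⊛-assoc f g h (suc m) = begin
  ((f ⊛ g) ⊛ h) (suc m)   ≡⟨ ⊛-suc (f ⊛ g) h m ⟩
  (f 0 *ℚ g 0) *ℚ h (suc m) +ℚ (tail (f ⊛ g) ⊛ h) m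
    ≡⟨ cong ((f 0 *ℚ g 0) *ℚ h (suc m) +ℚ_)
         (trans (⊛-congᵐ {g = h} (mk≈ (⊛-suc f g)) ≈-refl m) (⊛-distribʳ h (λ i → f 0 *ℚ tail g i) (tail f ⊛ g) m)) ⟩
  (f 0 *ℚ g 0) *ℚ h (suc m) +ℚ (((λ i → f 0 *ℚ tail g i) ⊛ h) m +ℚ ((tail f ⊛ g) ⊛ h) m)
    ≡⟨ cong₂ (λ s t → (f 0 *ℚ g 0) *ℚ h (suc m) +ℚ (s +ℚ t)) (scale-⊛ (f 0) (tail g) h m) (⊛-assoc (tail f) g h m) ⟩
  (f 0 *ℚ g 0) *ℚ h (suc m) +ℚ (f 0 *ℚ (tail g ⊛ h) m +ℚ (tail f ⊛ (g ⊛ h)) m)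
    ≡⟨ solve 5 (λ a b c d e → (a :* b) :* c :+ (a :* d :+ e) := a :* (b :* c :+ d) :+ e) refl (f 0) (g 0) (h (suc m)) _ _ ⟩
  f 0 *ℚ (g 0 *ℚ h (suc m) +ℚ (tail g ⊛ h) m) +ℚ (tail f ⊛ (g ⊛ h)) m
    ≡⟨ cong (λ t → f 0 *ℚ t +ℚ (tail f ⊛ (g ⊛ h)) m) (sym (⊛-suc g h m)) ⟩
  f 0 *ℚ (g ⊛ h) (suc m) +ℚ (tail f ⊛ (g ⊛ h)) m ≡⟨ sym (⊛-suc f (g ⊛ h) m) ⟩
  (f ⊛ (g ⊛ h)) (suc m) ∎
  where
    open ≡-Reasoning
    open ℚ-Solver

zeroS-⊛ : ∀ g m → (zeroS ⊛ g) m ≡ 0ℚ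
zeroS-⊛ g zero = ℚₚ.*-zeroˡ (g 0)
zeroS-⊛ g (suc m) = begin
  (zeroS ⊛ g) (suc m) ≡⟨ ⊛-suc zeroS g m ⟩
  0ℚ *ℚ g (suc m) +ℚ (zeroS ⊛ g) m ≡⟨ cong₂ _+ℚ_ (ℚₚ.*-zeroˡ (g (suc m))) (zeroS-⊛ g m) ⟩
  0ℚ ∎
  where open ≡-Reasoning

const-⊛ : ∀ c g m → (const c ⊛ g) m ≡ c *ℚ g m
const-⊛ c g zero = refl
const-⊛ c g (suc m) = begin
  (const c ⊛ g) (suc m) ≡⟨ ⊛-suc (const c) g m ⟩
  c *ℚ g (suc m) +ℚ (zeroS ⊛ g) m ≡⟨ cong (c *ℚ g (suc m) +ℚ_) (zeroS-⊛ g m) ⟩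
  c *ℚ g (suc m) +ℚ 0ℚ ≡⟨ ℚₚ.+-identityʳ _ ⟩
  c *ℚ g (suc m) ∎
  where open ≡-Reasoning

𝟙≈oneS : const 1ℚ ≈ oneS
𝟙≈oneS = mk≈ λ { zero → refl ; (suc m) → refl }

𝟙 : Series
𝟙 = const 1ℚ

𝟙-⊛ : ∀ g m → (𝟙 ⊛ g) m ≡ g m
𝟙-⊛ g m = trans (const-⊛ 1ℚ g m) (ℚₚ.*-identityˡ (g m))

opaque
  unfolding _⊕_ ⊖_ _·_

  ⊕-·-isCommutativeRing : IsCommutativeRing _≈_ _⊕_ _·_ ⊖_ zeroS 𝟙
  ⊕-·-isCommutativeRing = record
      { isRing = record
        { +-isAbelianGroup = record
          { isGroup = record
            { isMonoid = record
              { isSemigroup = record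
                { isMagma = record
                  { isEquivalence = record { refl = ≈-refl ; sym = ≈-sym ; trans = ≈-trans }
                  ; ∙-cong = λ e e′ → mk≈ λ m → cong₂ _+ℚ_ (at e m) (at e′ m) }
                ; assoc = λ f g h → mk≈ λ m → ℚₚ.+-assoc (f m) (g m) (h m) }
              ; identity = (λ f → mk≈ λ m → ℚₚ.+-identityˡ (f m)) , (λ f → mk≈ λ m → ℚₚ.+-identityʳ (f m)) }
            ; inverse = (λ f → mk≈ λ m → ℚₚ.+-inverseˡ (f m)) , (λ f → mk≈ λ m → ℚₚ.+-inverseʳ (f m))
            ; ⁻¹-cong = λ e → mk≈ λ m → cong -ℚ_ (at e m) }
          ; comm = λ f g → mk≈ λ m → ℚₚ.+-comm (f m) (g m) }
        ; *-cong = ⊛-cong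
        ; *-assoc = λ f g h → mk≈ (⊛-assoc f g h)
        ; *-identity = (λ g → mk≈ (𝟙-⊛ g)) , (λ g → mk≈ λ m → trans (⊛-comm g 𝟙 m) (𝟙-⊛ g m))
        ; distrib = (λ h f g → mk≈ λ m → trans (⊛-comm h (λ i → f i +ℚ g i) m) (trans (⊛-distribʳ h f g m) (cong₂ _+ℚ_ (⊛-comm f h m) (⊛-comm g h m))))
                  , (λ h f g → mk≈ (⊛-distribʳ h f g)) }
      ; *-comm = λ f g → mk≈ (⊛-comm f g) }

  const-+ : ∀ a b → const (a +ℚ b) ≈ const a ⊕ const b
  const-+ a b = mk≈ λ { zero → refl ; (suc m) → refl }

  const-* : ∀ a b → const (a *ℚ b) ≈ const a · const b
  const-* a b = mk≈ λ { zero → refl ; (suc m) → sym (trans (const-⊛ a (const b) (suc m)) (ℚₚ.*-zeroʳ a)) }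

  const-neg : ∀ a → const (-ℚ a) ≈ ⊖ const a
  const-neg a = mk≈ λ { zero → refl ; (suc m) → refl }

const-0 : const 0ℚ ≈ zeroS
const-0 = mk≈ λ { zero → refl ; (suc m) → refl }

seriesRing : CommutativeRing 0ℓ 0ℓ
seriesRing = record { isCommutativeRing = ⊕-·-isCommutativeRing }

module SR = CommutativeRing seriesRing

const-morphism : CommutativeRing.rawRing ℚₚ.+-*-commutativeRing -Raw-AlmostCommutative⟶ fromCommutativeRing seriesRing
const-morphism = record
  { ⟦_⟧ = const
  ; +-homo = const-+
  ; *-homo = const-*
  ; -‿homo = const-neg
  ; 0-homo = const-0
  ; 1-homo = ≈-refl }

const-≟ : WeaklyDecidable (λ a b → const a ≈ const b)
const-≟ a b with a ℚₚ.≟ b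
... | yes refl = just ≈-refl
... | no _ = nothing

module S-Solver = RingSolver (CommutativeRing.rawRing ℚₚ.+-*-commutativeRing) (fromCommutativeRing seriesRing) const-morphism const-≟
open import Relation.Binary.Reasoning.Setoid SR.setoid using (begin_; step-≈-⟩; _∎)

ℚ-inverse : ∀ p → p ≢ 0ℚ → Σ ℚ λ r → r *ℚ p ≡ 1ℚ
ℚ-inverse p p≢0 = 1/ p , ℚₚ.*-inverseˡ p
  where instance _ = ℚ.≢-nonZero p≢0

ℚ-cancel : ∀ p q → p ≢ 0ℚ → p *ℚ q ≡ 0ℚ → q ≡ 0ℚ
ℚ-cancel p q p≢0 e = trans (sym (ℚₚ.*-identityˡ q)) (trans (cong (_*ℚ q) (sym (proj₂ (ℚ-inverse p p≢0))))
    (trans (ℚₚ.*-assoc r p q) (trans (cong (r *ℚ_) e) (ℚₚ.*-zeroʳ r))))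
  where r = proj₁ (ℚ-inverse p p≢0)

x^ : ℕ → Series
x^ n m = if m ≡ᵇ n then 1ℚ else 0ℚ

·-zero-at : ∀ f g → (f · g) 0 ≡ f 0 *ℚ g 0
·-zero-at f g = ·-at f g 0

·-suc-at : ∀ f g m → (f · g) (suc m) ≡ f 0 *ℚ g (suc m) +ℚ (tail f · g) m
·-suc-at f g m = trans (·-at f g (suc m)) (trans (⊛-suc f g m) (cong (f 0 *ℚ g (suc m) +ℚ_) (sym (·-at (tail f) g m))))

x^-suc-zero : ∀ n f → (x^ (suc n) · f) 0 ≡ 0ℚ
x^-suc-zero n f = trans (·-zero-at _ f) (ℚₚ.*-zeroˡ (f 0))

x^-suc-suc : ∀ n f m → (x^ (suc n) · f) (suc m) ≡ (x^ n · f) m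
x^-suc-suc n f m = trans (·-suc-at (x^ (suc n)) f m)
  (trans (cong (_+ℚ (x^ n · f) m) (ℚₚ.*-zeroˡ (f (suc m)))) (ℚₚ.+-identityˡ _))

x^0≈𝟙 : x^ 0 ≈ 𝟙
x^0≈𝟙 = ≈-sym (mk≈ λ m → at 𝟙≈oneS m)

x^0· : ∀ f → x^ 0 · f ≈ f
x^0· f = ≈-trans (SR.*-congʳ x^0≈𝟙) (SR.*-identityˡ f)

x^-+ : ∀ a b → x^ (a + b) ≈ x^ a · x^ b
x^-+ zero b = ≈-sym (x^0· (x^ b))
x^-+ (suc a) b = mk≈ λ
  { zero → sym (x^-suc-zero a (x^ b))
  ; (suc m) → trans (at (x^-+ a b) m) (sym (x^-suc-suc a (x^ b) m)) }

x^-shift : ∀ n f m → (x^ n · f) (n + m) ≡ f m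
x^-shift zero f m = at (x^0· f) m
x^-shift (suc n) f m = trans (x^-suc-suc n f (n + m)) (x^-shift n f m)

x^-low : ∀ n f m → m < n → (x^ n · f) m ≡ 0ℚ
x^-low (suc n) f zero _ = x^-suc-zero n f
x^-low (suc n) f (suc m) (s≤s m<n) = trans (x^-suc-suc n f m) (x^-low n f m m<n)

-- Polynomials as series that vanish from some index on

VanishFrom : ℕ → Series → Set
VanishFrom n f = ∀ m → n ≤ m → f m ≡ 0ℚ

IsPoly : Series → Set
IsPoly f = Σ ℕ λ n → VanishFrom n f

vanish-≈ : ∀ {f g n} → f ≈ g → VanishFrom n f → VanishFrom n g
vanish-≈ e v m n≤m = trans (sym (at e m)) (v m n≤m)

poly-≈ : ∀ {f g} → f ≈ g → IsPoly f → IsPoly g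
poly-≈ e (n , v) = n , vanish-≈ e v

vanish-mono : ∀ {f a b} → a ≤ b → VanishFrom a f → VanishFrom b f
vanish-mono a≤b v m b≤m = v m (ℕₚ.≤-trans a≤b b≤m)

vanish-⊕ : ∀ {f g n} → VanishFrom n f → VanishFrom n g → VanishFrom n (f ⊕ g)
vanish-⊕ {f} {g} v w m n≤m = trans (⊕-at f g m) (cong₂ _+ℚ_ (v m n≤m) (w m n≤m))

poly-⊕ : ∀ {f g} → IsPoly f → IsPoly g → IsPoly (f ⊕ g)
poly-⊕ {f} {g} (a , v) (b , w) = a + b , vanish-⊕ {f} {g} (vanish-mono {f} (ℕₚ.m≤m+n a b) v) (vanish-mono {g} (ℕₚ.m≤n+m b a) w)

vanish-⊖ : ∀ {f n} → VanishFrom n f → VanishFrom n (⊖ f)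
vanish-⊖ {f} v m n≤m = trans (⊖-at f m) (cong -ℚ_ (v m n≤m))

poly-⊖ : ∀ {f} → IsPoly f → IsPoly (⊖ f)
poly-⊖ {f} (a , v) = a , vanish-⊖ {f} v

vanish-· : ∀ a b {f g} → VanishFrom a f → VanishFrom b g → VanishFrom (a + b) (f · g)
vanish-· zero b {f} {g} v w m _ =
  trans (at (≈-trans (SR.*-congʳ {g} (mk≈ λ i → v i z≤n)) (SR.zeroˡ g)) m) refl
vanish-· (suc a) b {f} {g} v w (suc m) (s≤s a+b≤m) = trans (·-suc-at f g m)
  (cong₂ _+ℚ_ (trans (cong (f 0 *ℚ_) (w (suc m) (ℕₚ.m≤n⇒m≤1+n (ℕₚ.≤-trans (ℕₚ.m≤n+m b a) a+b≤m)))) (ℚₚ.*-zeroʳ (f 0)))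
              (vanish-· a b {tail f} {g} (λ i a≤i → v (suc i) (s≤s a≤i)) w m a+b≤m))

poly-· : ∀ {f g} → IsPoly f → IsPoly g → IsPoly (f · g)
poly-· {f} {g} (a , v) (b , w) = a + b , vanish-· a b {f} {g} v w

poly-const : ∀ c → IsPoly (const c)
poly-const c = 1 , λ { (suc m) _ → refl }

poly-𝟙 : IsPoly 𝟙
poly-𝟙 = poly-const 1ℚ

poly-zero : IsPoly zeroS
poly-zero = 0 , λ _ _ → refl

vanish-x^ : ∀ n → VanishFrom (suc n) (x^ n)
vanish-x^ zero (suc m) _ = refl
vanish-x^ (suc n) (suc m) (s≤s n<m) = vanish-x^ n m n<m

poly-x^ : ∀ n → IsPoly (x^ n)
poly-x^ n = suc n , vanish-x^ n

poly-coeff : ∀ p → IsPoly (coeff p)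
poly-coeff [] = 0 , λ _ _ → refl
poly-coeff (a ∷ p) = suc (proj₁ (poly-coeff p)) , λ { (suc m) (s≤s le) → proj₂ (poly-coeff p) m le }

toPoly : ∀ {f} → IsPoly f → Σ Poly λ p → coeff p ≈ f
toPoly (n , v) = go n v
  where
    go : ∀ n {f} → VanishFrom n f → Σ Poly λ p → coeff p ≈ f
    go zero v = [] , mk≈ λ m → sym (v m z≤n)
    go (suc n) {f} v with go n {tail f} (λ m n≤m → v (suc m) (s≤s n≤m))
    ... | p , e = f 0 ∷ p , mk≈ λ { zero → refl ; (suc m) → at e m }

top-coeff : ∀ a b {f g} → VanishFrom (suc a) f → VanishFrom (suc b) g → (f · g) (a + b) ≡ f a *ℚ g b
top-coeff zero b {f} {g} v w =
  trans (at (SR.*-congʳ {g} {f} {const (f 0)} (mk≈ λ { zero → refl ; (suc m) → v (suc m) (s≤s z≤n) })) b)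
        (trans (·-at (const (f 0)) g b) (const-⊛ (f 0) g b))
top-coeff (suc a) b {f} {g} v w = trans (·-suc-at f g (a + b))
  (trans (cong₂ _+ℚ_ (trans (cong (f 0 *ℚ_) (w (suc (a + b)) (s≤s (ℕₚ.m≤n+m b a)))) (ℚₚ.*-zeroʳ (f 0)))
                     (top-coeff a b {tail f} {g} (λ i a<i → v (suc i) (s≤s a<i)) w))
         (ℚₚ.+-identityˡ _))

HasDeg : Series → ℕ → Set
HasDeg f n = f n ≢ 0ℚ × VanishFrom (suc n) f

vanish-lower : ∀ {f n} → VanishFrom (suc n) f → f n ≡ 0ℚ → VanishFrom n f
vanish-lower {f} {n} v e m n≤m with ℕₚ.m≤n⇒m<n∨m≡n n≤m
... | inj₁ n<m = v m n<m
... | inj₂ refl = e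

findDeg : ∀ n {f} → VanishFrom n f → (f ≈ zeroS) ⊎ Σ ℕ (HasDeg f)
findDeg zero v = inj₁ (mk≈ λ m → v m z≤n)
findDeg (suc n) {f} v with f n ℚₚ.≟ 0ℚ
... | yes e = findDeg n (vanish-lower {f} v e)
... | no ne = inj₂ (n , ne , v)

deg-· : ∀ {f g a b} → HasDeg f a → HasDeg g b → HasDeg (f · g) (a + b)
deg-· {f} {g} {a} {b} (f≢0 , v) (g≢0 , w) =
  (λ e → g≢0 (ℚ-cancel (f a) (g b) f≢0 (trans (sym (top-coeff a b {f} {g} v w)) e))) ,
  vanish′
  where
    vanish′ : VanishFrom (suc (a + b)) (f · g)
    vanish′ m lt with ℕₚ.m≤n⇒m<n∨m≡n lt
    ... | inj₁ lt′ = vanish-· (suc a) (suc b) {f} {g} v w m (subst (_≤ m) (cong suc (sym (ℕₚ.+-suc a b))) lt′)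
    ... | inj₂ refl = trans (cong (f · g) (sym (ℕₚ.+-suc a b)))
                        (trans (top-coeff a (suc b) {f} {g} v (vanish-mono {g} (ℕₚ.n≤1+n (suc b)) w))
                          (trans (cong (f a *ℚ_) (w (suc b) ℕₚ.≤-refl)) (ℚₚ.*-zeroʳ (f a))))

deg-unique : ∀ {f a b} → HasDeg f a → HasDeg f b → a ≡ b
deg-unique {f} {a} {b} (f≢0 , v) (f≢0′ , w) with ℕₚ.<-cmp a b
... | tri< a<b _ _ = ⊥-elim (f≢0′ (v b a<b))
... | tri≈ _ a≡b _ = a≡b
... | tri> _ _ b<a = ⊥-elim (f≢0 (w a b<a))

deg-≈ : ∀ {f g a} → f ≈ g → HasDeg f a → HasDeg g a
deg-≈ e (ne , v) = (λ z → ne (trans (at e _) z)) , vanish-≈ e v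

1≢0 : 1ℚ ≢ 0ℚ
1≢0 ()

deg-𝟙 : HasDeg 𝟙 0
deg-𝟙 = 1≢0 , λ { (suc m) _ → refl }

unit⇒deg0 : ∀ {f g} → IsPoly f → IsPoly g → f · g ≈ 𝟙 → HasDeg f 0
unit⇒deg0 {f} {g} (_ , v) (_ , w) e with findDeg _ {f} v | findDeg _ {g} w
... | inj₁ z | _ = ⊥-elim (1≢0 (trans (sym (at e 0)) (at (≈-trans (SR.*-congʳ {g} z) (SR.zeroˡ g)) 0)))
... | inj₂ _ | inj₁ z = ⊥-elim (1≢0 (trans (sym (at e 0)) (at (≈-trans (SR.*-congˡ {f} z) (SR.zeroʳ f)) 0)))
... | inj₂ (a , df) | inj₂ (b , dg) =
  subst (HasDeg f) (ℕₚ.m+n≡0⇒m≡0 a (deg-unique {f · g} (deg-· {f} {g} df dg) (deg-≈ (≈-sym e) deg-𝟙))) df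

-- Series over ℚ have no zero divisors

private
  cancel₀ : ∀ m {g f} → g 0 ≢ 0ℚ → (∀ i → (g · f) i ≡ 0ℚ) → f m ≡ 0ℚ
  f₀≡0 : ∀ {g f} → g 0 ≢ 0ℚ → (∀ i → (g · f) i ≡ 0ℚ) → f 0 ≡ 0ℚ
  f₀≡0 {g} {f} ne e = ℚ-cancel (g 0) (f 0) ne (trans (sym (·-zero-at g f)) (e 0))
  cancel₀ zero {g} {f} ne e = f₀≡0 {g} {f} ne e
  cancel₀ (suc m) {g} {f} ne e = cancel₀ m {g} {tail f} ne λ i →
    trans (at (SR.*-comm g (tail f)) i)
    (trans (sym (ℚₚ.+-identityˡ _))
    (trans (cong (_+ℚ (tail f · g) i) (sym (trans (cong (_*ℚ g (suc i)) (f₀≡0 {g} {f} ne e)) (ℚₚ.*-zeroˡ (g (suc i))))))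
    (trans (sym (·-suc-at f g i)) (trans (at (SR.*-comm f g) (suc i)) (e (suc i))))))

cancel-zero : ∀ n {g f} → g n ≢ 0ℚ → g · f ≈ zeroS → f ≈ zeroS
cancel-zero zero {g} {f} ne e = mk≈ λ m → cancel₀ m {g} {f} ne (at e)
cancel-zero (suc n) {g} {f} ne e with g 0 ℚₚ.≟ 0ℚ
... | no ne₀ = mk≈ λ m → cancel₀ m {g} {f} ne₀ (at e)
... | yes e₀ = cancel-zero n {tail g} {f} ne (mk≈ λ i →
  trans (sym (ℚₚ.+-identityˡ _))
  (trans (cong (_+ℚ (tail g · f) i) (sym (trans (cong (_*ℚ f (suc i)) e₀) (ℚₚ.*-zeroˡ (f (suc i))))))
  (trans (sym (·-suc-at g f i)) (at e (suc i)))))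

cancel-· : ∀ n {g f h} → g n ≢ 0ℚ → g · f ≈ g · h → f ≈ h
cancel-· n {g} {f} {h} ne e = begin
  f                   ≈⟨ solve 2 (λ f h → f := (f :- h) :+ h) ≈-refl f h ⟩
  (f ⊕ ⊖ h) ⊕ h       ≈⟨ SR.+-congʳ (cancel-zero n {g} {f ⊕ ⊖ h} ne (begin
      g · (f ⊕ ⊖ h)     ≈⟨ solve 3 (λ g f h → g :* (f :- h) := g :* f :- g :* h) ≈-refl g f h ⟩
      g · f ⊕ ⊖ (g · h) ≈⟨ SR.+-congʳ e ⟩
      g · h ⊕ ⊖ (g · h) ≈⟨ SR.-‿inverseʳ (g · h) ⟩
      zeroS ∎)) ⟩
  zeroS ⊕ h           ≈⟨ SR.+-identityˡ h ⟩
  h ∎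
  where open S-Solver

-- Bézout identity for polynomials

record Bezout (a b : Series) : Set where
  field
    g a′ b′ u v : Series
    poly-g  : IsPoly g
    poly-a′ : IsPoly a′
    poly-b′ : IsPoly b′
    poly-u  : IsPoly u
    poly-v  : IsPoly v
    a≈ : a ≈ a′ · g
    b≈ : b ≈ b′ · g
    g≈ : g ≈ u · a ⊕ v · b

bezout-sym : ∀ {a b} → Bezout a b → Bezout b a
bezout-sym {a} {b} z = record
  { g = g ; a′ = b′ ; b′ = a′ ; u = v ; v = u ; poly-g = poly-g ; poly-a′ = poly-b′ ; poly-b′ = poly-a′
  ; poly-u = poly-v ; poly-v = poly-u ; a≈ = b≈ ; b≈ = a≈ ; g≈ = ≈-trans g≈ (SR.+-comm (u · a) (v · b)) }
  where open Bezout z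

bezout-zero : ∀ {a b} → a ≈ zeroS → IsPoly b → Bezout a b
bezout-zero {a} {b} z pb = record
  { g = b ; a′ = zeroS ; b′ = 𝟙 ; u = zeroS ; v = 𝟙 ; poly-g = pb ; poly-a′ = poly-zero ; poly-b′ = poly-𝟙
  ; poly-u = poly-zero ; poly-v = poly-𝟙
  ; a≈ = ≈-trans z (≈-sym (SR.zeroˡ b)) ; b≈ = ≈-sym (SR.*-identityˡ b)
  ; g≈ = ≈-sym (≈-trans (SR.+-cong (SR.zeroˡ a) (SR.*-identityˡ b)) (SR.+-identityˡ b)) }

bezout-step : ∀ {a b} t → IsPoly t → Bezout (a ⊕ ⊖ (t · b)) b → Bezout a b
bezout-step {a} {b} t pt z = record
  { g = g ; a′ = a′ ⊕ t · b′ ; b′ = b′ ; u = u ; v = v ⊕ ⊖ (u · t) ; poly-g = poly-g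
  ; poly-a′ = poly-⊕ poly-a′ (poly-· pt poly-b′) ; poly-b′ = poly-b′
  ; poly-u = poly-u ; poly-v = poly-⊕ poly-v (poly-⊖ (poly-· poly-u pt))
  ; a≈ = begin
      a                           ≈⟨ solve 3 (λ a t b → a := (a :- t :* b) :+ t :* b) ≈-refl a t b ⟩
      (a ⊕ ⊖ (t · b)) ⊕ t · b     ≈⟨ SR.+-cong a≈ (SR.*-congˡ b≈) ⟩
      a′ · g ⊕ t · (b′ · g)       ≈⟨ solve 4 (λ a t b g → a :* g :+ t :* (b :* g) := (a :+ t :* b) :* g) ≈-refl a′ t b′ g ⟩
      (a′ ⊕ t · b′) · g ∎
  ; b≈ = b≈
  ; g≈ = begin
      g                           ≈⟨ g≈ ⟩
      u · (a ⊕ ⊖ (t · b)) ⊕ v · b ≈⟨ solve 5 (λ u a t b v → u :* (a :- t :* b) :+ v :* b := u :* a :+ (v :- u :* t) :* b) ≈-refl u a t b v ⟩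
      u · a ⊕ (v ⊕ ⊖ (u · t)) · b ∎ }
  where
    open Bezout z
    open S-Solver

lead-cancel : ∀ {a b p q} → q ≤ p → VanishFrom (suc p) a → VanishFrom (suc q) b → b q ≢ 0ℚ →
  Σ Series λ t → IsPoly t × VanishFrom p (a ⊕ ⊖ (t · b))
lead-cancel {a} {b} {p} {q} q≤p va vb ne = t , poly-· (poly-const c) (poly-x^ (p ∸ q)) , vanish-lower {d} vd dp
  where
    r = proj₁ (ℚ-inverse (b q) ne)
    c = a p *ℚ r
    t = const c · x^ (p ∸ q)
    d = a ⊕ ⊖ (t · b)
    t·b-at : ∀ m → (t · b) (p ∸ q + m) ≡ c *ℚ b m
    t·b-at m = trans (at (SR.*-assoc (const c) (x^ (p ∸ q)) b) _)
      (trans (·-at (const c) (x^ (p ∸ q) · b) _) (trans (const-⊛ c (x^ (p ∸ q) · b) _) (cong (c *ℚ_) (x^-shift (p ∸ q) b m))))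
    vtb : VanishFrom (suc p) (t · b)
    vtb m p<m = trans (cong (t · b) (sym eq)) (trans (t·b-at m′) (trans (cong (c *ℚ_) (vb m′ q<m′)) (ℚₚ.*-zeroʳ c)))
      where
        m′ = m ∸ (p ∸ q)
        eq : p ∸ q + m′ ≡ m
        eq = ℕₚ.m+[n∸m]≡n (ℕₚ.≤-trans (ℕₚ.m∸n≤m p q) (ℕₚ.<⇒≤ p<m))
        q<m′ : q < m′
        q<m′ = ℕₚ.+-cancelˡ-< (p ∸ q) q m′ (subst (p ∸ q + q <_) (sym eq) (subst (_< m) (sym (ℕₚ.m∸n+n≡m q≤p)) p<m))
    vd : VanishFrom (suc p) d
    vd = vanish-⊕ {a} va (vanish-⊖ {t · b} vtb)
    dp : d p ≡ 0ℚ
    dp = trans (⊕-at a (⊖ (t · b)) p) (trans (cong (a p +ℚ_) (trans (⊖-at (t · b) p) (cong -ℚ_ (t·b-lead)))) (ℚₚ.+-inverseʳ (a p)))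
      where
        t·b-lead : (t · b) p ≡ a p
        t·b-lead = trans (cong (t · b) (sym (ℕₚ.m∸n+n≡m q≤p))) (trans (t·b-at q)
          (trans (ℚₚ.*-assoc (a p) r (b q)) (trans (cong (a p *ℚ_) (proj₂ (ℚ-inverse (b q) ne))) (ℚₚ.*-identityʳ (a p)))))

bezout : ∀ {a b} → IsPoly a → IsPoly b → Bezout a b
bezout (p , va) (q , vb) = go (p + q) p q ℕₚ.≤-refl va vb
  where
    go : ∀ N p q {a b} → p + q ≤ N → VanishFrom p a → VanishFrom q b → Bezout a b
    go N zero q {a} {b} _ va vb = bezout-zero (mk≈ λ m → va m z≤n) (q , vb)
    go N (suc p) zero {a} {b} _ va vb = bezout-sym (bezout-zero (mk≈ λ m → vb m z≤n) (suc p , va))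
    go (suc N) (suc p) (suc q) {a} {b} (s≤s le) va vb with a p ℚₚ.≟ 0ℚ | b q ℚₚ.≟ 0ℚ
    ... | yes e | _ = go N p (suc q) le (vanish-lower {a} va e) vb
    ... | no _ | yes e = go N (suc p) q (subst (_≤ N) (ℕₚ.+-suc p q) le) va (vanish-lower {b} vb e)
    ... | no nea | no neb with ℕₚ.≤-total q p
    ...   | inj₁ q≤p with lead-cancel {a} {b} q≤p va vb neb
    ...     | t , pt , v = bezout-step t pt (go N p (suc q) le v vb)
    go (suc N) (suc p) (suc q) {a} {b} (s≤s le) va vb | no nea | no neb | inj₂ p≤q with lead-cancel {b} {a} p≤q vb va nea
    ...     | t , pt , v = bezout-sym (bezout-step t pt (bezout-sym (go N (suc p) q (subst (_≤ N) (ℕₚ.+-suc p q) le) va v)))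

-- Counting elements of a given order in ℤ/k

ind : ∀ {P : Set} → Dec P → ℕ
ind p = if does p then 1 else 0

ind-yes : ∀ {P : Set} (p : Dec P) → P → ind p ≡ 1
ind-yes (yes _) _ = refl
ind-yes (no ¬p) p = ⊥-elim (¬p p)

ind-no : ∀ {P : Set} (p : Dec P) → ¬ P → ind p ≡ 0
ind-no (yes p) ¬p = ⊥-elim (¬p p)
ind-no (no _) _ = refl

ind-⇔ : ∀ {P Q : Set} (p : Dec P) (q : Dec Q) → (P → Q) → (Q → P) → ind p ≡ ind q
ind-⇔ (yes p) q f g = sym (ind-yes q (f p))
ind-⇔ (no ¬p) q f g = sym (ind-no q (λ z → ¬p (g z)))

sumUp : (ℕ → ℕ) → ℕ → ℕ
sumUp f zero = 0
sumUp f (suc n) = f 0 + sumUp (λ i → f (suc i)) n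

sumUp-cong : ∀ n {f g} → (∀ i → i < n → f i ≡ g i) → sumUp f n ≡ sumUp g n
sumUp-cong zero e = refl
sumUp-cong (suc n) e = cong₂ _+_ (e 0 (s≤s z≤n)) (sumUp-cong n λ i i<n → e (suc i) (s≤s i<n))

sumUp-zero : ∀ n {f} → (∀ i → i < n → f i ≡ 0) → sumUp f n ≡ 0
sumUp-zero zero e = refl
sumUp-zero (suc n) e = cong₂ _+_ (e 0 (s≤s z≤n)) (sumUp-zero n λ i i<n → e (suc i) (s≤s i<n))

sumUp-+ : ∀ n f g → sumUp (λ i → f i + g i) n ≡ sumUp f n + sumUp g n
sumUp-+ zero f g = refl
sumUp-+ (suc n) f g = trans (cong ((f 0 + g 0) +_) (sumUp-+ n (λ i → f (suc i)) (λ i → g (suc i))))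
  (solve 4 (λ a b c d → a :+ b :+ (c :+ d) := a :+ c :+ (b :+ d)) refl (f 0) (g 0) _ _)
  where
    open import Data.Nat.Solver
    open +-*-Solver

sumUp-split : ∀ a b f → sumUp f (a + b) ≡ sumUp f a + sumUp (λ i → f (a + i)) b
sumUp-split zero b f = refl
sumUp-split (suc a) b f = trans (cong (f 0 +_) (sumUp-split a b (λ i → f (suc i)))) (sym (ℕₚ.+-assoc (f 0) _ _))

sumUp-term : ∀ n f i → i < n → f i ≤ sumUp f n
sumUp-term (suc n) f zero _ = ℕₚ.m≤m+n (f 0) _
sumUp-term (suc n) f (suc i) (s≤s i<n) = ℕₚ.≤-trans (sumUp-term n (λ j → f (suc j)) i i<n) (ℕₚ.m≤n+m _ (f 0))

count-multiples : ∀ q m → 1 ≤ q → sumUp (λ i → ind (q ∣? i)) (m * q) ≡ m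
count-multiples q zero _ = refl
count-multiples (suc q) (suc m) 1≤q = trans (sumUp-split (suc q) (m * suc q) (λ i → ind (suc q ∣? i)))
  (cong₂ _+_
    (cong₂ _+_ (ind-yes (suc q ∣? 0) (suc q ∣0)) (sumUp-zero q λ i i<q → ind-no (suc q ∣? suc i) (>⇒∤ (s≤s i<q))))
    (trans (sumUp-cong (m * suc q) λ i _ → ind-⇔ (suc q ∣? (suc q + i)) (suc q ∣? i) (λ d → ∣m+n∣m⇒∣n d ∣-refl) (∣m∣n⇒∣m+n ∣-refl))
           (count-multiples (suc q) m 1≤q)))

divs : ℕ → ℕ → List ℕ
divs n j = filter (λ d → d ∣? n) (map suc (upTo j))

divs-snoc : ∀ n j → divs n (suc j) ≡ divs n j ++ filter (λ d → d ∣? n) [ suc j ]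
divs-snoc n j = trans (cong (λ l → filter (λ d → d ∣? n) (map suc l)) (sym (Listₚ.upTo-∷ʳ j)))
  (trans (cong (filter (λ d → d ∣? n)) (Listₚ.map-++ suc (upTo j) [ j ])) (Listₚ.filter-++ (λ d → d ∣? n) (map suc (upTo j)) [ suc j ]))

divs-yes : ∀ n j → suc j ∣ n → divs n (suc j) ≡ divs n j ++ [ suc j ]
divs-yes n j d = trans (divs-snoc n j) (cong (divs n j ++_) (Listₚ.filter-accept (λ d → d ∣? n) d))

divs-no : ∀ n j → ¬ suc j ∣ n → divs n (suc j) ≡ divs n j
divs-no n j d = trans (divs-snoc n j) (trans (cong (divs n j ++_) (Listₚ.filter-reject (λ d → d ∣? n) d)) (Listₚ.++-identityʳ _))

divs-All : ∀ n j → All (λ d → 1 ≤ d × d ≤ j × d ∣ n) (divs n j)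
divs-All n zero = []
divs-All n (suc j) with suc j ∣? n
... | yes d = subst (All _) (sym (divs-yes n j d))
  (Allₚ.++⁺ (All.map (λ (a , b , c) → a , ℕₚ.m≤n⇒m≤1+n b , c) (divs-All n j)) ((s≤s z≤n , ℕₚ.≤-refl , d) ∷ []))
... | no ¬d = subst (All _) (sym (divs-no n j ¬d)) (All.map (λ (a , b , c) → a , ℕₚ.m≤n⇒m≤1+n b , c) (divs-All n j))

sum-map-∷ʳ : ∀ (f : ℕ → ℕ) xs y → sum (map f (xs ++ [ y ])) ≡ sum (map f xs) + f y
sum-map-∷ʳ f xs y = trans (cong sum (Listₚ.map-++ f xs [ y ])) (trans (sum-++ (map f xs) [ f y ]) (cong (_+_ (sum (map f xs))) (ℕₚ.+-identityʳ (f y))))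
  where open import Data.Nat.ListAction.Properties using (sum-++)

module Order (k : ℕ) (1≤k : 1 ≤ k) where

  instance
    k≢0 : NonZero k
    k≢0 = >-nonZero 1≤k

  ord : ℕ → ℕ
  ord i = quotient (gcd[m,n]∣n i k)

  ord·gcd : ∀ i → k ≡ ord i * gcd i k
  ord·gcd i = _∣_.equality (gcd[m,n]∣n i k)

  gcd≢0 : ∀ i → NonZero (gcd i k)
  gcd≢0 i = ≢-nonZero (gcd[m,n]≢0 i k (inj₂ λ e → ℕₚ.<⇒≢ 1≤k (sym e)))

  ord≥1 : ∀ i → 1 ≤ ord i
  ord≥1 i with ord i | ord·gcd i
  ... | zero | e = ⊥-elim (ℕₚ.<⇒≢ 1≤k (sym e))
  ... | suc o | _ = s≤s z≤n

  ord∣⇒ : ∀ i m → ord i ∣ m → k ∣ m * i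
  ord∣⇒ i m o∣m = subst (_∣ m * i) (sym (ord·gcd i)) (*-pres-∣ o∣m (gcd[m,n]∣m i k))

  ⇒ord∣ : ∀ i m → k ∣ m * i → ord i ∣ m
  ⇒ord∣ i m d = *-cancelʳ-∣ (gcd i k) {{gcd≢0 i}}
    (subst (_∣ m * gcd i k) (ord·gcd i)
      (subst (k ∣_) (sym (c*gcd[m,n]≡gcd[cm,cn] m i k)) (gcd-greatest d (n∣m*n m))))

  ofOrder : ℕ → ℕ
  ofOrder d = sumUp (λ i → ind (ord i ≟ d)) k

  sum-ofOrder : ∀ m j → sum (map ofOrder (divs m j)) ≡ sumUp (λ i → ind (ord i ∣? m ×-dec ord i ≤? j)) k
  sum-ofOrder m zero = sym (sumUp-zero k λ i _ → ind-no (ord i ∣? m ×-dec ord i ≤? 0) λ (_ , o≤0) → ℕₚ.<⇒≱ (ord≥1 i) o≤0)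
  sum-ofOrder m (suc j) with suc j ∣? m
  ... | yes d = trans (cong (λ l → sum (map ofOrder l)) (divs-yes m j d))
      (trans (sum-map-∷ʳ ofOrder (divs m j) (suc j))
      (trans (cong (_+ ofOrder (suc j)) (sum-ofOrder m j))
      (trans (sym (sumUp-+ k (λ i → ind (ord i ∣? m ×-dec ord i ≤? j)) (λ i → ind (ord i ≟ suc j))))
      (sumUp-cong k λ i _ → pointwise i))))
    where
      pointwise : ∀ i → ind (ord i ∣? m ×-dec ord i ≤? j) + ind (ord i ≟ suc j) ≡ ind (ord i ∣? m ×-dec ord i ≤? suc j)
      pointwise i = cases (ord i ≟ suc j)
        where
          cases : (p : Dec (ord i ≡ suc j)) → ind (ord i ∣? m ×-dec ord i ≤? j) + ind p ≡ ind (ord i ∣? m ×-dec ord i ≤? suc j)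
          cases (yes e) = trans (cong (_+ 1) (ind-no (ord i ∣? m ×-dec ord i ≤? j) λ (_ , o≤j) → ℕₚ.<⇒≱ (subst (j <_) (sym e) ℕₚ.≤-refl) o≤j))
            (sym (ind-yes (ord i ∣? m ×-dec ord i ≤? suc j) (subst (_∣ m) (sym e) d , ℕₚ.≤-reflexive e)))
          cases (no ne) = trans (ℕₚ.+-identityʳ _) (ind-⇔ (ord i ∣? m ×-dec ord i ≤? j) (ord i ∣? m ×-dec ord i ≤? suc j)
            (λ (a , b) → a , ℕₚ.m≤n⇒m≤1+n b) λ (a , b) → a , ℕₚ.≤-pred (ℕₚ.≤∧≢⇒< b ne))
  ... | no ¬d = trans (cong (λ l → sum (map ofOrder l)) (divs-no m j ¬d)) (trans (sum-ofOrder m j)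
      (sumUp-cong k λ i _ → ind-⇔ (ord i ∣? m ×-dec ord i ≤? j) (ord i ∣? m ×-dec ord i ≤? suc j)
         (λ (a , b) → a , ℕₚ.m≤n⇒m≤1+n b)
         λ (a , b) → a , ℕₚ.≤-pred (ℕₚ.≤∧≢⇒< b λ e → ¬d (subst (_∣ m) e a))))

  sum-ofOrder-divisors : ∀ m → 1 ≤ m → m ∣ k → sum (map ofOrder (divs m m)) ≡ m
  sum-ofOrder-divisors m 1≤m m∣k = trans (sum-ofOrder m m) (trans (sumUp-cong k λ i _ → eq i)
      (trans (cong (sumUp (λ i → ind (q ∣? i))) (trans k≡ (ℕₚ.*-comm q m))) (count-multiples q m 1≤q)))
    where
      instance
        m≢0 : NonZero m
        m≢0 = >-nonZero 1≤m
      q = quotient m∣k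
      k≡ : k ≡ q * m
      k≡ = _∣_.equality m∣k
      1≤q : 1 ≤ q
      1≤q = ℕₚ.n≢0⇒n>0 λ e → ℕₚ.<⇒≢ 1≤k (sym (trans k≡ (cong (_* m) e)))
      eq : ∀ i → ind (ord i ∣? m ×-dec ord i ≤? m) ≡ ind (q ∣? i)
      eq i = ind-⇔ (ord i ∣? m ×-dec ord i ≤? m) (q ∣? i)
        (λ (a , _) → *-cancelˡ-∣ m (subst (_∣ m * i) (trans k≡ (ℕₚ.*-comm q m)) (ord∣⇒ i m a)))
        (λ d → let o∣m = ⇒ord∣ i m (subst (_∣ m * i) (trans (ℕₚ.*-comm m q) (sym k≡)) (*-monoʳ-∣ m d)) in o∣m , ∣⇒≤ o∣m)

  ofOrder-k≥1 : 1 ≤ ofOrder k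
  ofOrder-k≥1 with k ≟ 1
  ... | yes e = subst (_≤ ofOrder k) (ind-yes (ord 0 ≟ k) o≡k) (sumUp-term k (λ i → ind (ord i ≟ k)) 0 1≤k)
    where
      o≡k : ord 0 ≡ k
      o≡k = ∣-antisym (subst (ord 0 ∣_) (sym (ord·gcd 0)) (m∣m*n (gcd 0 k))) (subst (_∣ ord 0) (sym e) (1∣ ord 0))
  ... | no ne = subst (_≤ ofOrder k) (ind-yes (ord 1 ≟ k) o≡k) (sumUp-term k (λ i → ind (ord i ≟ k)) 1 (ℕₚ.≤∧≢⇒< 1≤k λ e → ne (sym e)))
    where
      o≡k : ord 1 ≡ k
      o≡k = ∣-antisym (subst (ord 1 ∣_) (sym (ord·gcd 1)) (m∣m*n (gcd 1 k)))
              (subst (k ∣_) (ℕₚ.*-identityʳ (ord 1)) (ord∣⇒ 1 (ord 1) ∣-refl))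

  determined : (δ : ℕ → ℕ) → (∀ m → 1 ≤ m → sum (map δ (divs m m)) ≡ m) → ∀ m → 1 ≤ m → m ∣ k → δ m ≡ ofOrder m
  determined δ sum-δ = <-rec _ go
    where
      sum-agree : ∀ {xs} → All (λ d → δ d ≡ ofOrder d) xs → sum (map δ xs) ≡ sum (map ofOrder xs)
      sum-agree [] = refl
      sum-agree (e ∷ es) = cong₂ _+_ e (sum-agree es)
      go : ∀ m → (∀ {d} → d < m → 1 ≤ d → d ∣ k → δ d ≡ ofOrder d) → 1 ≤ m → m ∣ k → δ m ≡ ofOrder m
      go (suc m) rec 1≤m m∣k = ℕₚ.+-cancelˡ-≡ (sum (map δ (divs (suc m) m))) _ _
        (trans (sym (sum-map-∷ʳ δ (divs (suc m) m) (suc m)))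
        (trans (cong (λ l → sum (map δ l)) (sym (divs-yes (suc m) m ∣-refl)))
        (trans (sum-δ (suc m) 1≤m)
        (trans (sym (sum-ofOrder-divisors (suc m) 1≤m m∣k))
        (trans (cong (λ l → sum (map ofOrder l)) (divs-yes (suc m) m ∣-refl))
        (trans (sum-map-∷ʳ ofOrder (divs (suc m) m) (suc m))
        (cong (_+ ofOrder (suc m)) (sym (sum-agree (All.map (λ (a , b , c) → rec (s≤s b) a (∣-trans c m∣k)) (divs-All (suc m) m)))))))))))

ℕtoℚ-mkℚ : ∀ a → ℕtoℚ a ≡ ℚ.mkℚ (ℤ.+ a) 0 (Coprimality.sym (Coprimality.1-coprimeTo a))
ℕtoℚ-mkℚ a = ℚₚ.normalize-coprime (Coprimality.sym (Coprimality.1-coprimeTo a))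

ℕtoℚ-+ : ∀ a b → ℕtoℚ (a + b) ≡ ℕtoℚ a +ℚ ℕtoℚ b
ℕtoℚ-+ a b = sym (trans (cong₂ _+ℚ_ (ℕtoℚ-mkℚ a) (ℕtoℚ-mkℚ b))
  (cong (ℚ._/ 1) (cong₂ ℤ._+_ (ℤₚ.*-identityʳ (ℤ.+ a)) (ℤₚ.*-identityʳ (ℤ.+ b)))))

ℕtoℚ-≢0 : ∀ a → 1 ≤ a → ℕtoℚ a ≢ 0ℚ
ℕtoℚ-≢0 (suc a) _ e with trans (sym (ℕtoℚ-mkℚ (suc a))) e
... | ()

-- The derivation x d/dx

θ : Series → Series
θ f m = ℕtoℚ m *ℚ f m

sumTo-cong-≤ : ∀ {f g} m → (∀ i → i ≤ m → f i ≡ g i) → sumTo f m ≡ sumTo g m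
sumTo-cong-≤ zero e = e 0 z≤n
sumTo-cong-≤ (suc m) e = cong₂ _+ℚ_ (sumTo-cong-≤ m λ i i≤m → e i (ℕₚ.m≤n⇒m≤1+n i≤m)) (e (suc m) ℕₚ.≤-refl)

sumTo-+ : ∀ f g m → sumTo (λ i → f i +ℚ g i) m ≡ sumTo f m +ℚ sumTo g m
sumTo-+ f g zero = refl
sumTo-+ f g (suc m) = trans (cong (_+ℚ (f (suc m) +ℚ g (suc m))) (sumTo-+ f g m))
  (solve 4 (λ a b c d → a :+ b :+ (c :+ d) := a :+ c :+ (b :+ d)) refl (sumTo f m) (sumTo g m) (f (suc m)) (g (suc m)))
  where open ℚ-Solver

sumTo-* : ∀ c f m → sumTo (λ i → c *ℚ f i) m ≡ c *ℚ sumTo f m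
sumTo-* c f zero = refl
sumTo-* c f (suc m) = trans (cong (_+ℚ (c *ℚ f (suc m))) (sumTo-* c f m)) (sym (ℚₚ.*-distribˡ-+ c _ _))

θ-leibniz : ∀ f g → θ (f · g) ≈ θ f · g ⊕ f · θ g
θ-leibniz f g = mk≈ λ m → ≡R.begin
  ℕtoℚ m *ℚ (f · g) m    ≡R.≡⟨ cong (ℕtoℚ m *ℚ_) (·-at f g m) ⟩
  ℕtoℚ m *ℚ (f ⊛ g) m    ≡R.≡⟨ sym (sumTo-* (ℕtoℚ m) (λ i → f i *ℚ g (m ∸ i)) m) ⟩
  sumTo (λ i → ℕtoℚ m *ℚ (f i *ℚ g (m ∸ i))) m ≡R.≡⟨ sumTo-cong-≤ m (λ i i≤m →
      trans (cong (λ t → t *ℚ (f i *ℚ g (m ∸ i))) (trans (cong ℕtoℚ (sym (ℕₚ.m+[n∸m]≡n i≤m))) (ℕtoℚ-+ i (m ∸ i))))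
            (solve 4 (λ a b c d → (a :+ b) :* (c :* d) := (a :* c) :* d :+ c :* (b :* d)) refl (ℕtoℚ i) (ℕtoℚ (m ∸ i)) (f i) (g (m ∸ i)))) ⟩
  sumTo (λ i → θ f i *ℚ g (m ∸ i) +ℚ f i *ℚ θ g (m ∸ i)) m ≡R.≡⟨ sumTo-+ (λ i → θ f i *ℚ g (m ∸ i)) (λ i → f i *ℚ θ g (m ∸ i)) m ⟩
  (θ f ⊛ g) m +ℚ (f ⊛ θ g) m  ≡R.≡⟨ sym (trans (⊕-at (θ f · g) (f · θ g) m) (cong₂ _+ℚ_ (·-at (θ f) g m) (·-at f (θ g) m))) ⟩
  (θ f · g ⊕ f · θ g) m ≡R.∎
  where
    open ℚ-Solver
    module ≡R = ≡-Reasoning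

poly-θ : ∀ {f} → IsPoly f → IsPoly (θ f)
poly-θ (n , v) = n , λ m n≤m → trans (cong (ℕtoℚ m *ℚ_) (v m n≤m)) (ℚₚ.*-zeroʳ (ℕtoℚ m))

oneMinus : ℕ → Series
oneMinus n = 𝟙 ⊕ ⊖ (x^ n)

poly-oneMinus : ∀ n → IsPoly (oneMinus n)
poly-oneMinus n = poly-⊕ poly-𝟙 (poly-⊖ (poly-x^ n))

oneMinus-at : ∀ n m → oneMinus n m ≡ oneMinusXPow n m
oneMinus-at n m = trans (⊕-at 𝟙 (⊖ x^ n) m) (cong₂ _+ℚ_ (at 𝟙≈oneS m) (⊖-at (x^ n) m))

oneMinus-+ : ∀ a b → oneMinus (a + b) ≈ oneMinus a ⊕ x^ a · oneMinus b
oneMinus-+ a b = begin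
  𝟙 ⊕ ⊖ x^ (a + b)    ≈⟨ SR.+-congˡ (SR.-‿cong (x^-+ a b)) ⟩
  𝟙 ⊕ ⊖ (x^ a · x^ b) ≈⟨ solve 2 (λ a b → con 1ℚ :- a :* b := (con 1ℚ :- a) :+ a :* (con 1ℚ :- b)) ≈-refl (x^ a) (x^ b) ⟩
  oneMinus a ⊕ x^ a · oneMinus b ∎
  where open S-Solver

θ-oneMinus : ∀ n → θ (oneMinus n) ≈ ⊖ (const (ℕtoℚ n) · x^ n)
θ-oneMinus n = mk≈ λ m → ≡R.begin
  ℕtoℚ m *ℚ (𝟙 ⊕ ⊖ x^ n) m   ≡R.≡⟨ cong (ℕtoℚ m *ℚ_) (trans (⊕-at 𝟙 (⊖ x^ n) m) (cong (𝟙 m +ℚ_) (⊖-at (x^ n) m))) ⟩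
  ℕtoℚ m *ℚ (𝟙 m +ℚ -ℚ x^ n m) ≡R.≡⟨ solve 3 (λ a b c → a :* (b :- c) := a :* b :+ :- (a :* c)) refl (ℕtoℚ m) (𝟙 m) (x^ n m) ⟩
  ℕtoℚ m *ℚ 𝟙 m +ℚ -ℚ (ℕtoℚ m *ℚ x^ n m) ≡R.≡⟨ cong₂ (λ s t → s +ℚ -ℚ t) (θ𝟙 m) (θx^ m n) ⟩
  0ℚ +ℚ -ℚ (ℕtoℚ n *ℚ x^ n m) ≡R.≡⟨ ℚₚ.+-identityˡ _ ⟩
  -ℚ (ℕtoℚ n *ℚ x^ n m) ≡R.≡⟨ sym (trans (⊖-at _ m) (cong -ℚ_ (trans (·-at _ _ m) (const-⊛ (ℕtoℚ n) (x^ n) m)))) ⟩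
  (⊖ (const (ℕtoℚ n) · x^ n)) m ≡R.∎
  where
    open ℚ-Solver
    module ≡R = ≡-Reasoning
    θ𝟙 : ∀ m → ℕtoℚ m *ℚ 𝟙 m ≡ 0ℚ
    θ𝟙 zero = refl
    θ𝟙 (suc m) = ℚₚ.*-zeroʳ (ℕtoℚ (suc m))
    θx^ : ∀ m n → ℕtoℚ m *ℚ x^ n m ≡ ℕtoℚ n *ℚ x^ n m
    θx^ m n with m ≡ᵇ n in eq
    ... | true = cong (λ t → ℕtoℚ t *ℚ 1ℚ) (ℕₚ.≡ᵇ⇒≡ m n (subst T (sym eq) _))
    ... | false = trans (ℚₚ.*-zeroʳ (ℕtoℚ m)) (sym (ℚₚ.*-zeroʳ (ℕtoℚ n)))

Coprime : Series → Series → Set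
Coprime f g = Σ Series λ u → Σ Series λ v → IsPoly u × IsPoly v × u · f ⊕ v · g ≈ 𝟙

coprime-· : ∀ {f g h} → IsPoly f → IsPoly h → Coprime f h → Coprime g h → IsPoly g → Coprime (f · g) h
coprime-· {f} {g} {h} pf ph (u , v , pu , pv , e) (u′ , v′ , pu′ , pv′ , e′) pg =
  u · u′ , u · f · v′ ⊕ v , poly-· pu pu′ , poly-⊕ (poly-· (poly-· pu pf) pv′) pv , (begin
    (u · u′) · (f · g) ⊕ (u · f · v′ ⊕ v) · h ≈⟨ solve 7 (λ u u′ f g v v′ h → (u :* u′) :* (f :* g) :+ (u :* f :* v′ :+ v) :* h
                                                  := u :* f :* (u′ :* g :+ v′ :* h) :+ v :* h) ≈-refl u u′ f g v v′ h ⟩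
    u · f · (u′ · g ⊕ v′ · h) ⊕ v · h         ≈⟨ SR.+-congʳ (≈-trans (SR.*-congˡ e′) (SR.*-identityʳ (u · f))) ⟩
    u · f ⊕ v · h                             ≈⟨ e ⟩
    𝟙 ∎)
  where open S-Solver

coprime-≈ : ∀ {f g h} → f ≈ g → Coprime f h → Coprime g h
coprime-≈ eq (u , v , pu , pv , e) = u , v , pu , pv , ≈-trans (SR.+-congʳ (SR.*-congˡ (≈-sym eq))) e

coprime-+· : ∀ {f h t} → IsPoly t → Coprime f h → Coprime (f ⊕ t · h) h
coprime-+· {f} {h} {t} pt (u , v , pu , pv , e) = u , v ⊕ ⊖ (u · t) , pu , poly-⊕ pv (poly-⊖ (poly-· pu pt)) ,
  ≈-trans (solve 5 (λ u f t h v → u :* (f :+ t :* h) :+ (v :- u :* t) :* h := u :* f :+ v :* h) ≈-refl u f t h v) e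
  where open S-Solver

coprime-𝟙 : ∀ h → Coprime 𝟙 h
coprime-𝟙 h = 𝟙 , zeroS , poly-𝟙 , poly-zero ,
  ≈-trans (SR.+-cong (SR.*-identityˡ 𝟙) (SR.zeroˡ h)) (SR.+-identityʳ 𝟙)

coprime-const : ∀ c h → c ≢ 0ℚ → Coprime (const c) h
coprime-const c h ne = const r , zeroS , poly-const r , poly-zero ,
  ≈-trans (SR.+-cong (≈-trans (≈-sym (const-* r c)) (mk≈ λ { zero → proj₂ (ℚ-inverse c ne) ; (suc m) → refl })) (SR.zeroˡ h)) (SR.+-identityʳ 𝟙)
  where r = proj₁ (ℚ-inverse c ne)

oneMinus-* : ∀ c m → Σ Series λ e → IsPoly e × oneMinus (c * m) ≈ e · oneMinus m
oneMinus-* zero m = zeroS , poly-zero , ≈-trans (≈-trans (SR.+-congˡ (SR.-‿cong x^0≈𝟙)) (SR.-‿inverseʳ 𝟙)) (≈-sym (SR.zeroˡ _))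
oneMinus-* (suc c) m with oneMinus-* c m
... | e , pe , eq = 𝟙 ⊕ x^ m · e , poly-⊕ poly-𝟙 (poly-· (poly-x^ m) pe) , (begin
    oneMinus (m + c * m)                ≈⟨ oneMinus-+ m (c * m) ⟩
    oneMinus m ⊕ x^ m · oneMinus (c * m) ≈⟨ SR.+-congˡ (SR.*-congˡ eq) ⟩
    oneMinus m ⊕ x^ m · (e · oneMinus m) ≈⟨ solve 3 (λ p x e → p :+ x :* (e :* p) := (con 1ℚ :+ x :* e) :* p) ≈-refl (oneMinus m) (x^ m) e ⟩
    (𝟙 ⊕ x^ m · e) · oneMinus m ∎)
  where open S-Solver

private
  oneMinus-combine : ∀ {g a b} x y → g + y * b ≡ x * a →
    Σ Series λ u → Σ Series λ v → IsPoly u × IsPoly v × oneMinus g ≈ u · oneMinus a ⊕ v · oneMinus b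
  oneMinus-combine {g} {a} {b} x y eq with oneMinus-* x a | oneMinus-* y b
  ... | e , pe , e≈ | f , pf , f≈ = e , ⊖ (x^ g · f) , pe , poly-⊖ (poly-· (poly-x^ g) pf) , (begin
      oneMinus g   ≈⟨ solve 2 (λ p t → p := (p :+ t) :- t) ≈-refl (oneMinus g) (x^ g · oneMinus (y * b)) ⟩
      (oneMinus g ⊕ x^ g · oneMinus (y * b)) ⊕ ⊖ (x^ g · oneMinus (y * b)) ≈⟨ SR.+-congʳ (≈-sym (oneMinus-+ g (y * b))) ⟩
      oneMinus (g + y * b) ⊕ ⊖ (x^ g · oneMinus (y * b)) ≈⟨ SR.+-cong (≈-trans (SR.reflexive (cong oneMinus eq)) e≈) (SR.-‿cong (SR.*-congˡ f≈)) ⟩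
      e · oneMinus a ⊕ ⊖ (x^ g · (f · oneMinus b)) ≈⟨ SR.+-congˡ (solve 3 (λ x f p → :- (x :* (f :* p)) := (:- (x :* f)) :* p) ≈-refl (x^ g) f (oneMinus b)) ⟩
      e · oneMinus a ⊕ (⊖ (x^ g · f)) · oneMinus b ∎)
    where open S-Solver

oneMinus-Bézout : ∀ g a b → Bézout.Identity.Identity g a b →
  Σ Series λ u → Σ Series λ v → IsPoly u × IsPoly v × oneMinus g ≈ u · oneMinus a ⊕ v · oneMinus b
oneMinus-Bézout g a b (Bézout.Identity.+- x y eq) = oneMinus-combine x y eq
oneMinus-Bézout g a b (Bézout.Identity.-+ x y eq) = flip (oneMinus-combine {g} {b} {a} y x eq)
  where
    flip : (Σ Series λ u → Σ Series λ v → IsPoly u × IsPoly v × oneMinus g ≈ u · oneMinus b ⊕ v · oneMinus a) →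
      Σ Series λ u → Σ Series λ v → IsPoly u × IsPoly v × oneMinus g ≈ u · oneMinus a ⊕ v · oneMinus b
    flip (u , v , pu , pv , e) = v , u , pv , pu , ≈-trans e (SR.+-comm (u · oneMinus b) (v · oneMinus a))

oneMinus-gcd : ∀ a b → Σ Series λ u → Σ Series λ v → IsPoly u × IsPoly v × oneMinus (gcd a b) ≈ u · oneMinus a ⊕ v · oneMinus b
oneMinus-gcd a b = oneMinus-Bézout (gcd a b) a b (Bézout.identity (gcd-GCD a b))

module Cyclotomic (Ψ : ℕ → Poly) (cyc : IsCyclotomic Ψ) where

  ψ : ℕ → Series
  ψ d = coeff (Ψ d)

  prodψ : List ℕ → Series
  prodψ [] = 𝟙
  prodψ (d ∷ ds) = ψ d · prodψ ds

  prodψ-spec : ∀ ds → prodS (map ψ ds) ≈ prodψ ds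
  prodψ-spec [] = mk≈ λ m → sym (at 𝟙≈oneS m)
  prodψ-spec (d ∷ ds) = ≈-trans (≈-trans (⊛-cong {f = ψ d} ≈-refl (prodψ-spec ds)) (mk≈ λ m → sym (·-at (ψ d) (prodψ ds) m))) ≈-refl

  prodψ-++ : ∀ xs ys → prodψ (xs ++ ys) ≈ prodψ xs · prodψ ys
  prodψ-++ [] ys = ≈-sym (SR.*-identityˡ _)
  prodψ-++ (x ∷ xs) ys = ≈-trans (SR.*-congˡ (prodψ-++ xs ys)) (≈-sym (SR.*-assoc (ψ x) (prodψ xs) (prodψ ys)))

  prodψ-∷ʳ : ∀ xs y → prodψ (xs ++ [ y ]) ≈ prodψ xs · ψ y
  prodψ-∷ʳ xs y = ≈-trans (prodψ-++ xs [ y ]) (SR.*-congˡ (SR.*-identityʳ (ψ y)))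

  poly-prodψ : ∀ xs → IsPoly (prodψ xs)
  poly-prodψ [] = poly-𝟙
  poly-prodψ (x ∷ xs) = poly-· (poly-coeff (Ψ x)) (poly-prodψ xs)

  prodψ-divisors : ∀ n → 1 ≤ n → prodψ (divs n n) ≈ oneMinus n
  prodψ-divisors n 1≤n = ≈-trans (≈-sym (prodψ-spec (divs n n))) (mk≈ λ m → trans (cyc n 1≤n m) (sym (oneMinus-at n m)))

  Divides : Series → Series → Set
  Divides f g = Σ Series λ e → IsPoly e × g ≈ f · e

  divides-divs : ∀ g k → g ∣ k → ∀ j → Divides (prodψ (divs g j)) (prodψ (divs k j))
  divides-divs g k g∣k zero = 𝟙 , poly-𝟙 , ≈-sym (SR.*-identityˡ 𝟙)
  divides-divs g k g∣k (suc j) with divides-divs g k g∣k j | suc j ∣? g | suc j ∣? k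
  ... | e , pe , eq | yes d | no ¬d = ⊥-elim (¬d (∣-trans d g∣k))
  ... | e , pe , eq | no ¬d | no ¬d′ = e , pe ,
      subst (λ l → prodψ (divs k (suc j)) ≈ prodψ l · e) (sym (divs-no g j ¬d))
        (subst (λ l → prodψ l ≈ prodψ (divs g j) · e) (sym (divs-no k j ¬d′)) eq)
  ... | e , pe , eq | yes d | yes d′ = e , pe ,
      subst (λ l → prodψ (divs k (suc j)) ≈ prodψ l · e) (sym (divs-yes g j d))
        (subst (λ l → prodψ l ≈ prodψ (divs g j ++ [ suc j ]) · e) (sym (divs-yes k j d′)) (begin
          prodψ (divs k j ++ [ suc j ])        ≈⟨ prodψ-∷ʳ (divs k j) (suc j) ⟩
          prodψ (divs k j) · ψ (suc j)         ≈⟨ SR.*-congʳ eq ⟩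
          prodψ (divs g j) · e · ψ (suc j)     ≈⟨ solve 3 (λ p e s → p :* e :* s := p :* s :* e) ≈-refl (prodψ (divs g j)) e (ψ (suc j)) ⟩
          prodψ (divs g j) · ψ (suc j) · e     ≈⟨ SR.*-congʳ (≈-sym (prodψ-∷ʳ (divs g j) (suc j))) ⟩
          prodψ (divs g j ++ [ suc j ]) · e ∎))
    where open S-Solver
  ... | e , pe , eq | no ¬d | yes d′ = e · ψ (suc j) , poly-· pe (poly-coeff (Ψ (suc j))) ,
      subst (λ l → prodψ (divs k (suc j)) ≈ prodψ l · (e · ψ (suc j))) (sym (divs-no g j ¬d))
        (subst (λ l → prodψ l ≈ prodψ (divs g j) · (e · ψ (suc j))) (sym (divs-yes k j d′)) (begin
          prodψ (divs k j ++ [ suc j ])        ≈⟨ prodψ-∷ʳ (divs k j) (suc j) ⟩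
          prodψ (divs k j) · ψ (suc j)         ≈⟨ SR.*-congʳ eq ⟩
          prodψ (divs g j) · e · ψ (suc j)     ≈⟨ SR.*-assoc (prodψ (divs g j)) e (ψ (suc j)) ⟩
          prodψ (divs g j) · (e · ψ (suc j)) ∎))

  divides-divs-+ : ∀ k j i → Divides (prodψ (divs k j)) (prodψ (divs k (i + j)))
  divides-divs-+ k j zero = 𝟙 , poly-𝟙 , ≈-sym (SR.*-identityʳ _)
  divides-divs-+ k j (suc i) with divides-divs-+ k j i | suc (i + j) ∣? k
  ... | e , pe , eq | no ¬d = e , pe , subst (λ l → prodψ l ≈ prodψ (divs k j) · e) (sym (divs-no k (i + j) ¬d)) eq
  ... | e , pe , eq | yes d = e · ψ (suc (i + j)) , poly-· pe (poly-coeff (Ψ (suc (i + j)))) ,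
      subst (λ l → prodψ l ≈ prodψ (divs k j) · (e · ψ (suc (i + j)))) (sym (divs-yes k (i + j) d)) (begin
          prodψ (divs k (i + j) ++ [ suc (i + j) ])  ≈⟨ prodψ-∷ʳ (divs k (i + j)) (suc (i + j)) ⟩
          prodψ (divs k (i + j)) · ψ (suc (i + j))   ≈⟨ SR.*-congʳ eq ⟩
          prodψ (divs k j) · e · ψ (suc (i + j))     ≈⟨ SR.*-assoc (prodψ (divs k j)) e (ψ (suc (i + j))) ⟩
          prodψ (divs k j) · (e · ψ (suc (i + j))) ∎)

  cofactor : ℕ → Series
  cofactor k′ = prodψ (divs (suc k′) k′)

  cofactor-· : ∀ k′ → cofactor k′ · ψ (suc k′) ≈ oneMinus (suc k′)
  cofactor-· k′ = ≈-trans (≈-sym (prodψ-∷ʳ (divs (suc k′) k′) (suc k′)))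
    (subst (λ l → prodψ l ≈ oneMinus (suc k′)) (divs-yes (suc k′) k′ ∣-refl) (prodψ-divisors (suc k′) (s≤s z≤n)))

  -- 1 - x^k is squarefree, because it is coprime to its derivative.
  coprime-cofactor : ∀ k′ → Coprime (cofactor k′) (ψ (suc k′))
  coprime-cofactor k′ = const r · ⊖ θ P , const r · (const c · M ⊕ ⊖ θ M) ,
      poly-· (poly-const r) (poly-⊖ (poly-θ pP)) , poly-· (poly-const r) (poly-⊕ (poly-· (poly-const c) pM) (poly-⊖ (poly-θ pM))) , (begin
    (const r · ⊖ θ P) · M ⊕ (const r · (const c · M ⊕ ⊖ θ M)) · P
      ≈⟨ solve 6 (λ r P′ M c M′ P → (r :* (:- P′)) :* M :+ (r :* (c :* M :- M′)) :* P := r :* (c :* (M :* P) :- (M′ :* P :+ M :* P′))) ≈-refl (const r) (θ P) M (const c) (θ M) P ⟩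
    const r · (const c · (M · P) ⊕ ⊖ (θ M · P ⊕ M · θ P))
      ≈⟨ SR.*-congˡ (SR.+-cong (SR.*-congˡ (cofactor-· k′)) (SR.-‿cong (≈-trans (≈-sym (θ-leibniz M P)) (≈-trans θ-cong (θ-oneMinus k))))) ⟩
    const r · (const c · oneMinus k ⊕ ⊖ (⊖ (const c · x^ k)))
      ≈⟨ solve 3 (λ r c x → r :* (c :* (con 1ℚ :- x) :- (:- (c :* x))) := r :* c) ≈-refl (const r) (const c) (x^ k) ⟩
    const r · const c ≈⟨ ≈-sym (const-* r c) ⟩
    const (r *ℚ c) ≈⟨ SR.reflexive (cong const (proj₂ (ℚ-inverse c ne))) ⟩
    𝟙 ∎)
    where
      open S-Solver
      k = suc k′
      M = cofactor k′
      P = ψ k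
      pM = poly-prodψ (divs k k′)
      pP = poly-coeff (Ψ k)
      c = ℕtoℚ k
      ne = ℕtoℚ-≢0 k (s≤s z≤n)
      r = proj₁ (ℚ-inverse c ne)
      θ-cong : θ (M · P) ≈ θ (oneMinus k)
      θ-cong = mk≈ λ m → cong (ℕtoℚ m *ℚ_) (at (cofactor-· k′) m)

  coprime-oneMinus : ∀ k′ j → 1 ≤ j → j ≤ k′ → Coprime (oneMinus j) (ψ (suc k′))
  coprime-oneMinus k′ j 1≤j j≤k′ = result (divides-divs g k g∣k g) (divides-divs-+ k g (k′ ∸ g)) (oneMinus-gcd j k) (coprime-cofactor k′)
    where
      open S-Solver
      k = suc k′
      g = gcd j k
      g∣k = gcd[m,n]∣n j k
      instance
        j≢0 : NonZero j
        j≢0 = >-nonZero 1≤j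
      g≤k′ : g ≤ k′
      g≤k′ = ℕₚ.≤-trans (∣⇒≤ (gcd[m,n]∣m j k)) j≤k′
      1≤g : 1 ≤ g
      1≤g = ℕₚ.n≢0⇒n>0 (gcd[m,n]≢0 j k (inj₂ λ ()))
      P = ψ k
      M = cofactor k′
      result : Divides (prodψ (divs g g)) (prodψ (divs k g)) → Divides (prodψ (divs k g)) (prodψ (divs k (k′ ∸ g + g))) →
        (Σ Series λ u → Σ Series λ v → IsPoly u × IsPoly v × oneMinus g ≈ u · oneMinus j ⊕ v · oneMinus k) → Coprime M P → Coprime (oneMinus j) P
      result (e , pe , e≈) (f , pf , f≈) (u , v , pu , pv , uv≈) (s , t , ps , pt , st≈) =
        s · (e · f) · u , s · (e · f) · v · M ⊕ t ,
        poly-· (poly-· ps (poly-· pe pf)) pu , poly-⊕ (poly-· (poly-· (poly-· ps (poly-· pe pf)) pv) (poly-prodψ (divs k k′))) pt , (begin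
          s · (e · f) · u · oneMinus j ⊕ (s · (e · f) · v · M ⊕ t) · P
            ≈⟨ solve 8 (λ s ef u v M t P p → s :* ef :* u :* p :+ (s :* ef :* v :* M :+ t) :* P := s :* ((u :* p :+ v :* (M :* P)) :* ef) :+ t :* P) ≈-refl s (e · f) u v M t P (oneMinus j) ⟩
          s · ((u · oneMinus j ⊕ v · (M · P)) · (e · f)) ⊕ t · P
            ≈⟨ SR.+-congʳ (SR.*-congˡ (SR.*-congʳ (≈-trans (SR.+-congˡ (SR.*-congˡ (cofactor-· k′))) (≈-sym uv≈)))) ⟩
          s · (oneMinus g · (e · f)) ⊕ t · P ≈⟨ SR.+-congʳ (SR.*-congˡ (≈-sym M≈)) ⟩
          s · M ⊕ t · P ≈⟨ st≈ ⟩
          𝟙 ∎)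
        where
          M≈ : M ≈ oneMinus g · (e · f)
          M≈ = begin
            M                               ≈⟨ SR.reflexive (cong (λ j → prodψ (divs k j)) (sym (ℕₚ.m∸n+n≡m g≤k′))) ⟩
            prodψ (divs k (k′ ∸ g + g))      ≈⟨ f≈ ⟩
            prodψ (divs k g) · f            ≈⟨ SR.*-congʳ e≈ ⟩
            prodψ (divs g g) · e · f        ≈⟨ SR.*-assoc (prodψ (divs g g)) e f ⟩
            prodψ (divs g g) · (e · f)      ≈⟨ SR.*-congʳ (prodψ-divisors g 1≤g) ⟩
            oneMinus g · (e · f) ∎

  coprime-x^ : ∀ k′ n → Coprime (x^ n) (ψ (suc k′))
  coprime-x^ k′ zero = coprime-≈ (≈-sym x^0≈𝟙) (coprime-𝟙 _)
  coprime-x^ k′ (suc n) = coprime-≈ (≈-sym (x^-+ 1 n)) (coprime-· (poly-x^ 1) (poly-coeff (Ψ (suc k′))) c₁ (coprime-x^ k′ n) (poly-x^ n))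
    where
      open S-Solver
      c₁ : Coprime (x^ 1) (ψ (suc k′))
      c₁ = x^ k′ , cofactor k′ , poly-x^ k′ , poly-prodψ (divs (suc k′) k′) ,
        ≈-trans (SR.+-cong (≈-trans (SR.*-comm (x^ k′) (x^ 1)) (≈-sym (x^-+ 1 k′))) (cofactor-· k′))
          (solve 1 (λ x → x :+ (con 1ℚ :- x) := con 1ℚ) ≈-refl (x^ (suc k′)))

  deg-oneMinus : ∀ n → 1 ≤ n → HasDeg (oneMinus n) n
  deg-oneMinus (suc n) _ = (λ e → -1≢0 (trans (sym lead) e)) ,
      vanish-⊕ {𝟙} (λ { zero () ; (suc m) _ → refl }) (vanish-⊖ {x^ (suc n)} (vanish-x^ (suc n)))
    where
      -1≢0 : -ℚ 1ℚ ≢ 0ℚ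
      -1≢0 ()
      x^-diag : ∀ n → x^ n n ≡ 1ℚ
      x^-diag zero = refl
      x^-diag (suc n) = x^-diag n
      lead : oneMinus (suc n) (suc n) ≡ -ℚ 1ℚ
      lead = trans (⊕-at 𝟙 (⊖ x^ (suc n)) (suc n)) (trans (ℚₚ.+-identityˡ _) (trans (⊖-at (x^ (suc n)) (suc n)) (cong -ℚ_ (x^-diag n))))

  degψ : ∀ d → 1 ≤ d → Σ ℕ (HasDeg (ψ d))
  degψ (suc d) _ with findDeg _ {ψ (suc d)} (proj₂ (poly-coeff (Ψ (suc d))))
  ... | inj₂ r = r
  ... | inj₁ z = ⊥-elim (proj₁ (deg-oneMinus (suc d) (s≤s z≤n)) (at
      (≈-trans (≈-sym (cofactor-· d)) (≈-trans (SR.*-congˡ z) (SR.zeroʳ (cofactor d)))) (suc d)))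

  δ : ℕ → ℕ
  δ zero = 0
  δ (suc d) = proj₁ (degψ (suc d) (s≤s z≤n))

  deg-prodψ : ∀ {xs} → All (1 ≤_) xs → HasDeg (prodψ xs) (sum (map δ xs))
  deg-prodψ [] = deg-𝟙
  deg-prodψ {suc d ∷ xs} (_ ∷ ps) = deg-· {ψ (suc d)} {prodψ xs} (proj₂ (degψ (suc d) (s≤s z≤n))) (deg-prodψ ps)

  ψ-nonconstant : ∀ k → 1 ≤ k → ¬ HasDeg (ψ k) 0
  ψ-nonconstant (suc k′) 1≤k deg0 = ℕₚ.<⇒≢ O.ofOrder-k≥1
      (trans (deg-unique {ψ (suc k′)} deg0 (proj₂ (degψ (suc k′) (s≤s z≤n)))) (O.determined δ sum-δ (suc k′) 1≤k ∣-refl))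
    where
      module O = Order (suc k′) 1≤k
      sum-δ : ∀ m → 1 ≤ m → sum (map δ (divs m m)) ≡ m
      sum-δ m 1≤m = deg-unique {prodψ (divs m m)} (deg-prodψ (All.map proj₁ (divs-All m m)))
        (deg-≈ (≈-sym (prodψ-divisors m 1≤m)) (deg-oneMinus m 1≤m))

Σ< : (ℕ → ℚ) → ℕ → ℚ
Σ< f zero = 0ℚ
Σ< f (suc n) = f 0 +ℚ Σ< (λ i → f (suc i)) n

Σ<-shift : ∀ f n → f n ≡ f 0 → Σ< (λ i → f (suc i)) n ≡ Σ< f n
Σ<-shift f n e = trans (solve 2 (λ a s → s := (a :+ s) :- a) refl (f 0) _)
    (trans (cong (_+ℚ -ℚ f 0) (trans (snoc f n) (cong (Σ< f n +ℚ_) e))) (solve 2 (λ a s → (s :+ a) :- a := s) refl (f 0) _))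
  where
    open ℚ-Solver
    snoc : ∀ f n → f 0 +ℚ Σ< (λ i → f (suc i)) n ≡ Σ< f n +ℚ f n
    snoc f zero = trans (ℚₚ.+-identityʳ (f 0)) (sym (ℚₚ.+-identityˡ (f 0)))
    snoc f (suc n) = trans (cong (f 0 +ℚ_) (snoc (λ i → f (suc i)) n)) (sym (ℚₚ.+-assoc (f 0) _ _))

Σ<-cong : ∀ n {f g} → (∀ i → f i ≡ g i) → Σ< f n ≡ Σ< g n
Σ<-cong zero e = refl
Σ<-cong (suc n) e = cong₂ _+ℚ_ (e 0) (Σ<-cong n λ i → e (suc i))

Σ<-linear : ∀ n f g h l → Σ< (λ i → f i +ℚ -ℚ g i +ℚ (h i +ℚ -ℚ l i)) n ≡ Σ< f n +ℚ -ℚ Σ< g n +ℚ (Σ< h n +ℚ -ℚ Σ< l n)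
Σ<-linear zero f g h l = refl
Σ<-linear (suc n) f g h l = trans (cong ((f 0 +ℚ -ℚ g 0 +ℚ (h 0 +ℚ -ℚ l 0)) +ℚ_) (Σ<-linear n _ _ _ _))
  (solve 8 (λ a b c d a′ b′ c′ d′ → (a :- b :+ (c :- d)) :+ (a′ :- b′ :+ (c′ :- d′)) := (a :+ a′) :- (b :+ b′) :+ ((c :+ c′) :- (d :+ d′))) refl
    (f 0) (g 0) (h 0) (l 0) (Σ< (λ i → f (suc i)) n) (Σ< (λ i → g (suc i)) n) (Σ< (λ i → h (suc i)) n) (Σ< (λ i → l (suc i)) n))
  where open ℚ-Solver

square≥0 : ∀ p → 0ℚ ≤ℚ p *ℚ p
square≥0 p with ℚₚ.≤-total 0ℚ p
... | inj₁ 0≤p = ℚₚ.nonNegative⁻¹ (p *ℚ p) {{ℚₚ.nonNeg*nonNeg⇒nonNeg p {{ℚ.nonNegative 0≤p}} p {{ℚ.nonNegative 0≤p}}}}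
... | inj₂ p≤0 = ℚₚ.nonNegative⁻¹ (p *ℚ p) {{ℚₚ.nonPos*nonPos⇒nonPos p {{ℚ.nonPositive p≤0}} p {{ℚ.nonPositive p≤0}}}}

Σ<-square≥0 : ∀ (f : ℕ → ℚ) n → 0ℚ ≤ℚ Σ< (λ i → f i *ℚ f i) n
Σ<-square≥0 f zero = ℚₚ.≤-refl
Σ<-square≥0 f (suc n) = ℚₚ.+-mono-≤ (square≥0 (f 0)) (Σ<-square≥0 (λ i → f (suc i)) n)

Σ<-square-zero : ∀ (f : ℕ → ℚ) n → Σ< (λ i → f i *ℚ f i) (suc n) ≡ 0ℚ → f 0 ≡ 0ℚ
Σ<-square-zero f n e with f 0 ℚₚ.≟ 0ℚ
... | yes z = z
... | no nz = ℚ-cancel (f 0) (f 0) nz (ℚₚ.≤-antisym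
    (subst (f 0 *ℚ f 0 ≤ℚ_) e (subst (_≤ℚ f 0 *ℚ f 0 +ℚ Σ< (λ i → f (suc i) *ℚ f (suc i)) n) (ℚₚ.+-identityʳ (f 0 *ℚ f 0))
      (ℚₚ.+-monoʳ-≤ (f 0 *ℚ f 0) (Σ<-square≥0 (λ i → f (suc i)) n))))
    (square≥0 (f 0)))

-- The relation says that 1 + x - x² acts on b as a translation, so it preserves the ℓ² norm
-- over one period; expanding the square, what is left is Σ (b_{i+2} - b_i)² = 0.
periodic-rigid : ∀ (b : ℕ → ℚ) k s → (∀ i → b (suc k + i) ≡ b i) →
  (∀ i → b (suc (suc (s + i))) +ℚ (b (suc (s + i)) +ℚ -ℚ b (s + i)) ≡ b i) → b (suc (suc s)) ≡ b s
periodic-rigid b k s per rec = conclusion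
  where
    open ℚ-Solver
    v d w : ℕ → ℚ
    v i = b (s + i)
    d i = b (suc (suc (s + i))) +ℚ -ℚ b (s + i)
    w i = (b (suc (s + i)) +ℚ b (suc (s + i))) *ℚ b (s + i)
    sq : ℕ → ℚ
    sq i = b i *ℚ b i
    per′ : ∀ i → b (i + suc k) ≡ b i
    per′ i = trans (cong b (ℕₚ.+-comm i (suc k))) (per i)
    shiftBy : ∀ n → Σ< (λ i → sq (n + i)) (suc k) ≡ Σ< sq (suc k)
    shiftBy zero = refl
    shiftBy (suc n) = trans (Σ<-cong (suc k) λ i → cong sq (sym (ℕₚ.+-suc n i)))
      (trans (Σ<-shift (λ i → sq (n + i)) (suc k) (trans (cong₂ _*ℚ_ (per′ n) (per′ n)) (cong sq (sym (ℕₚ.+-identityʳ n))))) (shiftBy n))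
    w-per : w (suc k) ≡ w 0
    w-per = cong₂ (λ x y → (x +ℚ x) *ℚ y) (trans (per′ (suc s)) (cong (λ t → b (suc t)) (sym (ℕₚ.+-identityʳ s))))
              (trans (per′ s) (cong b (sym (ℕₚ.+-identityʳ s))))
    expand : ∀ i → d i *ℚ d i ≡ sq i +ℚ -ℚ sq (suc s + i) +ℚ (w i +ℚ -ℚ w (suc i))
    expand i = trans
      (solve 3 (λ a b c → (a :- c) :* (a :- c) := (a :+ (b :- c)) :* (a :+ (b :- c)) :- b :* b :+ ((b :+ b) :* c :- (a :+ a) :* b)) refl
        (b (suc (suc (s + i)))) (b (suc (s + i))) (b (s + i)))
      (cong₂ (λ x y → x *ℚ x +ℚ -ℚ sq (suc s + i) +ℚ (w i +ℚ -ℚ y)) (rec i)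
        (cong (λ t → (b (suc t) +ℚ b (suc t)) *ℚ b t) (sym (ℕₚ.+-suc s i))))
    sum≡0 : Σ< (λ i → d i *ℚ d i) (suc k) ≡ 0ℚ
    sum≡0 = trans (Σ<-cong (suc k) expand) (trans (Σ<-linear (suc k) sq (λ i → sq (suc s + i)) w (λ i → w (suc i)))
      (trans (cong₂ (λ x y → Σ< sq (suc k) +ℚ -ℚ x +ℚ (Σ< w (suc k) +ℚ -ℚ y)) (shiftBy (suc s)) (Σ<-shift w (suc k) w-per))
        (cong₂ _+ℚ_ (ℚₚ.+-inverseʳ (Σ< sq (suc k))) (ℚₚ.+-inverseʳ (Σ< w (suc k))))))
    conclusion : b (suc (suc s)) ≡ b s
    conclusion = subst (λ t → b (suc (suc t)) ≡ b t) (ℕₚ.+-identityʳ s)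
      (trans (solve 2 (λ x y → x := (x :- y) :+ y) refl (b (suc (suc (s + 0)))) (b (s + 0)))
        (trans (cong (_+ℚ b (s + 0)) (Σ<-square-zero d k sum≡0)) (ℚₚ.+-identityˡ _)))

geo : ℕ → Series
geo k m = ℕtoℚ (ind (k ∣? m))

geo-inverse : ∀ k → oneMinus (suc k) · geo (suc k) ≈ 𝟙
geo-inverse k = ≈-trans (solve 2 (λ x g → (con 1ℚ :- x) :* g := g :- x :* g) ≈-refl (x^ (suc k)) G) (mk≈ λ m →
    trans (⊕-at G (⊖ (x^ (suc k) · G)) m) (trans (cong (G m +ℚ_) (⊖-at (x^ (suc k) · G) m)) (cases m)))
  where
    open S-Solver
    G = geo (suc k)
    cases : ∀ m → G m +ℚ -ℚ (x^ (suc k) · G) m ≡ 𝟙 m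
    cases m with m <? suc k
    cases zero | yes lt = cong₂ (λ a b → ℕtoℚ a +ℚ -ℚ b) (ind-yes (suc k ∣? 0) (suc k ∣0)) (x^-low (suc k) G 0 lt)
    cases (suc m) | yes lt = cong₂ (λ a b → ℕtoℚ a +ℚ -ℚ b) (ind-no (suc k ∣? suc m) (>⇒∤ lt)) (x^-low (suc k) G (suc m) lt)
    cases m | no ge = subst (λ m → G m +ℚ -ℚ (x^ (suc k) · G) m ≡ 𝟙 m) (ℕₚ.m+[n∸m]≡n (ℕₚ.≮⇒≥ ge)) (split (m ∸ suc k))
      where
        split : ∀ i → G (suc k + i) +ℚ -ℚ (x^ (suc k) · G) (suc k + i) ≡ 0ℚ
        split i = trans (cong₂ (λ a b → ℕtoℚ a +ℚ -ℚ b)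
            (ind-⇔ (suc k ∣? (suc k + i)) (suc k ∣? i) (λ d → ∣m+n∣m⇒∣n d ∣-refl) (∣m∣n⇒∣m+n ∣-refl)) (x^-shift (suc k) G i))
          (ℚₚ.+-inverseʳ (G i))

N : ℕ → Series
N s = 𝟙 ⊕ x^ 1 ⊕ ⊖ x^ 2 ⊕ ⊖ x^ (2 + s)

poly-N : ∀ s → IsPoly (N s)
poly-N s = poly-⊕ (poly-⊕ (poly-⊕ poly-𝟙 (poly-x^ 1)) (poly-⊖ (poly-x^ 2))) (poly-⊖ (poly-x^ (2 + s)))

N-at : ∀ s a i → (N s · a) (suc (suc (s + i))) ≡ a (suc (suc (s + i))) +ℚ (a (suc (s + i)) +ℚ -ℚ a (s + i)) +ℚ -ℚ a i
N-at s a i = trans (at (solve 4 (λ x y z a → (con 1ℚ :+ x :- y :- z) :* a := a :+ (x :* a :- y :* a) :- z :* a) ≈-refl (x^ 1) (x^ 2) (x^ (2 + s)) a) m)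
  (trans (⊕-at _ _ m) (cong₂ _+ℚ_ (trans (⊕-at _ _ m) (cong (a m +ℚ_) (trans (⊕-at _ _ m)
      (cong₂ _+ℚ_ (x^-shift 1 a (suc (s + i))) (trans (⊖-at _ m) (cong -ℚ_ (x^-shift 2 a (s + i))))))))
    (trans (⊖-at _ m) (cong -ℚ_ (x^-shift (2 + s) a i)))))
  where
    open S-Solver
    m = suc (suc (s + i))

eventually-2-periodic : ∀ k s a → IsPoly (oneMinus (suc k) · a) → IsPoly (N s · a) → IsPoly (oneMinus 2 · a)
eventually-2-periodic k s a (n , v) (n′ , v′) = 2 + (s + (n + n′)) , vanish
  where
    open S-Solver
    oneMinus-shift : ∀ j i → (oneMinus j · a) (j + i) ≡ a (j + i) +ℚ -ℚ a i
    oneMinus-shift j i = trans (at (solve 2 (λ x a → (con 1ℚ :- x) :* a := a :- x :* a) ≈-refl (x^ j) a) (j + i))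
      (trans (⊕-at _ _ (j + i)) (cong (a (j + i) +ℚ_) (trans (⊖-at _ (j + i)) (cong -ℚ_ (x^-shift j a i)))))
    diff-zero : ∀ p q → p +ℚ -ℚ q ≡ 0ℚ → p ≡ q
    diff-zero p q e = trans (ℚS.solve 2 (λ p q → p ℚS.:= (p ℚS.:- q) ℚS.:+ q) refl p q) (trans (cong (_+ℚ q) e) (ℚₚ.+-identityˡ q))
      where module ℚS = ℚ-Solver
    n≤ : ∀ j c → n + n′ ≤ j → n ≤ c + j
    n≤ j c le = ℕₚ.≤-trans (ℕₚ.m≤m+n n n′) (ℕₚ.≤-trans le (ℕₚ.m≤n+m j c))
    n′≤ : ∀ j c → n + n′ ≤ j → n′ ≤ c + j
    n′≤ j c le = ℕₚ.≤-trans (ℕₚ.m≤n+m n′ n) (ℕₚ.≤-trans le (ℕₚ.m≤n+m j c))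
    reassoc : ∀ c j i → c + (j + i) ≡ j + (c + i)
    reassoc c j i = trans (sym (ℕₚ.+-assoc c j i)) (trans (cong (_+ i) (ℕₚ.+-comm c j)) (ℕₚ.+-assoc j c i))
    key : ∀ j → n + n′ ≤ j → a (2 + (s + j)) ≡ a (s + j)
    key j le = trans (cong a (sym (trans (ℕₚ.+-comm j (2 + s)) refl))) (trans (periodic-rigid (λ i → a (j + i)) k s per rec) (cong a (ℕₚ.+-comm j s)))
      where
        le′ : ∀ i → n + n′ ≤ j + i
        le′ i = ℕₚ.≤-trans le (ℕₚ.m≤m+n j i)
        per : ∀ i → a (j + (suc k + i)) ≡ a (j + i)
        per i = trans (cong a (reassoc j (suc k) i)) (diff-zero _ _ (trans (sym (oneMinus-shift (suc k) (j + i))) (v _ (n≤ (j + i) (suc k) (le′ i)))))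
        rec : ∀ i → a (j + suc (suc (s + i))) +ℚ (a (j + suc (s + i)) +ℚ -ℚ a (j + (s + i))) ≡ a (j + i)
        rec i = trans (cong₂ _+ℚ_ (cong a (reassoc j (2 + s) i)) (cong₂ (λ p q → a p +ℚ -ℚ a q) (reassoc j (1 + s) i) (reassoc j s i)))
          (diff-zero _ _ (trans (sym (N-at s a (j + i))) (v′ _ (n′≤ (j + i) (2 + s) (le′ i)))))
    vanish : VanishFrom (2 + (s + (n + n′))) (oneMinus 2 · a)
    vanish m le = subst (λ m → (oneMinus 2 · a) m ≡ 0ℚ) eq (trans (oneMinus-shift 2 (s + j))
        (trans (cong (_+ℚ -ℚ a (s + j)) (key j (ℕₚ.m≤n+m (n + n′) i))) (ℚₚ.+-inverseʳ (a (s + j)))))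
      where
        i = m ∸ (2 + (s + (n + n′)))
        j = i + (n + n′)
        eq : 2 + (s + j) ≡ m
        eq = trans (cong (2 +_) (reassoc s i (n + n′))) (trans (reassoc 2 i (s + (n + n′))) (ℕₚ.m∸n+n≡m le))

module Localization (Ψ : ℕ → Poly) (cyc : IsCyclotomic Ψ) (k′ : ℕ) where

  open Cyclotomic Ψ cyc public

  k : ℕ
  k = suc k′

  P : Series
  P = ψ k

  poly-P : IsPoly P
  poly-P = poly-coeff (Ψ k)

  record Unit (D : Series) : Set where
    constructor unit
    field
      isPoly    : IsPoly D
      isCoprime : Coprime D P
  open Unit public

  unit-· : ∀ {D E} → Unit D → Unit E → Unit (D · E)
  unit-· (unit pD cD) (unit pE cE) = unit (poly-· pD pE) (coprime-· pD poly-P cD cE pE)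

  unit-𝟙 : Unit 𝟙
  unit-𝟙 = unit poly-𝟙 (coprime-𝟙 P)

  unit-const : ∀ {c} → c ≢ 0ℚ → Unit (const c)
  unit-const ne = unit (poly-const _) (coprime-const _ P ne)

  unit-oneMinus : ∀ j → 1 ≤ j → j < k → Unit (oneMinus j)
  unit-oneMinus j 1≤j (s≤s j≤k′) = unit (poly-oneMinus j) (coprime-oneMinus k′ j 1≤j j≤k′)

  unit-x^ : ∀ n → Unit (x^ n)
  unit-x^ n = unit (poly-x^ n) (coprime-x^ k′ n)

  M : Series
  M = cofactor k′

  unit-M : Unit M
  unit-M = unit (poly-prodψ (divs k k′)) (coprime-cofactor k′)

  M·P : M · P ≈ oneMinus k
  M·P = cofactor-· k′

  unit-N : ∀ s → 2 < k → Unit (N s)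
  unit-N s 2<k = unit (poly-N s) (fromBezout (bezout (poly-N s) poly-P))
    where
      open S-Solver
      fromBezout : Bezout (N s) P → Coprime (N s) P
      fromBezout z = finish (isCoprime (unit-oneMinus 2 (s≤s z≤n) 2<k)) (eventually-2-periodic k′ s a polyᵏ polyᴺ)
        where
          open Bezout z
          G = geo k
          a = b′ · (M · G)
          P·a : P · a ≈ b′
          P·a = begin
            P · (b′ · (M · G))   ≈⟨ solve 4 (λ P b M G → P :* (b :* (M :* G)) := b :* ((M :* P) :* G)) ≈-refl P b′ M G ⟩
            b′ · ((M · P) · G)   ≈⟨ SR.*-congˡ (SR.*-congʳ M·P) ⟩
            b′ · (oneMinus k · G) ≈⟨ SR.*-congˡ (geo-inverse k′) ⟩
            b′ · 𝟙               ≈⟨ SR.*-identityʳ b′ ⟩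
            b′ ∎
          polyᵏ : IsPoly (oneMinus k · a)
          polyᵏ = poly-≈ (begin
            M · b′               ≈⟨ SR.*-congˡ (≈-sym P·a) ⟩
            M · (P · a)          ≈⟨ ≈-sym (SR.*-assoc M P a) ⟩
            M · P · a            ≈⟨ SR.*-congʳ M·P ⟩
            oneMinus k · a ∎) (poly-· (isPoly unit-M) poly-b′)
          -- b′ = P a = b′ g a, hence g a = 1.
          b′≢0 : Σ ℕ λ n → b′ n ≢ 0ℚ
          b′≢0 = cases (findDeg _ {b′} (proj₂ poly-b′))
            where
              cases : (b′ ≈ zeroS) ⊎ Σ ℕ (HasDeg b′) → Σ ℕ λ n → b′ n ≢ 0ℚ
              cases (inj₂ (n , ne , _)) = n , ne
              cases (inj₁ z) = ⊥-elim (proj₁ (proj₂ (degψ k (s≤s z≤n))) (at (≈-trans b≈ (≈-trans (SR.*-congʳ z) (SR.zeroˡ g))) _))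
          g·a : g · a ≈ 𝟙
          g·a = cancel-· (proj₁ b′≢0) {b′} (proj₂ b′≢0) (begin
            b′ · (g · a)         ≈⟨ ≈-sym (SR.*-assoc b′ g a) ⟩
            b′ · g · a           ≈⟨ SR.*-congʳ (≈-sym b≈) ⟩
            P · a                ≈⟨ P·a ⟩
            b′                   ≈⟨ ≈-sym (SR.*-identityʳ b′) ⟩
            b′ · 𝟙 ∎)
          polyᴺ : IsPoly (N s · a)
          polyᴺ = poly-≈ (begin
            a′                   ≈⟨ ≈-sym (SR.*-identityʳ a′) ⟩
            a′ · 𝟙               ≈⟨ SR.*-congˡ (≈-sym g·a) ⟩
            a′ · (g · a)         ≈⟨ ≈-sym (SR.*-assoc a′ g a) ⟩
            a′ · g · a           ≈⟨ SR.*-congʳ (≈-sym a≈) ⟩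
            N s · a ∎) poly-a′
          finish : Coprime (oneMinus 2) P → IsPoly (oneMinus 2 · a) → Coprime (N s) P
          finish (p , q , pp , pq , e) poly₂ = t · u , t · v , poly-· pt poly-u , poly-· pt poly-v , (begin
              t · u · N s ⊕ t · v · P     ≈⟨ solve 5 (λ t u n v P → t :* u :* n :+ t :* v :* P := t :* (u :* n :+ v :* P)) ≈-refl t u (N s) v P ⟩
              t · (u · N s ⊕ v · P)       ≈⟨ SR.*-congˡ (≈-sym g≈) ⟩
              t · g                       ≈⟨ solve 6 (λ p d a q b g → (p :* (d :* a) :+ q :* b) :* g := p :* d :* (g :* a) :+ q :* (b :* g)) ≈-refl p (oneMinus 2) a q b′ g ⟩
              p · oneMinus 2 · (g · a) ⊕ q · (b′ · g) ≈⟨ SR.+-cong (≈-trans (SR.*-congˡ g·a) (SR.*-identityʳ _)) (SR.*-congˡ (≈-sym b≈)) ⟩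
              p · oneMinus 2 ⊕ q · P      ≈⟨ e ⟩
              𝟙 ∎)
            where
              t = p · (oneMinus 2 · a) ⊕ q · b′
              pt : IsPoly t
              pt = poly-⊕ (poly-· pp poly₂) (poly-· pq poly-b′)

  -- Series without a pole at the zeros of Ψ_k

  record Reg (f : Series) : Set where
    constructor reg
    field
      den      : Series
      unit-den : Unit den
      poly-num : IsPoly (den · f)

  reg-≈ : ∀ {f g} → f ≈ g → Reg f → Reg g
  reg-≈ e (reg D uD p) = reg D uD (poly-≈ (SR.*-congˡ e) p)

  reg-poly : ∀ {f} → IsPoly f → Reg f
  reg-poly {f} p = reg 𝟙 unit-𝟙 (poly-≈ (≈-sym (SR.*-identityˡ f)) p)

  reg-⊕ : ∀ {f g} → Reg f → Reg g → Reg (f ⊕ g)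
  reg-⊕ {f} {g} (reg D uD p) (reg E uE q) = reg (D · E) (unit-· uD uE)
    (poly-≈ (solve 4 (λ D E f g → E :* (D :* f) :+ D :* (E :* g) := D :* E :* (f :+ g)) ≈-refl D E f g)
      (poly-⊕ (poly-· (isPoly uE) p) (poly-· (isPoly uD) q)))
    where open S-Solver

  reg-· : ∀ {f g} → Reg f → Reg g → Reg (f · g)
  reg-· {f} {g} (reg D uD p) (reg E uE q) = reg (D · E) (unit-· uD uE)
    (poly-≈ (solve 4 (λ D E f g → (D :* f) :* (E :* g) := D :* E :* (f :* g)) ≈-refl D E f g) (poly-· p q))
    where open S-Solver

  reg-⊖ : ∀ {f} → Reg f → Reg (⊖ f)
  reg-⊖ {f} (reg D uD p) = reg D uD (poly-≈ (solve 2 (λ D f → :- (D :* f) := D :* (:- f)) ≈-refl D f) (poly-⊖ p))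
    where open S-Solver

  reg-/ : ∀ {D f} → Unit D → Reg (D · f) → Reg f
  reg-/ {D} {f} uD (reg E uE p) = reg (E · D) (unit-· uE uD) (poly-≈ (≈-sym (SR.*-assoc E D f)) p)

  reg-zero : Reg zeroS
  reg-zero = reg-poly poly-zero

  infix 4 _≡ᴿ_
  _≡ᴿ_ : Series → Series → Set
  f ≡ᴿ g = Reg (f ⊕ ⊖ g)

  ≈⇒≡ᴿ : ∀ {f g} → f ≈ g → f ≡ᴿ g
  ≈⇒≡ᴿ {f} {g} e = reg-≈ (≈-sym (≈-trans (SR.+-congʳ e) (SR.-‿inverseʳ g))) reg-zero

  ≡ᴿ-trans : ∀ {f g h} → f ≡ᴿ g → g ≡ᴿ h → f ≡ᴿ h
  ≡ᴿ-trans {f} {g} {h} p q = reg-≈ (solve 3 (λ f g h → (f :- g) :+ (g :- h) := f :- h) ≈-refl f g h) (reg-⊕ p q)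
    where open S-Solver

  ≡ᴿ-sym : ∀ {f g} → f ≡ᴿ g → g ≡ᴿ f
  ≡ᴿ-sym {f} {g} p = reg-≈ (solve 2 (λ f g → :- (f :- g) := g :- f) ≈-refl f g) (reg-⊖ p)
    where open S-Solver

  ≡ᴿ-⊕ : ∀ {f f′ g g′} → f ≡ᴿ f′ → g ≡ᴿ g′ → f ⊕ g ≡ᴿ f′ ⊕ g′
  ≡ᴿ-⊕ {f} {f′} {g} {g′} p q = reg-≈ (solve 4 (λ f f′ g g′ → (f :- f′) :+ (g :- g′) := (f :+ g) :- (f′ :+ g′)) ≈-refl f f′ g g′) (reg-⊕ p q)
    where open S-Solver

  ≡ᴿ-· : ∀ {f f′ r} → Reg r → f ≡ᴿ f′ → r · f ≡ᴿ r · f′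
  ≡ᴿ-· {f} {f′} {r} pr p = reg-≈ (solve 3 (λ r f f′ → r :* (f :- f′) := r :* f :- r :* f′) ≈-refl r f f′) (reg-· pr p)
    where open S-Solver

  reg⇒≡ᴿ0 : ∀ {f} → Reg f → f ≡ᴿ zeroS
  reg⇒≡ᴿ0 {f} p = reg-≈ (≈-trans (solve 1 (λ f → f := f :- con 0ℚ) ≈-refl f) (SR.+-congˡ (SR.-‿cong const-0))) p
    where open S-Solver

  reg-≡ᴿ : ∀ {f g} → f ≡ᴿ g → Reg g → Reg f
  reg-≡ᴿ {f} {g} p q = reg-≈ (solve 2 (λ f g → (f :- g) :+ g := f) ≈-refl f g) (reg-⊕ p q)
    where open S-Solver

  -- Series with a simple pole at every zero of Ψ_k

  record Pole (f : Series) : Set where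
    constructor pole
    field
      den num  : Series
      unit-den : Unit den
      unit-num : Unit num
      eq       : den · (P · f) ≈ num

  pole-≈ : ∀ {f g} → f ≈ g → Pole f → Pole g
  pole-≈ e (pole D U uD uU eq) = pole D U uD uU (≈-trans (SR.*-congˡ (SR.*-congˡ (≈-sym e))) eq)

  pole-⊕ : ∀ {f r} → Pole f → Reg r → Pole (f ⊕ r)
  pole-⊕ {f} {r} (pole D U uD uU eq) (reg E uE p) = pole (E · D) (E · U ⊕ D · (E · r) · P) (unit-· uE uD)
      (unit (poly-⊕ (isPoly (unit-· uE uU)) (poly-· (poly-· (isPoly uD) p) poly-P))
            (coprime-+· (poly-· (isPoly uD) p) (isCoprime (unit-· uE uU))))
      (begin
        E · D · (P · (f ⊕ r))                ≈⟨ solve 5 (λ E D P f r → E :* D :* (P :* (f :+ r)) := E :* (D :* (P :* f)) :+ D :* (E :* r) :* P) ≈-refl E D P f r ⟩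
        E · (D · (P · f)) ⊕ D · (E · r) · P  ≈⟨ SR.+-congʳ (SR.*-congˡ eq) ⟩
        E · U ⊕ D · (E · r) · P ∎)
    where open S-Solver

  pole-≡ᴿ : ∀ {f g} → f ≡ᴿ g → Pole g → Pole f
  pole-≡ᴿ {f} {g} e p = pole-≈ (solve 2 (λ f g → g :+ (f :- g) := f) ≈-refl f g) (pole-⊕ p e)
    where open S-Solver

  pole-· : ∀ {E f} → Unit E → Pole f → Pole (E · f)
  pole-· {E} {f} uE (pole D U uD uU eq) = pole D (E · U) uD (unit-· uE uU)
    (≈-trans (solve 4 (λ D P E f → D :* (P :* (E :* f)) := E :* (D :* (P :* f))) ≈-refl D P E f) (SR.*-congˡ eq))
    where open S-Solver

  pole-/ : ∀ {E f} → Unit E → Pole (E · f) → Pole f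
  pole-/ {E} {f} uE (pole D U uD uU eq) = pole (D · E) U (unit-· uD uE) uU
    (≈-trans (solve 4 (λ D P E f → D :* E :* (P :* f) := D :* (P :* (E :* f))) ≈-refl D P E f) eq)
    where open S-Solver

infix 4 _≈[_]_
_≈[_]_ : Series → ℕ → Series → Set
f ≈[ n ] g = ∀ m → m < n → f m ≡ g m

≈⇒≈[] : ∀ {f g n} → f ≈ g → f ≈[ n ] g
≈⇒≈[] e m _ = at e m

≈[]-mono : ∀ {f g a b} → a ≤ b → f ≈[ b ] g → f ≈[ a ] g
≈[]-mono a≤b e m m<a = e m (ℕₚ.<-≤-trans m<a a≤b)

≈[]-⊕ : ∀ {f f′ g g′ n} → f ≈[ n ] f′ → g ≈[ n ] g′ → f ⊕ g ≈[ n ] f′ ⊕ g′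
≈[]-⊕ {f} {f′} {g} {g′} e e′ m m<n = trans (⊕-at f g m) (trans (cong₂ _+ℚ_ (e m m<n) (e′ m m<n)) (sym (⊕-at f′ g′ m)))

≈[]-· : ∀ {f f′ g g′ n} → f ≈[ n ] f′ → g ≈[ n ] g′ → f · g ≈[ n ] f′ · g′
≈[]-· {f} {f′} {g} {g′} e e′ m m<n = trans (·-at f g m) (trans
  (sumTo-cong-≤ m λ i i≤m → cong₂ _*ℚ_ (e i (ℕₚ.≤-<-trans i≤m m<n)) (e′ (m ∸ i) (ℕₚ.≤-<-trans (ℕₚ.m∸n≤m m i) m<n)))
  (sym (·-at f′ g′ m)))

≈[]-x^ : ∀ a {f g n} → f ≈[ n ] g → x^ a · f ≈[ a + n ] x^ a · g
≈[]-x^ zero {f} {g} e m m<n = trans (at (x^0· f) m) (trans (e m m<n) (sym (at (x^0· g) m)))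
≈[]-x^ (suc a) {f} {g} e zero _ = trans (x^-suc-zero a f) (sym (x^-suc-zero a g))
≈[]-x^ (suc a) {f} {g} e (suc m) (s≤s lt) = trans (x^-suc-suc a f m) (trans (≈[]-x^ a {f} {g} e m lt) (sym (x^-suc-suc a g m)))

⅀ : {A : Set} → List A → (A → Series) → Series
⅀ [] f = zeroS
⅀ (a ∷ as) f = f a ⊕ ⅀ as f

module _ {A : Set} where

  ⅀-++ : ∀ xs ys (f : A → Series) → ⅀ (xs ++ ys) f ≈ ⅀ xs f ⊕ ⅀ ys f
  ⅀-++ [] ys f = ≈-sym (SR.+-identityˡ _)
  ⅀-++ (x ∷ xs) ys f = ≈-trans (SR.+-congˡ (⅀-++ xs ys f)) (≈-sym (SR.+-assoc (f x) _ _))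

  ⅀-cong-All : ∀ {xs} {f g : A → Series} → All (λ a → f a ≈ g a) xs → ⅀ xs f ≈ ⅀ xs g
  ⅀-cong-All [] = ≈-refl
  ⅀-cong-All (e ∷ es) = SR.+-cong e (⅀-cong-All es)

  ⅀-cong : ∀ xs {f g : A → Series} → (∀ a → f a ≈ g a) → ⅀ xs f ≈ ⅀ xs g
  ⅀-cong xs e = ⅀-cong-All (All.universal e xs)

  ⅀-zero : ∀ xs {f : A → Series} → (∀ a → f a ≈ zeroS) → ⅀ xs f ≈ zeroS
  ⅀-zero [] e = ≈-refl
  ⅀-zero (x ∷ xs) e = ≈-trans (SR.+-cong (e x) (⅀-zero xs e)) (SR.+-identityˡ zeroS)

  ⅀-⊕ : ∀ xs (f g : A → Series) → ⅀ xs (λ a → f a ⊕ g a) ≈ ⅀ xs f ⊕ ⅀ xs g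
  ⅀-⊕ [] f g = ≈-sym (SR.+-identityˡ zeroS)
  ⅀-⊕ (x ∷ xs) f g = ≈-trans (SR.+-congˡ (⅀-⊕ xs f g))
    (solve 4 (λ a b c d → (a :+ b) :+ (c :+ d) := (a :+ c) :+ (b :+ d)) ≈-refl (f x) (g x) (⅀ xs f) (⅀ xs g))
    where open S-Solver

  ⅀-· : ∀ xs c (f : A → Series) → ⅀ xs (λ a → c · f a) ≈ c · ⅀ xs f
  ⅀-· [] c f = ≈-sym (SR.zeroʳ c)
  ⅀-· (x ∷ xs) c f = ≈-trans (SR.+-congˡ (⅀-· xs c f)) (≈-sym (SR.distribˡ c (f x) (⅀ xs f)))

  ⅀-≈[] : ∀ xs {f g : A → Series} {n} → (∀ a → f a ≈[ n ] g a) → ⅀ xs f ≈[ n ] ⅀ xs g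
  ⅀-≈[] [] e m _ = refl
  ⅀-≈[] (x ∷ xs) {f} {g} e = ≈[]-⊕ {f x} {g x} (e x) (⅀-≈[] xs e)

⅀-map : ∀ {A B : Set} (h : A → B) xs (f : B → Series) → ⅀ (map h xs) f ≡ ⅀ xs (f ∘ h)
⅀-map h [] f = refl
⅀-map h (x ∷ xs) f = cong (f (h x) ⊕_) (⅀-map h xs f)

-- Column transfer

-- A row (s , μ) of a configuration: s says whether a horizontal bond enters the current
-- column in this row, μ is the number of vertical bonds still to be placed on top of this row.
Row : Set
Row = Bool × ℕ

Config : Set
Config = List Row

bit : Bool → ℕ
bit false = 0
bit true = 1

alive : Config → ℕ
alive [] = 0
alive ((s , _) ∷ σ) = bit s + alive σ

verts : Config → ℕ
verts [] = 0
verts ((_ , μ) ∷ σ) = μ + verts σ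

-- `succs c σ` lists the configurations that can follow σ in the next column; c says whether
-- a vertical bond of the current column enters the bottom row of σ from below.
succs : Bool → Config → List Config
rowSuccs : Bool → ℕ → Config → List Config
emits : ℕ → Config → List Config
succs c [] = [] ∷ []
succs c ((s , μ) ∷ σ) = rowSuccs (s ∨ c) μ σ
rowSuccs false μ σ = map ((false , μ) ∷_) (succs false σ)
rowSuccs true μ σ = map ((true , μ) ∷_) (succs false σ) ++ (map ((false , μ) ∷_) (succs false σ) ++ emits μ σ)
emits zero σ = []
emits (suc ν) σ = map ((true , ν) ∷_) (succs true σ) ++ map ((false , ν) ∷_) (succs true σ)

rest : Config → List Config
rest [] = []
rest ((false , μ) ∷ σ) = map ((false , μ) ∷_) (rest σ)
rest ((true , μ) ∷ σ) = map ((true , μ) ∷_) (rest σ) ++ (map ((false , μ) ∷_) (succs false σ) ++ emits μ σ)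

succs-rest : ∀ σ → succs false σ ≡ σ ∷ rest σ
succs-rest [] = refl
succs-rest ((false , μ) ∷ σ) = cong (map ((false , μ) ∷_)) (succs-rest σ)
succs-rest ((true , μ) ∷ σ) = cong (λ l → map ((true , μ) ∷_) l ++ (map ((false , μ) ∷_) (succs false σ) ++ emits μ σ)) (succs-rest σ)

rest-dead : ∀ σ → alive σ ≡ 0 → rest σ ≡ []
rest-dead [] _ = refl
rest-dead ((false , μ) ∷ σ) e = cong (map ((false , μ) ∷_)) (rest-dead σ e)

𝓛 : Bool → Config → (Config → Series) → Series
𝓛 c σ f = ⅀ (succs c σ) λ τ → x^ (alive τ) · f τ

𝓛-cong : ∀ c σ {f g} → (∀ τ → f τ ≈ g τ) → 𝓛 c σ f ≈ 𝓛 c σ g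
𝓛-cong c σ e = ⅀-cong (succs c σ) λ τ → SR.*-congˡ (e τ)

𝓛-⊕ : ∀ c σ f g → 𝓛 c σ (λ τ → f τ ⊕ g τ) ≈ 𝓛 c σ f ⊕ 𝓛 c σ g
𝓛-⊕ c σ f g = ≈-trans (⅀-cong (succs c σ) λ τ → SR.distribˡ (x^ (alive τ)) (f τ) (g τ)) (⅀-⊕ (succs c σ) _ _)

𝓛-· : ∀ c σ a f → 𝓛 c σ (λ τ → a · f τ) ≈ a · 𝓛 c σ f
𝓛-· c σ a f = ≈-trans (⅀-cong (succs c σ) λ τ → solve 3 (λ x a f → x :* (a :* f) := a :* (x :* f)) ≈-refl (x^ (alive τ)) a (f τ)) (⅀-· (succs c σ) a _)
  where open S-Solver

𝓛-zero : ∀ c σ {f} → (∀ τ → f τ ≈ zeroS) → 𝓛 c σ f ≈ zeroS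
𝓛-zero c σ e = ⅀-zero (succs c σ) λ τ → ≈-trans (SR.*-congˡ (e τ)) (SR.zeroʳ _)

private
  ⅀-true : ∀ μ l (f : Config → Series) → ⅀ (map ((true , μ) ∷_) l) (λ τ → x^ (alive τ) · f τ) ≈ x^ 1 · ⅀ l (λ τ → x^ (alive τ) · f ((true , μ) ∷ τ))
  ⅀-true μ l f = ≈-trans (SR.reflexive (⅀-map _ l _)) (≈-trans
    (⅀-cong l λ τ → ≈-trans (SR.*-congʳ (x^-+ 1 (alive τ))) (SR.*-assoc (x^ 1) (x^ (alive τ)) (f ((true , μ) ∷ τ)))) (⅀-· l (x^ 1) _))

  ⅀-false : ∀ μ l (f : Config → Series) → ⅀ (map ((false , μ) ∷_) l) (λ τ → x^ (alive τ) · f τ) ≈ ⅀ l (λ τ → x^ (alive τ) · f ((false , μ) ∷ τ))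
  ⅀-false μ l f = SR.reflexive (⅀-map _ l _)

𝓛-dead : ∀ μ σ (f : Config → Series) → 𝓛 false ((false , μ) ∷ σ) f ≈ 𝓛 false σ (f ∘ ((false , μ) ∷_))
𝓛-dead μ σ f = ⅀-false μ (succs false σ) f

𝓛-alive : ∀ c μ σ (f : Config → Series) → 𝓛 c ((true , μ) ∷ σ) f ≈
  x^ 1 · 𝓛 false σ (f ∘ ((true , μ) ∷_)) ⊕ (𝓛 false σ (f ∘ ((false , μ) ∷_)) ⊕ ⅀ (emits μ σ) (λ τ → x^ (alive τ) · f τ))
𝓛-alive c μ σ f = ≈-trans (⅀-++ (map ((true , μ) ∷_) (succs false σ)) _ _)
  (SR.+-cong (⅀-true μ (succs false σ) f) (≈-trans (⅀-++ (map ((false , μ) ∷_) (succs false σ)) _ _) (SR.+-congʳ (⅀-false μ (succs false σ) f))))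

⅀-emits : ∀ ν σ (f : Config → Series) → ⅀ (emits (suc ν) σ) (λ τ → x^ (alive τ) · f τ) ≈ x^ 1 · 𝓛 true σ (f ∘ ((true , ν) ∷_)) ⊕ 𝓛 true σ (f ∘ ((false , ν) ∷_))
⅀-emits ν σ f = ≈-trans (⅀-++ (map ((true , ν) ∷_) (succs true σ)) _ _) (SR.+-cong (⅀-true ν (succs true σ) f) (⅀-false ν (succs true σ) f))

-- The generating function of the completions of a configuration

δ₀ : Config → Series
δ₀ [] = 𝟙
δ₀ ((false , zero) ∷ σ) = δ₀ σ
δ₀ ((false , suc _) ∷ σ) = zeroS
δ₀ ((true , _) ∷ σ) = zeroS

Fn : ℕ → Config → Series
Fn zero σ = δ₀ σ
Fn (suc t) σ = 𝓛 false σ (Fn t)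

Fn-dead : ∀ t σ → alive σ ≡ 0 → Fn t σ ≈ δ₀ σ
Fn-dead zero σ _ = ≈-refl
Fn-dead (suc t) σ e = ≈-trans (SR.reflexive (cong (λ l → ⅀ l λ τ → x^ (alive τ) · Fn t τ) (trans (succs-rest σ) (cong (σ ∷_) (rest-dead σ e)))))
  (≈-trans (SR.+-identityʳ _) (≈-trans (SR.*-congʳ (SR.reflexive (cong x^ e))) (≈-trans (x^0· (Fn t σ)) (Fn-dead t σ e))))

Fn-stable : ∀ t σ → Fn (suc t) σ ≈[ t ] Fn t σ
Fn-stable zero σ m ()
Fn-stable (suc t) σ = ⅀-≈[] (succs false σ) term
  where
    term : ∀ τ → x^ (alive τ) · Fn (suc t) τ ≈[ suc t ] x^ (alive τ) · Fn t τ
    term τ with alive τ in eq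
    ... | zero = ≈⇒≈[] (SR.*-congˡ (≈-trans (Fn-dead (suc t) τ eq) (≈-sym (Fn-dead t τ eq))))
    ... | suc a = ≈[]-mono {x^ (suc a) · Fn (suc t) τ} {x^ (suc a) · Fn t τ} (s≤s (ℕₚ.m≤n+m t a)) (≈[]-x^ (suc a) {Fn (suc t) τ} {Fn t τ} (Fn-stable t τ))

limit : (ℕ → Series) → Series
limit f m = f (suc m) m

limit-≈[] : ∀ f → (∀ t → f (suc t) ≈[ t ] f t) → ∀ t → limit f ≈[ t ] f t
limit-≈[] f stable t m m<t = subst (λ t → limit f m ≡ f t m) (ℕₚ.m∸n+n≡m m<t) (go (t ∸ suc m))
  where
    go : ∀ d → f (suc m) m ≡ f (d + suc m) m
    go zero = refl
    go (suc d) = trans (go d) (sym (stable (d + suc m) m (ℕₚ.m≤n+m (suc m) d)))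

opaque
  F : Config → Series
  F σ = limit (λ t → Fn t σ)

  F-at : ∀ σ m → F σ m ≡ Fn (suc m) σ m
  F-at σ m = refl

F≈Fn : ∀ t σ → F σ ≈[ t ] Fn t σ
F≈Fn t σ m m<t = trans (F-at σ m) (limit-≈[] (λ t → Fn t σ) (λ t → Fn-stable t σ) t m m<t)

𝓛-≈[] : ∀ c σ {f g n} → (∀ τ → f τ ≈[ n ] g τ) → 𝓛 c σ f ≈[ n ] 𝓛 c σ g
𝓛-≈[] c σ {f} {g} {n} e = ⅀-≈[] (succs c σ) λ τ →
  ≈[]-mono {x^ (alive τ) · f τ} {x^ (alive τ) · g τ} (ℕₚ.m≤n+m n (alive τ)) (≈[]-x^ (alive τ) {f τ} {g τ} (e τ))

F-eq : ∀ σ → F σ ≈ 𝓛 false σ F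
F-eq σ = mk≈ λ m → trans (F≈Fn (suc (suc m)) σ m (ℕₚ.m≤n⇒m≤1+n ℕₚ.≤-refl))
  (𝓛-≈[] false σ {Fn (suc m)} {F} {suc m} (λ τ i i<m → sym (F≈Fn (suc m) τ i i<m)) m ℕₚ.≤-refl)

F-dead : ∀ σ → alive σ ≡ 0 → F σ ≈ δ₀ σ
F-dead σ e = mk≈ λ m → trans (F-at σ m) (at (Fn-dead (suc m) σ e) m)

F-blocked : ∀ ν σ → F ((false , suc ν) ∷ σ) ≈ zeroS
F-blocked ν σ = mk≈ λ m → trans (F-at ((false , suc ν) ∷ σ) m) (at (go (suc m) σ) m)
  where
    go : ∀ t σ → Fn t ((false , suc ν) ∷ σ) ≈ zeroS
    go zero σ = ≈-refl
    go (suc t) σ = ≈-trans (𝓛-dead (suc ν) σ (Fn t)) (𝓛-zero false σ (go t))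

data Closed : Config → Set where
  last : ∀ s → Closed ((s , 0) ∷ [])
  cons : ∀ {r σ} → Closed σ → Closed (r ∷ σ)

alive-++ : ∀ σ τ → alive (σ ++ τ) ≡ alive σ + alive τ
alive-++ [] τ = refl
alive-++ ((s , _) ∷ σ) τ = trans (cong (bit s +_) (alive-++ σ τ)) (sym (ℕₚ.+-assoc (bit s) _ _))

verts-++ : ∀ σ τ → verts (σ ++ τ) ≡ verts σ + verts τ
verts-++ [] τ = refl
verts-++ ((_ , μ) ∷ σ) τ = trans (cong (μ +_) (verts-++ σ τ)) (sym (ℕₚ.+-assoc μ _ _))

closed-succs : ∀ c {σ} → Closed σ → All Closed (succs c σ)
closed-rowSuccs : ∀ b μ {σ} → Closed σ → All Closed (rowSuccs b μ σ)
closed-emits : ∀ μ {σ} → Closed σ → All Closed (emits μ σ)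
closed-map : ∀ r c {σ} → Closed σ → All Closed (map (r ∷_) (succs c σ))
closed-map r c cl = Allₚ.map⁺ (All.map cons (closed-succs c cl))
closed-succs c (last false) with c
... | false = last false ∷ []
... | true = last true ∷ last false ∷ []
closed-succs c (last true) = last true ∷ last false ∷ []
closed-succs c (cons {s , μ} cl) = closed-rowSuccs (s ∨ c) μ cl
closed-rowSuccs false μ cl = closed-map _ false cl
closed-rowSuccs true μ cl = Allₚ.++⁺ (closed-map _ false cl) (Allₚ.++⁺ (closed-map _ false cl) (closed-emits μ cl))
closed-emits zero cl = []
closed-emits (suc ν) cl = Allₚ.++⁺ (closed-map _ true cl) (closed-map _ true cl)

-- A row with μ = 0 separates the rows below and above it.
⅀-succs-++ : ∀ c {σ} → Closed σ → ∀ τ h → ⅀ (succs c (σ ++ τ)) h ≈ ⅀ (succs c σ) (λ σ′ → ⅀ (succs false τ) (λ τ′ → h (σ′ ++ τ′)))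
⅀-rowSuccs-++ : ∀ b μ {σ} → Closed σ → ∀ τ h → ⅀ (rowSuccs b μ (σ ++ τ)) h ≈ ⅀ (rowSuccs b μ σ) (λ σ′ → ⅀ (succs false τ) (λ τ′ → h (σ′ ++ τ′)))
⅀-emits-++ : ∀ μ {σ} → Closed σ → ∀ τ h → ⅀ (emits μ (σ ++ τ)) h ≈ ⅀ (emits μ σ) (λ σ′ → ⅀ (succs false τ) (λ τ′ → h (σ′ ++ τ′)))
⅀-map-++ : ∀ r c {σ} → Closed σ → ∀ τ h → ⅀ (map (r ∷_) (succs c (σ ++ τ))) h ≈ ⅀ (map (r ∷_) (succs c σ)) (λ σ′ → ⅀ (succs false τ) (λ τ′ → h (σ′ ++ τ′)))
⅀-map-++ r c {σ} cl τ h = ≈-trans (SR.reflexive (⅀-map (r ∷_) (succs c (σ ++ τ)) h))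
  (≈-trans (⅀-succs-++ c cl τ (h ∘ (r ∷_))) (SR.reflexive (sym (⅀-map (r ∷_) (succs c σ) _))))
⅀-++₂ : ∀ {A : Set} {xs xs′ ys ys′ : List A} {f g : A → Series} → ⅀ xs f ≈ ⅀ xs′ g → ⅀ ys f ≈ ⅀ ys′ g → ⅀ (xs ++ ys) f ≈ ⅀ (xs′ ++ ys′) g
⅀-++₂ {xs = xs} {xs′} {ys} {ys′} {f} {g} e e′ = ≈-trans (⅀-++ xs ys f) (≈-trans (SR.+-cong e e′) (≈-sym (⅀-++ xs′ ys′ g)))
⅀-single-row : ∀ b τ h → ⅀ (rowSuccs b 0 τ) h ≈ ⅀ (rowSuccs b 0 []) (λ σ′ → ⅀ (succs false τ) (λ τ′ → h (σ′ ++ τ′)))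
⅀-single-row false τ h = ≈-trans (SR.reflexive (⅀-map _ (succs false τ) h)) (≈-sym (SR.+-identityʳ _))
⅀-single-row true τ h = ≈-trans (⅀-++ (map ((true , 0) ∷_) (succs false τ)) _ h)
  (SR.+-cong (SR.reflexive (⅀-map _ (succs false τ) h)) (≈-trans (⅀-++ (map ((false , 0) ∷_) (succs false τ)) [] h) (SR.+-congʳ (SR.reflexive (⅀-map _ (succs false τ) h)))))
⅀-succs-++ c (last s) τ h = ⅀-single-row (s ∨ c) τ h
⅀-succs-++ c (cons {s , μ} cl) τ h = ⅀-rowSuccs-++ (s ∨ c) μ cl τ h
⅀-rowSuccs-++ false μ cl τ h = ⅀-map-++ (false , μ) false cl τ h
⅀-rowSuccs-++ true μ {σ} cl τ h = ⅀-++₂ {xs = map ((true , μ) ∷_) (succs false (σ ++ τ))} {map ((true , μ) ∷_) (succs false σ)}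
  (⅀-map-++ (true , μ) false cl τ h) (⅀-++₂ {xs = map ((false , μ) ∷_) (succs false (σ ++ τ))} {map ((false , μ) ∷_) (succs false σ)}
    (⅀-map-++ (false , μ) false cl τ h) (⅀-emits-++ μ cl τ h))
⅀-emits-++ zero cl τ h = ≈-refl
⅀-emits-++ (suc ν) {σ} cl τ h = ⅀-++₂ {xs = map ((true , ν) ∷_) (succs true (σ ++ τ))} {map ((true , ν) ∷_) (succs true σ)}
  (⅀-map-++ (true , ν) true cl τ h) (⅀-map-++ (false , ν) true cl τ h)

δ₀-++ : ∀ σ τ → δ₀ (σ ++ τ) ≈ δ₀ σ · δ₀ τ
δ₀-++ [] τ = ≈-sym (SR.*-identityˡ _)
δ₀-++ ((false , zero) ∷ σ) τ = δ₀-++ σ τ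
δ₀-++ ((false , suc _) ∷ σ) τ = ≈-sym (SR.zeroˡ _)
δ₀-++ ((true , _) ∷ σ) τ = ≈-sym (SR.zeroˡ _)

Fn-++ : ∀ t {σ} → Closed σ → ∀ τ → Fn t (σ ++ τ) ≈ Fn t σ · Fn t τ
Fn-++ zero {σ} cl τ = δ₀-++ σ τ
Fn-++ (suc t) {σ} cl τ = begin
  ⅀ (succs false (σ ++ τ)) (λ ρ → x^ (alive ρ) · Fn t ρ)
    ≈⟨ ⅀-succs-++ false cl τ _ ⟩
  ⅀ (succs false σ) (λ σ′ → ⅀ (succs false τ) (λ τ′ → x^ (alive (σ′ ++ τ′)) · Fn t (σ′ ++ τ′)))
    ≈⟨ ⅀-cong-All (All.map (λ {σ′} cl′ → ≈-trans (⅀-cong (succs false τ) λ τ′ → term σ′ τ′ cl′) (⅀-· (succs false τ) (x^ (alive σ′) · Fn t σ′) _)) (closed-succs false cl)) ⟩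
  ⅀ (succs false σ) (λ σ′ → (x^ (alive σ′) · Fn t σ′) · Fn (suc t) τ)
    ≈⟨ ⅀-cong (succs false σ) (λ σ′ → SR.*-comm (x^ (alive σ′) · Fn t σ′) (Fn (suc t) τ)) ⟩
  ⅀ (succs false σ) (λ σ′ → Fn (suc t) τ · (x^ (alive σ′) · Fn t σ′))
    ≈⟨ ⅀-· (succs false σ) (Fn (suc t) τ) _ ⟩
  Fn (suc t) τ · Fn (suc t) σ ≈⟨ SR.*-comm (Fn (suc t) τ) (Fn (suc t) σ) ⟩
  Fn (suc t) σ · Fn (suc t) τ ∎
  where
    open S-Solver
    term : ∀ σ′ τ′ → Closed σ′ → x^ (alive (σ′ ++ τ′)) · Fn t (σ′ ++ τ′) ≈ (x^ (alive σ′) · Fn t σ′) · (x^ (alive τ′) · Fn t τ′)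
    term σ′ τ′ cl′ = ≈-trans (SR.*-cong (≈-trans (SR.reflexive (cong x^ (alive-++ σ′ τ′))) (x^-+ (alive σ′) (alive τ′))) (Fn-++ t cl′ τ′))
      (solve 4 (λ a b c d → (a :* b) :* (c :* d) := (a :* c) :* (b :* d)) ≈-refl (x^ (alive σ′)) (x^ (alive τ′)) (Fn t σ′) (Fn t τ′))

F-++ : ∀ {σ} → Closed σ → ∀ τ → F (σ ++ τ) ≈ F σ · F τ
F-++ {σ} cl τ = mk≈ λ m → trans (trans (F-at (σ ++ τ) m) (at (Fn-++ (suc m) cl τ) m))
  (sym (≈[]-· {F σ} {Fn (suc m) σ} {F τ} {Fn (suc m) τ} (F≈Fn (suc m) σ) (F≈Fn (suc m) τ) m ℕₚ.≤-refl))

-- The transfer with a bottom row of weight s + 1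

U : Config → Series
U σ = 𝓛 true σ F

Bn : ℕ → ℕ → Config → Series
Bn s zero σ = zeroS
Bn s (suc t) σ = U σ ⊕ x^ (suc s) · 𝓛 false σ (Bn s t)

x^suc-contracts : ∀ s {f g n} → f ≈[ n ] g → x^ (suc s) · f ≈[ suc n ] x^ (suc s) · g
x^suc-contracts s {f} {g} {n} e = ≈[]-mono {x^ (suc s) · f} {x^ (suc s) · g} (s≤s (ℕₚ.m≤n+m n s)) (≈[]-x^ (suc s) {f} {g} e)

Bn-stable : ∀ s t σ → Bn s (suc t) σ ≈[ t ] Bn s t σ
Bn-stable s zero σ m ()
Bn-stable s (suc t) σ = ≈[]-⊕ {U σ} {U σ} (λ _ _ → refl)
  (x^suc-contracts s {𝓛 false σ (Bn s (suc t))} {𝓛 false σ (Bn s t)} (𝓛-≈[] false σ {Bn s (suc t)} {Bn s t} (Bn-stable s t)))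

-- B s σ counts the completions of σ placed above a further row of weight x^(s+1) per step,
-- which ends at the single vertical bond that joins it to the bottom row of σ.
opaque
  B : ℕ → Config → Series
  B s σ = limit (λ t → Bn s t σ)

  B-at : ∀ s σ m → B s σ m ≡ Bn s (suc m) σ m
  B-at s σ m = refl

B≈Bn : ∀ s t σ → B s σ ≈[ t ] Bn s t σ
B≈Bn s t σ m m<t = trans (B-at s σ m) (limit-≈[] (λ t → Bn s t σ) (λ t → Bn-stable s t σ) t m m<t)

B-eq : ∀ s σ → B s σ ≈ U σ ⊕ x^ (suc s) · 𝓛 false σ (B s)
B-eq s σ = mk≈ λ m → trans (B≈Bn s (suc (suc m)) σ m (ℕₚ.m≤n⇒m≤1+n ℕₚ.≤-refl))
  (≈[]-⊕ {U σ} {U σ} {n = suc m} (λ _ _ → refl)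
    (≈[]-mono {x^ (suc s) · 𝓛 false σ (Bn s (suc m))} {x^ (suc s) · 𝓛 false σ (B s)} (ℕₚ.n≤1+n (suc m))
      (x^suc-contracts s {𝓛 false σ (Bn s (suc m))} {𝓛 false σ (B s)}
        (𝓛-≈[] false σ {Bn s (suc m)} {B s} (λ τ i i<m → sym (B≈Bn s (suc m) τ i i<m))))) m ℕₚ.≤-refl)

transfer-unique : ∀ s {X X′ : Config → Series} (Y : Config → Series) →
  (∀ σ → X σ ≈ Y σ ⊕ x^ (suc s) · 𝓛 false σ X) → (∀ σ → X′ σ ≈ Y σ ⊕ x^ (suc s) · 𝓛 false σ X′) → ∀ σ → X σ ≈ X′ σ
transfer-unique s {X} {X′} Y e e′ σ = mk≈ λ m → go (suc m) σ m ℕₚ.≤-refl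
  where
    go : ∀ n σ → X σ ≈[ n ] X′ σ
    go zero σ m ()
    go (suc n) σ m m<n = trans (at (e σ) m) (trans
      (≈[]-⊕ {Y σ} {Y σ} {n = suc n} (λ _ _ → refl) (x^suc-contracts s {𝓛 false σ X} {𝓛 false σ X′} (𝓛-≈[] false σ {X} {X′} (go n))) m m<n)
      (sym (at (e′ σ) m)))

F-[] : F [] ≈ 𝟙
F-[] = F-dead [] refl

F-idle : ∀ σ → F ((false , 0) ∷ σ) ≈ F σ
F-idle σ = ≈-trans (F-++ (last false) σ) (≈-trans (SR.*-congʳ (F-dead ((false , 0) ∷ []) refl)) (SR.*-identityˡ (F σ)))

free : Series
free = F ((true , 0) ∷ [])

F-free : ∀ σ → F ((true , 0) ∷ σ) ≈ free · F σ
F-free σ = F-++ (last true) σ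

free-eq : free ≈ x^ 1 · free ⊕ 𝟙
free-eq = begin
  free                                                 ≈⟨ F-eq ((true , 0) ∷ []) ⟩
  𝓛 false ((true , 0) ∷ []) F                           ≈⟨ 𝓛-alive false 0 [] F ⟩
  x^ 1 · (x^ 0 · free ⊕ zeroS) ⊕ ((x^ 0 · F ((false , 0) ∷ []) ⊕ zeroS) ⊕ zeroS)
    ≈⟨ SR.+-cong (SR.*-congˡ (≈-trans (SR.+-identityʳ _) (x^0· free)))
         (≈-trans (SR.+-identityʳ _) (≈-trans (SR.+-identityʳ _) (≈-trans (x^0· _) (F-dead ((false , 0) ∷ []) refl)))) ⟩
  x^ 1 · free ⊕ 𝟙 ∎

free-inverse : oneMinus 1 · free ≈ 𝟙
free-inverse = begin
  oneMinus 1 · free                    ≈⟨ solve 2 (λ x f → (con 1ℚ :- x) :* f := f :- x :* f) ≈-refl (x^ 1) free ⟩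
  free ⊕ ⊖ (x^ 1 · free)               ≈⟨ SR.+-congʳ free-eq ⟩
  (x^ 1 · free ⊕ 𝟙) ⊕ ⊖ (x^ 1 · free)  ≈⟨ solve 1 (λ t → (t :+ con 1ℚ) :- t := con 1ℚ) ≈-refl (x^ 1 · free) ⟩
  𝟙 ∎
  where open S-Solver

C : Config → Series
C σ = F ((true , 1) ∷ σ)

C-eq : ∀ σ → C σ ≈ free · U σ ⊕ x^ 1 · 𝓛 false σ C
C-eq σ = begin
  C σ ≈⟨ F-eq ((true , 1) ∷ σ) ⟩
  𝓛 false ((true , 1) ∷ σ) F ≈⟨ 𝓛-alive false 1 σ F ⟩
  x^ 1 · 𝓛 false σ C ⊕ (𝓛 false σ (F ∘ ((false , 1) ∷_)) ⊕ ⅀ (emits 1 σ) (λ τ → x^ (alive τ) · F τ))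
    ≈⟨ SR.+-congˡ (SR.+-cong (𝓛-zero false σ (F-blocked 0)) (≈-trans (⅀-emits 0 σ F)
         (SR.+-cong (SR.*-congˡ (≈-trans (𝓛-cong true σ F-free) (𝓛-· true σ free F))) (𝓛-cong true σ F-idle)))) ⟩
  x^ 1 · 𝓛 false σ C ⊕ (zeroS ⊕ (x^ 1 · (free · U σ) ⊕ U σ))
    ≈⟨ SR.+-congˡ (SR.+-identityˡ _) ⟩
  x^ 1 · 𝓛 false σ C ⊕ (x^ 1 · (free · U σ) ⊕ U σ)
    ≈⟨ solve 4 (λ x l f u → x :* l :+ (x :* (f :* u) :+ u) := (x :* f :+ con 1ℚ) :* u :+ x :* l) ≈-refl (x^ 1) (𝓛 false σ C) free (U σ) ⟩
  (x^ 1 · free ⊕ 𝟙) · U σ ⊕ x^ 1 · 𝓛 false σ C ≈⟨ SR.+-congʳ (SR.*-congʳ (≈-sym free-eq)) ⟩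
  free · U σ ⊕ x^ 1 · 𝓛 false σ C ∎
  where open S-Solver

C≈B : ∀ σ → oneMinus 1 · C σ ≈ B 0 σ
C≈B = transfer-unique 0 {λ σ → oneMinus 1 · C σ} {B 0} U
  (λ σ → begin
    oneMinus 1 · C σ ≈⟨ SR.*-congˡ (C-eq σ) ⟩
    oneMinus 1 · (free · U σ ⊕ x^ 1 · 𝓛 false σ C) ≈⟨ solve 5 (λ p f u x l → p :* (f :* u :+ x :* l) := (p :* f) :* u :+ x :* (p :* l)) ≈-refl (oneMinus 1) free (U σ) (x^ 1) (𝓛 false σ C) ⟩
    (oneMinus 1 · free) · U σ ⊕ x^ 1 · (oneMinus 1 · 𝓛 false σ C)
      ≈⟨ SR.+-cong (≈-trans (SR.*-congʳ free-inverse) (SR.*-identityˡ (U σ))) (SR.*-congˡ (≈-sym (𝓛-· false σ (oneMinus 1) C))) ⟩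
    U σ ⊕ x^ 1 · 𝓛 false σ (λ τ → oneMinus 1 · C τ) ∎)
  (B-eq 0)
  where open S-Solver

module _ (s : ℕ) where

  private
    w = x^ (suc s)
    x = x^ 1

  A A′ : Config → Series
  A σ = B s ((true , 1) ∷ σ)
  A′ σ = B s ((false , 1) ∷ σ)

  z z′ : Series
  z = B s ((true , 0) ∷ [])
  z′ = B s ((false , 0) ∷ [])

  B-idle-eq : ∀ σ → B s ((false , 0) ∷ σ) ≈ free · F σ ⊕ w · 𝓛 false σ (B s ∘ ((false , 0) ∷_))
  B-idle-eq σ = ≈-trans (B-eq s ((false , 0) ∷ σ)) (SR.+-cong (≈-trans (≈-sym (F-eq ((true , 0) ∷ σ))) (F-free σ)) (SR.*-congˡ (𝓛-dead 0 σ (B s))))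

  z′-eq : z′ ≈ free ⊕ w · z′
  z′-eq = ≈-trans (B-idle-eq []) (SR.+-cong (≈-trans (SR.*-congˡ F-[]) (SR.*-identityʳ free)) (SR.*-congˡ (≈-trans (SR.+-identityʳ _) (x^0· z′))))

  B-idle : ∀ σ → B s ((false , 0) ∷ σ) ≈ z′ · F σ
  B-idle = transfer-unique s {B s ∘ ((false , 0) ∷_)} {λ σ → z′ · F σ} (λ σ → free · F σ) B-idle-eq
    (λ σ → begin
      z′ · F σ ≈⟨ SR.*-congʳ z′-eq ⟩
      (free ⊕ w · z′) · F σ ≈⟨ solve 4 (λ a w z f → (a :+ w :* z) :* f := a :* f :+ w :* (z :* f)) ≈-refl free w z′ (F σ) ⟩
      free · F σ ⊕ w · (z′ · F σ) ≈⟨ SR.+-congˡ (SR.*-congˡ (≈-trans (SR.*-congˡ (F-eq σ)) (≈-sym (𝓛-· false σ z′ F)))) ⟩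
      free · F σ ⊕ w · 𝓛 false σ (λ τ → z′ · F τ) ∎)
    where open S-Solver

  B-free-eq : ∀ σ → B s ((true , 0) ∷ σ) ≈ (free ⊕ w · z′) · F σ ⊕ x^ (suc (suc s)) · 𝓛 false σ (B s ∘ ((true , 0) ∷_))
  B-free-eq σ = begin
    B s ((true , 0) ∷ σ) ≈⟨ B-eq s ((true , 0) ∷ σ) ⟩
    𝓛 true ((true , 0) ∷ σ) F ⊕ w · 𝓛 false ((true , 0) ∷ σ) (B s)
      ≈⟨ SR.+-cong (≈-trans (≈-sym (F-eq ((true , 0) ∷ σ))) (F-free σ)) (SR.*-congˡ (𝓛-alive false 0 σ (B s))) ⟩
    free · F σ ⊕ w · (x · L ⊕ (𝓛 false σ (B s ∘ ((false , 0) ∷_)) ⊕ zeroS))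
      ≈⟨ SR.+-congˡ (SR.*-congˡ (SR.+-congˡ (≈-trans (SR.+-identityʳ _) (≈-trans (𝓛-cong false σ B-idle) (≈-trans (𝓛-· false σ z′ F) (SR.*-congˡ (≈-sym (F-eq σ)))))))) ⟩
    free · F σ ⊕ w · (x · L ⊕ z′ · F σ)
      ≈⟨ solve 6 (λ a f w x l z → a :* f :+ w :* (x :* l :+ z :* f) := (a :+ w :* z) :* f :+ (x :* w) :* l) ≈-refl free (F σ) w x L z′ ⟩
    (free ⊕ w · z′) · F σ ⊕ (x · w) · L ≈⟨ SR.+-congˡ (SR.*-congʳ (≈-sym (x^-+ 1 (suc s)))) ⟩
    (free ⊕ w · z′) · F σ ⊕ x^ (suc (suc s)) · L ∎
    where
      open S-Solver
      L = 𝓛 false σ (B s ∘ ((true , 0) ∷_))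

  z-eq : z ≈ (free ⊕ w · z′) ⊕ x^ (suc (suc s)) · z
  z-eq = ≈-trans (B-free-eq []) (SR.+-cong (≈-trans (SR.*-congˡ F-[]) (SR.*-identityʳ _)) (SR.*-congˡ (≈-trans (SR.+-identityʳ _) (x^0· z))))

  B-free : ∀ σ → B s ((true , 0) ∷ σ) ≈ z · F σ
  B-free = transfer-unique (suc s) {B s ∘ ((true , 0) ∷_)} {λ σ → z · F σ} (λ σ → (free ⊕ w · z′) · F σ) B-free-eq
    (λ σ → begin
      z · F σ ≈⟨ SR.*-congʳ z-eq ⟩
      ((free ⊕ w · z′) ⊕ x^ (suc (suc s)) · z) · F σ ≈⟨ solve 4 (λ a w z f → (a :+ w :* z) :* f := a :* f :+ w :* (z :* f)) ≈-refl (free ⊕ w · z′) (x^ (suc (suc s))) z (F σ) ⟩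
      (free ⊕ w · z′) · F σ ⊕ x^ (suc (suc s)) · (z · F σ) ≈⟨ SR.+-congˡ (SR.*-congˡ (≈-trans (SR.*-congˡ (F-eq σ)) (≈-sym (𝓛-· false σ z F)))) ⟩
      (free ⊕ w · z′) · F σ ⊕ x^ (suc (suc s)) · 𝓛 false σ (λ τ → z · F τ) ∎)
    where open S-Solver

  A′-eq : ∀ σ → A′ σ ≈ C σ ⊕ w · 𝓛 false σ A′
  A′-eq σ = ≈-trans (B-eq s ((false , 1) ∷ σ)) (SR.+-cong (≈-sym (F-eq ((true , 1) ∷ σ))) (SR.*-congˡ (𝓛-dead 1 σ (B s))))

  A-eq : ∀ σ → A σ ≈ (A′ σ ⊕ w · ((x · z ⊕ z′) · U σ)) ⊕ x^ (suc (suc s)) · 𝓛 false σ A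
  A-eq σ = begin
    A σ ≈⟨ B-eq s ((true , 1) ∷ σ) ⟩
    𝓛 true ((true , 1) ∷ σ) F ⊕ w · 𝓛 false ((true , 1) ∷ σ) (B s)
      ≈⟨ SR.+-cong (≈-sym (F-eq ((true , 1) ∷ σ))) (SR.*-congˡ (≈-trans (𝓛-alive false 1 σ (B s)) (SR.+-congˡ (SR.+-congˡ (≈-trans (⅀-emits 0 σ (B s))
           (SR.+-cong (SR.*-congˡ (≈-trans (𝓛-cong true σ B-free) (𝓛-· true σ z F))) (≈-trans (𝓛-cong true σ B-idle) (𝓛-· true σ z′ F)))))))) ⟩
    C σ ⊕ w · (x · 𝓛 false σ A ⊕ (𝓛 false σ A′ ⊕ (x · (z · U σ) ⊕ z′ · U σ)))
      ≈⟨ solve 8 (λ c w x la la′ z z′ u → c :+ w :* (x :* la :+ (la′ :+ (x :* (z :* u) :+ z′ :* u))) := ((c :+ w :* la′) :+ w :* ((x :* z :+ z′) :* u)) :+ (x :* w) :* la) ≈-refl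
           (C σ) w x (𝓛 false σ A) (𝓛 false σ A′) z z′ (U σ) ⟩
    ((C σ ⊕ w · 𝓛 false σ A′) ⊕ w · ((x · z ⊕ z′) · U σ)) ⊕ (x · w) · 𝓛 false σ A
      ≈⟨ SR.+-cong (SR.+-congʳ (≈-sym (A′-eq σ))) (SR.*-congʳ (≈-sym (x^-+ 1 (suc s)))) ⟩
    (A′ σ ⊕ w · ((x · z ⊕ z′) · U σ)) ⊕ x^ (suc (suc s)) · 𝓛 false σ A ∎
    where open S-Solver

  private
    p = oneMinus 1
    q = oneMinus (suc s)
    r = oneMinus (suc (suc s))
    κ = x · w · free ⊕ p · q · (w · (x · z ⊕ z′))
    B⁺ = B (suc s)

    Y : Config → Series
    Y σ = p · q · (A′ σ ⊕ w · ((x · z ⊕ z′) · U σ))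

    V : Config → Series
    V σ = (q · A′ σ ⊕ (⊖ x) · C σ) ⊕ κ · B⁺ σ

    𝓛V : ∀ σ → 𝓛 false σ V ≈ (q · 𝓛 false σ A′ ⊕ (⊖ x) · 𝓛 false σ C) ⊕ κ · 𝓛 false σ B⁺
    𝓛V σ = ≈-trans (𝓛-⊕ false σ _ _) (SR.+-cong (≈-trans (𝓛-⊕ false σ _ _) (SR.+-cong (𝓛-· false σ q A′) (𝓛-· false σ (⊖ x) C))) (𝓛-· false σ κ B⁺))

    -- V is the solution of (1 - x w 𝓛) V = Y, found by partial fractions in 𝓛 from
    -- (1 - w 𝓛) A′ = C, (1 - x 𝓛) C = free · U and (1 - x w 𝓛) B⁺ = U.
    V-eq : ∀ σ → V σ ≈ Y σ ⊕ x^ (suc (suc s)) · 𝓛 false σ V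
    V-eq σ = ≈-sym (begin
      Y σ ⊕ x^ (suc (suc s)) · 𝓛 false σ V ≈⟨ SR.+-congˡ (SR.*-cong (x^-+ 1 (suc s)) (𝓛V σ)) ⟩
      Y σ ⊕ (x · w) · ((q · a ⊕ (⊖ x) · c) ⊕ κ · b)
        ≈⟨ solve 7 (λ y x w a c k b → y :+ (x :* w) :* (((con 1ℚ :- w) :* a :+ (:- x) :* c) :+ k :* b) := y :+ (((con 1ℚ :- w) :* x :* (w :* a) :+ :- (x :* w :* (x :* c))) :+ k :* ((x :* w) :* b))) ≈-refl (Y σ) x w a c κ b ⟩
      Y σ ⊕ ((q · x · (w · a) ⊕ ⊖ (x · w · (x · c))) ⊕ κ · ((x · w) · b))
        ≈⟨ SR.+-congˡ (SR.+-cong (SR.+-cong (SR.*-congˡ wa) (SR.-‿cong (SR.*-congˡ xc))) (SR.*-congˡ xwb)) ⟩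
      Y σ ⊕ ((q · x · (A′ σ ⊕ ⊖ C σ) ⊕ ⊖ (x · w · (C σ ⊕ ⊖ (free · U σ)))) ⊕ κ · (B⁺ σ ⊕ ⊖ U σ))
        ≈⟨ solve 8 (λ x w a′ m c fu u b → (con 1ℚ :- x) :* (con 1ℚ :- w) :* (a′ :+ m) :+ (((con 1ℚ :- w) :* x :* (a′ :- c) :- x :* w :* (c :- fu)) :+ (b :- u))
              := (((con 1ℚ :- w) :* a′ :+ (:- x) :* c) :+ b) :+ ((con 1ℚ :- x) :* (con 1ℚ :- w) :* m :+ x :* w :* fu :- u)) ≈-refl
            x w (A′ σ) (w · ((x · z ⊕ z′) · U σ)) (C σ) (free · U σ) (κ · U σ) (κ · B⁺ σ) ⟨≈⟩ʳ SR.+-congˡ (SR.+-congˡ (κ-distrib (B⁺ σ))) ⟩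
      V σ ⊕ (p · q · (w · ((x · z ⊕ z′) · U σ)) ⊕ x · w · (free · U σ) ⊕ ⊖ (κ · U σ))
        ≈⟨ SR.+-congˡ (solve 7 (λ x w pq zz f u v → pq :* (w :* (zz :* u)) :+ x :* w :* (f :* u) :- (x :* w :* f :+ pq :* (w :* zz)) :* u := con 0ℚ) ≈-refl x w (p · q) (x · z ⊕ z′) free (U σ) (V σ)) ⟩
      V σ ⊕ const 0ℚ ≈⟨ SR.+-congˡ const-0 ⟩
      V σ ⊕ zeroS ≈⟨ SR.+-identityʳ (V σ) ⟩
      V σ ∎)
      where
        open S-Solver
        a = 𝓛 false σ A′
        c = 𝓛 false σ C
        b = 𝓛 false σ B⁺
        κ-distrib : ∀ t → κ · (t ⊕ ⊖ U σ) ≈ κ · t ⊕ ⊖ (κ · U σ)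
        κ-distrib t = solve 3 (λ k t u → k :* (t :- u) := k :* t :- k :* u) ≈-refl κ t (U σ)
        infixl 1 _⟨≈⟩ʳ_
        _⟨≈⟩ʳ_ : ∀ {f g h} → g ≈ h → f ≈ g → f ≈ h
        e ⟨≈⟩ʳ e′ = ≈-trans e′ e
        solveFor : ∀ {f g h} → f ≈ g ⊕ h → h ≈ f ⊕ ⊖ g
        solveFor {f} {g} {h} e = ≈-trans (solve 2 (λ g h → h := (g :+ h) :- g) ≈-refl g h) (SR.+-congʳ (≈-sym e))
        wa : w · a ≈ A′ σ ⊕ ⊖ C σ
        wa = solveFor (A′-eq σ)
        xc : x · c ≈ C σ ⊕ ⊖ (free · U σ)
        xc = solveFor (C-eq σ)
        xwb : (x · w) · b ≈ B⁺ σ ⊕ ⊖ U σ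
        xwb = ≈-trans (SR.*-congʳ (≈-sym (x^-+ 1 (suc s)))) (solveFor (B-eq (suc s) σ))

    A≈V : ∀ σ → p · q · A σ ≈ V σ
    A≈V = transfer-unique (suc s) {λ σ → p · q · A σ} {V} Y
      (λ σ → ≈-trans (SR.*-congˡ (A-eq σ)) (≈-trans (SR.distribˡ (p · q) _ _)
        (SR.+-congˡ (≈-trans (solve 3 (λ p x l → p :* (x :* l) := x :* (p :* l)) ≈-refl (p · q) (x^ (suc (suc s))) (𝓛 false σ A)) (SR.*-congˡ (≈-sym (𝓛-· false σ (p · q) A)))))))
      V-eq
      where open S-Solver

  q·z′ : q · z′ ≈ free
  q·z′ = begin
    q · z′ ≈⟨ solve 2 (λ w z → (con 1ℚ :- w) :* z := z :- w :* z) ≈-refl w z′ ⟩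
    z′ ⊕ ⊖ (w · z′) ≈⟨ SR.+-congʳ z′-eq ⟩
    (free ⊕ w · z′) ⊕ ⊖ (w · z′) ≈⟨ solve 2 (λ f t → (f :+ t) :- t := f) ≈-refl free (w · z′) ⟩
    free ∎
    where open S-Solver

  r·z : r · z ≈ free ⊕ w · z′
  r·z = begin
    r · z ≈⟨ solve 2 (λ w z → (con 1ℚ :- w) :* z := z :- w :* z) ≈-refl (x^ (suc (suc s))) z ⟩
    z ⊕ ⊖ (x^ (suc (suc s)) · z) ≈⟨ SR.+-congʳ z-eq ⟩
    ((free ⊕ w · z′) ⊕ x^ (suc (suc s)) · z) ⊕ ⊖ (x^ (suc (suc s)) · z) ≈⟨ solve 2 (λ f t → (f :+ t) :- t := f) ≈-refl (free ⊕ w · z′) (x^ (suc (suc s)) · z) ⟩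
    free ⊕ w · z′ ∎
    where open S-Solver

  z-inverse : p · q · (r · z) ≈ 𝟙
  z-inverse = begin
    p · q · (r · z) ≈⟨ SR.*-congˡ r·z ⟩
    p · q · (free ⊕ w · z′) ≈⟨ solve 4 (λ p w f z → p :* (con 1ℚ :- w) :* (f :+ w :* z) := (con 1ℚ :- w) :* (p :* f) :+ w :* (p :* ((con 1ℚ :- w) :* z))) ≈-refl p w free z′ ⟩
    q · (p · free) ⊕ w · (p · (q · z′)) ≈⟨ SR.+-congˡ (SR.*-congˡ (SR.*-congˡ q·z′)) ⟩
    q · (p · free) ⊕ w · (p · free) ≈⟨ SR.+-cong (SR.*-congˡ free-inverse) (SR.*-congˡ free-inverse) ⟩
    q · 𝟙 ⊕ w · 𝟙 ≈⟨ solve 1 (λ w → (con 1ℚ :- w) :* con 1ℚ :+ w :* con 1ℚ := con 1ℚ) ≈-refl w ⟩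
    𝟙 ∎
    where open S-Solver

  κ-value : p · r · κ ≈ w · N s
  κ-value = begin
    p · r · (x · w · free ⊕ p · q · (w · (x · z ⊕ z′)))
      ≈⟨ solve 8 (λ p r x w f q z z′ → p :* r :* (x :* w :* f :+ p :* q :* (w :* (x :* z :+ z′))) := r :* x :* w :* (p :* f) :+ (p :* w :* x :* (p :* q :* (r :* z)) :+ p :* r :* w :* (p :* (q :* z′)))) ≈-refl p r x w free q z z′ ⟩
    r · x · w · (p · free) ⊕ (p · w · x · (p · q · (r · z)) ⊕ p · r · w · (p · (q · z′)))
      ≈⟨ SR.+-cong (SR.*-congˡ free-inverse) (SR.+-cong (SR.*-congˡ z-inverse) (SR.*-congˡ (≈-trans (SR.*-congˡ q·z′) free-inverse))) ⟩
    r · x · w · 𝟙 ⊕ (p · w · x · 𝟙 ⊕ p · r · w · 𝟙)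
      ≈⟨ solve 3 (λ x w v → (con 1ℚ :- v) :* x :* w :* con 1ℚ :+ ((con 1ℚ :- x) :* w :* x :* con 1ℚ :+ (con 1ℚ :- x) :* (con 1ℚ :- v) :* w :* con 1ℚ) := w :* (con 1ℚ :+ x :- x :* x :- v)) ≈-refl x w (x^ (suc (suc s))) ⟩
    w · (𝟙 ⊕ x ⊕ ⊖ (x · x) ⊕ ⊖ x^ (suc (suc s)))
      ≈⟨ SR.*-congˡ (SR.+-congʳ (SR.+-congˡ (SR.-‿cong (≈-sym (x^-+ 1 1))))) ⟩
    w · N s ∎
    where open S-Solver

  B-reduce : ∀ σ → (p · r) · (p · q) · B s ((true , 1) ∷ σ) ≈
    (p · r) · (q · B s ((false , 1) ∷ σ) ⊕ (⊖ x) · C σ) ⊕ (w · N s) · B (suc s) σ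
  B-reduce σ = begin
    (p · r) · (p · q) · A σ ≈⟨ SR.*-assoc (p · r) (p · q) (A σ) ⟩
    (p · r) · (p · q · A σ) ≈⟨ SR.*-congˡ (A≈V σ) ⟩
    (p · r) · ((q · A′ σ ⊕ (⊖ x) · C σ) ⊕ κ · B⁺ σ) ≈⟨ solve 4 (λ d e k b → d :* (e :+ k :* b) := d :* e :+ (d :* k) :* b) ≈-refl (p · r) (q · A′ σ ⊕ (⊖ x) · C σ) κ (B⁺ σ) ⟩
    (p · r) · (q · A′ σ ⊕ (⊖ x) · C σ) ⊕ (p · r · κ) · B⁺ σ ≈⟨ SR.+-congˡ (SR.*-congʳ κ-value) ⟩
    (p · r) · (q · A′ σ ⊕ (⊖ x) · C σ) ⊕ (w · N s) · B⁺ σ ∎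
    where open S-Solver

wt : ℕ → Config → ℕ
wt n [] = 0
wt n ((s , μ) ∷ σ) = bit s + n * μ + wt n σ

wt-++ : ∀ n σ τ → wt n (σ ++ τ) ≡ wt n σ + wt n τ
wt-++ n [] τ = refl
wt-++ n ((s , μ) ∷ σ) τ = trans (cong (bit s + n * μ +_) (wt-++ n σ τ)) (sym (ℕₚ.+-assoc (bit s + n * μ) _ _))

private
  stay-≤ : ∀ {b s c a t u} → b ≤ s + c → t ≤ u + 0 → b + a + t ≤ s + a + u + c
  stay-≤ {b} {s} {c} {a} {t} {u} b≤ t≤ = ℕₚ.≤-trans (ℕₚ.+-mono-≤ (ℕₚ.+-monoˡ-≤ a b≤) t≤)
    (ℕₚ.≤-reflexive (solve 4 (λ s c a u → s :+ c :+ a :+ (u :+ con 0) := s :+ a :+ u :+ c) refl s c a u))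
    where open +-*-Solver
  emit-≤ : ∀ {b s c a t u} n → b ≤ s + c → t ≤ u + 1 → b + suc n * a + t ≤ s + suc n * suc a + u + c
  emit-≤ {b} {s} {c} {a} {t} {u} n b≤ t≤ = ℕₚ.≤-trans (ℕₚ.+-mono-≤ (ℕₚ.+-monoˡ-≤ (suc n * a) b≤) t≤)
    (ℕₚ.≤-trans (ℕₚ.m≤m+n _ n) (ℕₚ.≤-reflexive
      (solve 5 (λ s c a u n → s :+ c :+ (con 1 :+ n) :* a :+ (u :+ con 1) :+ n := s :+ (con 1 :+ n) :* (con 1 :+ a) :+ u :+ c) refl s c a u n)))
    where open +-*-Solver
  bit≤ : ∀ b s c → s ∨ c ≡ true → bit b ≤ bit s + bit c
  bit≤ b true c _ = ℕₚ.≤-trans (b≤1 b) (s≤s z≤n)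
    where
      b≤1 : ∀ b → bit b ≤ 1
      b≤1 false = z≤n
      b≤1 true = s≤s z≤n
  bit≤ false false true _ = z≤n
  bit≤ true false true _ = s≤s z≤n

succs-wt : ∀ n c σ → All (λ τ → wt (suc n) τ ≤ wt (suc n) σ + bit c) (succs c σ)
emits-wt : ∀ n s c μ σ → s ∨ c ≡ true → All (λ τ → wt (suc n) τ ≤ wt (suc n) ((s , μ) ∷ σ) + bit c) (emits μ σ)
emits-wt n s c zero σ e = []
emits-wt n s c (suc ν) σ e = Allₚ.++⁺ (Allₚ.map⁺ (All.map (emit-≤ {1} {bit s} {bit c} n (bit≤ true s c e)) (succs-wt n true σ)))
                                     (Allₚ.map⁺ (All.map (emit-≤ {0} {bit s} {bit c} n (bit≤ false s c e)) (succs-wt n true σ)))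
succs-wt n c [] = z≤n ∷ []
succs-wt n c ((s , μ) ∷ σ) = go (s ∨ c) refl
  where
    go : ∀ b → s ∨ c ≡ b → All (λ τ → wt (suc n) τ ≤ wt (suc n) ((s , μ) ∷ σ) + bit c) (rowSuccs b μ σ)
    go false e = Allₚ.map⁺ (All.map (stay-≤ {0} {bit s} {bit c} z≤n) (succs-wt n false σ))
    go true e = Allₚ.++⁺ (Allₚ.map⁺ (All.map (stay-≤ {1} {bit s} {bit c} (bit≤ true s c e)) (succs-wt n false σ)))
      (Allₚ.++⁺ (Allₚ.map⁺ (All.map (stay-≤ {0} {bit s} {bit c} (bit≤ false s c e)) (succs-wt n false σ))) (emits-wt n s c μ σ e))

succs-length : ∀ c σ → All (λ τ → length τ ≡ length σ) (succs c σ)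
succs-length c [] = refl ∷ []
succs-length c ((s , μ) ∷ σ) = go (s ∨ c)
  where
    ext : ∀ r c → All (λ τ → length τ ≡ suc (length σ)) (map (r ∷_) (succs c σ))
    ext r c = Allₚ.map⁺ (All.map (cong suc) (succs-length c σ))
    emit : ∀ μ → All (λ τ → length τ ≡ suc (length σ)) (emits μ σ)
    emit zero = []
    emit (suc ν) = Allₚ.++⁺ (ext _ true) (ext _ true)
    go : ∀ b → All (λ τ → length τ ≡ suc (length σ)) (rowSuccs b μ σ)
    go false = ext _ false
    go true = Allₚ.++⁺ (ext _ false) (Allₚ.++⁺ (ext _ false) (emit μ))

rest-All : ∀ {P : Config → Set} σ → All P (succs false σ) → All P (rest σ)
rest-All σ all = All.tail (subst (All _) (succs-rest σ) all)

rest-wt< : ∀ σ → All (λ τ → wt 2 τ < wt 2 σ) (rest σ)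
rest-wt< [] = []
rest-wt< ((false , μ) ∷ σ) = Allₚ.map⁺ (All.map (ℕₚ.+-monoʳ-< (2 * μ)) (rest-wt< σ))
rest-wt< ((true , μ) ∷ σ) = Allₚ.++⁺ (Allₚ.map⁺ (All.map (ℕₚ.+-monoʳ-< (1 + 2 * μ)) (rest-wt< σ)))
  (Allₚ.++⁺ (Allₚ.map⁺ (All.map drop (succs-wt 1 false σ))) (emit μ))
  where
    open +-*-Solver
    drop : ∀ {t} → t ≤ wt 2 σ + 0 → 2 * μ + t < 1 + 2 * μ + wt 2 σ
    drop t≤ = s≤s (ℕₚ.+-monoʳ-≤ (2 * μ) (subst (_ ≤_) (ℕₚ.+-identityʳ _) t≤))
    emit-< : ∀ b ν {t} → b ≤ 1 → t ≤ wt 2 σ + 1 → b + 2 * ν + t < 1 + 2 * suc ν + wt 2 σ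
    emit-< b ν b≤ t≤ = ℕₚ.≤-trans (s≤s (ℕₚ.+-mono-≤ (ℕₚ.+-monoˡ-≤ (2 * ν) b≤) t≤))
      (ℕₚ.≤-reflexive (solve 2 (λ n w → con 1 :+ (con 1 :+ con 2 :* n :+ (w :+ con 1)) := con 1 :+ con 2 :* (con 1 :+ n) :+ w) refl ν (wt 2 σ)))
    emit : ∀ μ → All (λ τ → wt 2 τ < 1 + 2 * μ + wt 2 σ) (emits μ σ)
    emit zero = []
    emit (suc ν) = Allₚ.++⁺ (Allₚ.map⁺ (All.map (emit-< 1 ν ℕₚ.≤-refl) (succs-wt 1 true σ)))
                            (Allₚ.map⁺ (All.map (emit-< 0 ν z≤n) (succs-wt 1 true σ)))

alive≤length : ∀ σ → alive σ ≤ length σ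
alive≤length [] = z≤n
alive≤length ((false , _) ∷ σ) = ℕₚ.m≤n⇒m≤1+n (alive≤length σ)
alive≤length ((true , _) ∷ σ) = s≤s (alive≤length σ)

wt1≡ : ∀ σ → wt 1 σ ≡ alive σ + verts σ
wt1≡ [] = refl
wt1≡ ((s , μ) ∷ σ) = trans (cong (bit s + 1 * μ +_) (wt1≡ σ))
  (solve 4 (λ s m a v → s :+ con 1 :* m :+ (a :+ v) := s :+ a :+ (m :+ v)) refl (bit s) μ (alive σ) (verts σ))
  where open +-*-Solver

poly-δ₀ : ∀ σ → IsPoly (δ₀ σ)
poly-δ₀ [] = poly-𝟙
poly-δ₀ ((false , zero) ∷ σ) = poly-δ₀ σ
poly-δ₀ ((false , suc _) ∷ σ) = poly-zero
poly-δ₀ ((true , _) ∷ σ) = poly-zero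

split-closed : ∀ σ → (Σ Config λ σ₁ → Σ Config λ σ₂ → σ ≡ σ₁ ++ σ₂ × Closed σ₁ × length σ₁ ≤ suc (verts σ₁)) ⊎ length σ ≤ verts σ
split-closed [] = inj₂ z≤n
split-closed ((s , zero) ∷ σ) = inj₁ ((s , 0) ∷ [] , σ , refl , last s , ℕₚ.≤-refl)
split-closed ((s , suc μ) ∷ σ) with split-closed σ
... | inj₁ (σ₁ , σ₂ , e , cl , le) = inj₁ ((s , suc μ) ∷ σ₁ , σ₂ , cong (_ ∷_) e , cons cl ,
    s≤s (ℕₚ.≤-trans le (s≤s (ℕₚ.m≤n+m (verts σ₁) μ))))
... | inj₂ le = inj₂ (s≤s (ℕₚ.≤-trans le (ℕₚ.m≤n+m (verts σ) μ)))

on off : List ℕ → Config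
on = map (true ,_)
off = map (false ,_)

root : List ℕ → Config
root [] = []
root (a ∷ τ) = (true , a) ∷ off τ

wt-on : ∀ α → wt 1 (on α) ≡ length α + sum α
wt-on [] = refl
wt-on (μ ∷ α) = trans (cong (1 + 1 * μ +_) (wt-on α))
  (solve 3 (λ m l s → con 1 :+ con 1 :* m :+ (l :+ s) := con 1 :+ l :+ (m :+ s)) refl μ (length α) (sum α))
  where open +-*-Solver

wt-off : ∀ τ → wt 1 (off τ) ≡ sum τ
wt-off [] = refl
wt-off (μ ∷ τ) = cong₂ _+_ (ℕₚ.*-identityˡ μ) (wt-off τ)

alive-off : ∀ τ → alive (off τ) ≡ 0
alive-off [] = refl
alive-off (_ ∷ τ) = alive-off τ

𝓛-off : ∀ τ f → 𝓛 false (off τ) f ≈ f (off τ)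
𝓛-off τ f = ≈-trans (SR.reflexive (cong (λ l → ⅀ l λ ρ → x^ (alive ρ) · f ρ) (trans (succs-rest (off τ)) (cong (off τ ∷_) (rest-dead (off τ) (alive-off τ))))))
  (≈-trans (SR.+-identityʳ _) (≈-trans (SR.*-congʳ (SR.reflexive (cong x^ (alive-off τ)))) (x^0· (f (off τ)))))

δ₀-off-zeros : ∀ τ → sum τ ≡ 0 → δ₀ (off τ) ≈ 𝟙
δ₀-off-zeros [] _ = ≈-refl
δ₀-off-zeros (zero ∷ τ) e = δ₀-off-zeros τ e

ones-config : ℕ → Config
ones-config j = on (replicate j 1) ++ (true , 0) ∷ []

ones-length : ∀ j → length (ones-config j) ≡ suc j
ones-length zero = refl
ones-length (suc j) = cong suc (ones-length j)

ones-closed : ∀ j → Closed (ones-config j)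
ones-closed zero = last true
ones-closed (suc j) = cons (ones-closed j)

all-ones : ∀ α {r} → All (1 ≤_) α → sum α + r ≡ length α → α ≡ replicate (length α) 1 × r ≡ 0
all-ones [] [] e = refl , e
all-ones (suc a ∷ α) {r} (_ ∷ ps) e = go a (ℕₚ.suc-injective e)
  where
    open +-*-Solver
    go : ∀ a → a + sum α + r ≡ length α → suc a ∷ α ≡ 1 ∷ replicate (length α) 1 × r ≡ 0
    go a e′ with all-ones α {a + r} ps (trans (solve 3 (λ s a r → s :+ (a :+ r) := a :+ s :+ r) refl (sum α) a r) e′)
    go zero e′ | eq , r≡0 = cong (1 ∷_) eq , r≡0

find-zero : ∀ α → All (1 ≤_) α ⊎ Σ (List ℕ) λ α₁ → Σ (List ℕ) λ α₂ → α ≡ α₁ ++ 0 ∷ α₂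
find-zero [] = inj₁ []
find-zero (zero ∷ α) = inj₂ ([] , α , refl)
find-zero (suc a ∷ α) with find-zero α
... | inj₁ ps = inj₁ (s≤s z≤n ∷ ps)
... | inj₂ (α₁ , α₂ , e) = inj₂ (suc a ∷ α₁ , α₂ , cong (suc a ∷_) e)

Closed-∷ʳ : ∀ α → Closed (on α ++ (true , 0) ∷ [])
Closed-∷ʳ [] = last true
Closed-∷ʳ (_ ∷ α) = cons (Closed-∷ʳ α)

module Singular (Ψ : ℕ → Poly) (cyc : IsCyclotomic Ψ) (k′ : ℕ) where

  open Localization Ψ cyc k′ public

  reg-⅀ : ∀ {A : Set} {xs : List A} {f : A → Series} → All (λ a → Reg (f a)) xs → Reg (⅀ xs f)
  reg-⅀ [] = reg-zero
  reg-⅀ (p ∷ ps) = reg-⊕ p (reg-⅀ ps)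

  reg-x^ : ∀ n → Reg (x^ n)
  reg-x^ n = reg-poly (poly-x^ n)

  reg-solve : ∀ (X : Config → Series) (Good : Config → Set) → (∀ σ → Good σ → All Good (rest σ)) →
    (∀ σ → Good σ → Reg (X σ) ⊎ Σ ℕ λ s → Σ Series λ Y → Reg Y × Unit (oneMinus (s + alive σ)) × X σ ≈ Y ⊕ x^ s · 𝓛 false σ X) →
    ∀ σ → Good σ → Reg (X σ)
  reg-solve X Good closed eqn σ = go (suc (wt 2 σ)) σ ℕₚ.≤-refl
    where
      go : ∀ n σ → wt 2 σ < n → Good σ → Reg (X σ)
      go (suc n) σ (s≤s lt) gσ = cases (eqn σ gσ)
        where
          R : Series
          R = ⅀ (rest σ) (λ τ → x^ (alive τ) · X τ)
          reg-R : Reg R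
          reg-R = reg-⅀ (All.zipWith (λ { {τ} (gτ , lt′) → reg-· (reg-x^ (alive τ)) (go n τ (ℕₚ.≤-trans lt′ lt) gτ) }) (closed σ gσ , rest-wt< σ))
          cases : (Reg (X σ) ⊎ Σ ℕ λ s → Σ Series λ Y → Reg Y × Unit (oneMinus (s + alive σ)) × X σ ≈ Y ⊕ x^ s · 𝓛 false σ X) → Reg (X σ)
          cases (inj₁ p) = p
          cases (inj₂ (s , Y , rY , u , e)) = reg-/ u (reg-≈ (≈-sym (begin
              oneMinus (s + alive σ) · X σ
                ≈⟨ solve 2 (λ v f → (con 1ℚ :- v) :* f := f :- v :* f) ≈-refl (x^ (s + alive σ)) (X σ) ⟩
              X σ ⊕ ⊖ (x^ (s + alive σ) · X σ)
                ≈⟨ SR.+-cong (≈-trans e (SR.+-congˡ (SR.*-congˡ (SR.reflexive (cong (λ l → ⅀ l λ τ → x^ (alive τ) · X τ) (succs-rest σ))))))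
                             (SR.-‿cong (SR.*-congʳ (x^-+ s (alive σ)))) ⟩
              (Y ⊕ x^ s · (x^ (alive σ) · X σ ⊕ R)) ⊕ ⊖ (x^ s · x^ (alive σ) · X σ)
                ≈⟨ solve 5 (λ y v a f r → (y :+ v :* (a :* f :+ r)) :- v :* a :* f := y :+ v :* r) ≈-refl Y (x^ s) (x^ (alive σ)) (X σ) R ⟩
              Y ⊕ x^ s · R ∎)) (reg-⊕ rY (reg-· (reg-x^ s) reg-R)))
            where open S-Solver

  reg-F-dead : ∀ σ → alive σ ≡ 0 → Reg (F σ)
  reg-F-dead σ e = reg-≈ (≈-sym (F-dead σ e)) (reg-poly (poly-δ₀ σ))

  private
    F-cases : ∀ σ → alive σ ≤ k′ → Reg (F σ) ⊎ Σ ℕ λ s → Σ Series λ Y → Reg Y × Unit (oneMinus (s + alive σ)) × F σ ≈ Y ⊕ x^ s · 𝓛 false σ F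
    F-cases σ le = go (alive σ ≟ 0)
      where
        go : Dec (alive σ ≡ 0) → _
        go (yes e) = inj₁ (reg-F-dead σ e)
        go (no ne) = inj₂ (0 , zeroS , reg-zero , unit-oneMinus (alive σ) (ℕₚ.n≢0⇒n>0 ne) (s≤s le) ,
          ≈-trans (F-eq σ) (≈-sym (≈-trans (SR.+-identityˡ _) (x^0· _))))

  reg-F-short : ∀ σ → length σ ≤ k′ → Reg (F σ)
  reg-F-short = reg-solve F (λ σ → length σ ≤ k′)
    (λ σ le → rest-All σ (All.map (λ e → subst (_≤ k′) (sym e) le) (succs-length false σ)))
    (λ σ le → F-cases σ (ℕₚ.≤-trans (alive≤length σ) le))

  reg-F-few : ∀ σ → suc (verts σ) ≤ k′ → Reg (F σ)
  reg-F-few σ = go (suc (length σ)) σ ℕₚ.≤-refl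
    where
      go : ∀ n σ → length σ < n → suc (verts σ) ≤ k′ → Reg (F σ)
      go (suc n) σ (s≤s lt) le = cases (split-closed σ)
        where
          cases : (Σ Config λ σ₁ → Σ Config λ σ₂ → σ ≡ σ₁ ++ σ₂ × Closed σ₁ × length σ₁ ≤ suc (verts σ₁)) ⊎ length σ ≤ verts σ → Reg (F σ)
          cases (inj₂ l) = reg-F-short σ (ℕₚ.≤-trans l (ℕₚ.≤-trans (ℕₚ.n≤1+n _) le))
          cases (inj₁ (σ₁ , σ₂ , refl , cl , l)) = reg-≈ (≈-sym (F-++ cl σ₂)) (reg-·
              (reg-F-short σ₁ (ℕₚ.≤-trans l (ℕₚ.≤-trans (s≤s (ℕₚ.m≤m+n (verts σ₁) (verts σ₂))) le′)))
              (go n σ₂ (ℕₚ.≤-trans (shorter cl) lt) (ℕₚ.≤-trans (s≤s (ℕₚ.m≤n+m (verts σ₂) (verts σ₁))) le′)))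
            where
              le′ : suc (verts σ₁ + verts σ₂) ≤ k′
              le′ = subst (λ v → suc v ≤ k′) (verts-++ σ₁ σ₂) le
              shorter : ∀ {σ₁} → Closed σ₁ → length σ₂ < length (σ₁ ++ σ₂)
              shorter (last _) = ℕₚ.≤-refl
              shorter (cons c) = s≤s (ℕₚ.<⇒≤ (shorter c))

  reg-F-light : ∀ σ → wt 1 σ ≤ k′ + k′ → Reg (F σ)
  reg-F-light = reg-solve F (λ σ → wt 1 σ ≤ k′ + k′)
    (λ σ le → rest-All σ (All.map (λ e → ℕₚ.≤-trans e (subst (_≤ k′ + k′) (sym (ℕₚ.+-identityʳ (wt 1 σ))) le)) (succs-wt 0 false σ)))
    eqn
    where
      eqn : ∀ σ → wt 1 σ ≤ k′ + k′ → _
      eqn σ le with suc (verts σ) ≤? k′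
      ... | yes few = inj₁ (reg-F-few σ few)
      ... | no many = F-cases σ (ℕₚ.+-cancelʳ-≤ k′ (alive σ) k′
              (ℕₚ.≤-trans (ℕₚ.+-monoʳ-≤ (alive σ) (ℕₚ.≤-pred (ℕₚ.≰⇒> many))) (subst (_≤ k′ + k′) (wt1≡ σ) le)))

  reg-B : ∀ s σ → suc s + length σ ≤ k′ → Reg (B s ((false , 1) ∷ σ))
  reg-B s = reg-solve (λ σ → B s ((false , 1) ∷ σ)) (λ σ → suc s + length σ ≤ k′)
    (λ σ le → rest-All σ (All.map (λ e → subst (λ l → suc s + l ≤ k′) (sym e) le) (succs-length false σ)))
    (λ σ le → inj₂ (suc s , C σ , reg-F-short ((true , 1) ∷ σ) (ℕₚ.≤-trans (s≤s (ℕₚ.m≤n+m (length σ) s)) le) ,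
      unit-oneMinus (suc s + alive σ) (s≤s z≤n) (s≤s (ℕₚ.≤-trans (ℕₚ.+-monoʳ-≤ (suc s) (alive≤length σ)) le)) , A′-eq s σ))

  -- Merging the two bottom rows of the staircase leaves a multiple of the same quantity with a
  -- heavier bottom row, up to terms without a pole.
  pole-B : ∀ j s → suc s + suc j ≡ k → Pole (B s (ones-config j))
  pole-B zero s e = pole (p · q · M) 𝟙 (unit-· (unit-· (unit-oneMinus 1 (s≤s z≤n) 1<k) (unit-oneMinus (suc s) (s≤s z≤n) s<k)) unit-M) unit-𝟙
    (begin
      p · q · M · (P · z s)     ≈⟨ solve 5 (λ p q M P z → p :* q :* M :* (P :* z) := p :* q :* ((M :* P) :* z)) ≈-refl p q M P (z s) ⟩
      p · q · (M · P · z s)     ≈⟨ SR.*-congˡ (SR.*-congʳ (≈-trans M·P (SR.reflexive (cong oneMinus (sym e′))))) ⟩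
      p · q · (oneMinus (suc (suc s)) · z s) ≈⟨ z-inverse s ⟩
      𝟙 ∎)
    where
      open S-Solver
      p = oneMinus 1
      q = oneMinus (suc s)
      e′ : suc (suc s) ≡ k
      e′ = trans (ℕₚ.+-comm 1 (suc s)) e
      s<k : suc s < k
      s<k = ℕₚ.≤-reflexive e′
      1<k : 1 < k
      1<k = ℕₚ.≤-trans (s≤s (s≤s z≤n)) s<k
  pole-B (suc j) s e = pole-/ (unit-· (unit-· up ur) (unit-· up uq)) (pole-≈ (≈-sym (≈-trans (B-reduce s σ) (SR.+-comm _ _)))
      (pole-⊕ (pole-· (unit-· (unit-x^ (suc s)) (unit-N s (s≤s 2≤k′))) (pole-B j (suc s) (trans (sym (ℕₚ.+-suc (suc s) (suc j))) e)))
        (reg-· (reg-poly (isPoly (unit-· up ur)))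
          (reg-⊕ (reg-· (reg-poly (isPoly uq)) (reg-B s σ (subst (λ l → suc s + l ≤ k′) (sym (ones-length j)) sj≤)))
                 (reg-· (reg-⊖ (reg-x^ 1)) (reg-F-short ((true , 1) ∷ σ) (subst (λ l → suc l ≤ k′) (sym (ones-length j)) (ℕₚ.≤-trans (s≤s (ℕₚ.m≤n+m (suc j) s)) sj≤))))))))
    where
      σ = ones-config j
      sj≤ : suc s + suc j ≤ k′
      sj≤ = ℕₚ.≤-pred (ℕₚ.≤-reflexive (trans (sym (ℕₚ.+-suc (suc s) (suc j))) e))
      ss≤k′ : suc (suc s) ≤ k′
      ss≤k′ = ℕₚ.≤-trans (s≤s (ℕₚ.≤-trans (ℕₚ.m≤m+n (suc s) j) (ℕₚ.≤-reflexive (sym (ℕₚ.+-suc s j))))) sj≤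
      2≤k′ : 2 ≤ k′
      2≤k′ = ℕₚ.≤-trans (s≤s (s≤s z≤n)) ss≤k′
      up = unit-oneMinus 1 (s≤s z≤n) (s≤s (ℕₚ.≤-trans (s≤s z≤n) 2≤k′))
      uq = unit-oneMinus (suc s) (s≤s z≤n) (s≤s (ℕₚ.≤-trans (ℕₚ.n≤1+n _) ss≤k′))
      ur = unit-oneMinus (suc (suc s)) (s≤s z≤n) (s≤s ss≤k′)

  fₖ : Series
  fₖ = F (ones-config k′)

  pole-fₖ : Pole fₖ
  pole-fₖ = go k′ refl
    where
      go : ∀ j → j ≡ k′ → Pole (F (ones-config j))
      go zero e = pole M 𝟙 unit-M unit-𝟙 (≈-trans (≈-sym (SR.*-assoc M P free))
        (≈-trans (SR.*-congʳ (≈-trans M·P (SR.reflexive (cong (λ j → oneMinus (suc j)) (sym e))))) free-inverse))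
      go (suc j) e = pole-/ (unit-oneMinus 1 (s≤s z≤n) (s≤s (subst (1 ≤_) e (s≤s z≤n))))
        (pole-≈ (≈-sym (C≈B (ones-config j))) (pole-B j 0 (cong suc e)))

  private
    W : ℕ
    W = suc (k′ + k′)

  reg-𝓛 : ∀ c σ {f} → (∀ τ → wt 1 τ ≤ wt 1 σ + bit c → Reg (f τ)) → Reg (𝓛 c σ f)
  reg-𝓛 c σ p = reg-⅀ (All.map (λ {τ} le → reg-· (reg-x^ (alive τ)) (p τ le)) (succs-wt 0 c σ))

  private
    𝓛-true-on : ∀ α a ρ f → 𝓛 true (on α ++ (true , a) ∷ ρ) f ≡ 𝓛 false (on α ++ (true , a) ∷ ρ) f
    𝓛-true-on [] a ρ f = refl
    𝓛-true-on (_ ∷ α) a ρ f = refl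

    reg-emits : ∀ μ σ (f : Config → Series) → (∀ τ → wt 1 τ < 1 + 1 * μ + wt 1 σ → Reg (f τ)) → (∀ g → 𝓛 true σ g ≡ 𝓛 false σ g) →
      Reg (⅀ (emits μ σ) (λ τ → x^ (alive τ) · f τ))
    reg-emits zero σ f p e = reg-zero
    reg-emits (suc ν) σ f p e = reg-≈ (≈-sym (⅀-emits ν σ f)) (reg-⊕
        (reg-· (reg-x^ 1) (subst Reg (sym (e _)) (reg-𝓛 false σ λ τ le → p _ (bound 1 ℕₚ.≤-refl le))))
        (subst Reg (sym (e _)) (reg-𝓛 false σ λ τ le → p _ (bound 0 z≤n le))))
      where
        open +-*-Solver
        bound : ∀ b {t} → b ≤ 1 → t ≤ wt 1 σ + 0 → b + 1 * ν + t < 1 + 1 * suc ν + wt 1 σ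
        bound b b≤ t≤ = ℕₚ.≤-trans (s≤s (ℕₚ.+-mono-≤ (ℕₚ.+-monoˡ-≤ (1 * ν) b≤) t≤))
          (ℕₚ.≤-reflexive (solve 2 (λ n w → con 1 :+ (con 1 :+ con 1 :* n :+ (w :+ con 0)) := con 1 :+ con 1 :* (con 1 :+ n) :+ w) refl ν (wt 1 σ)))

    drop-< : ∀ μ σ τ → wt 1 τ ≤ wt 1 σ + 0 → wt 1 ((false , μ) ∷ τ) < 1 + 1 * μ + wt 1 σ
    drop-< μ σ τ le = s≤s (ℕₚ.+-monoʳ-≤ (1 * μ) (subst (wt 1 τ ≤_) (ℕₚ.+-identityʳ _) le))

  -- Modulo series without a pole, the rows below the top one stay alive and emit nothing:
  -- anything else lowers the weight.
  𝓛-on : ∀ α a ρ f → (∀ τ → wt 1 τ < wt 1 (on α ++ (true , a) ∷ ρ) → Reg (f τ)) →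
    𝓛 false (on α ++ (true , a) ∷ ρ) f ≡ᴿ x^ (length α) · 𝓛 false ((true , a) ∷ ρ) (f ∘ (on α ++_))
  𝓛-on [] a ρ f p = ≈⇒≡ᴿ (≈-sym (x^0· _))
  𝓛-on (μ ∷ α) a ρ f p = ≡ᴿ-trans (≈⇒≡ᴿ (𝓛-alive false μ σ f)) (≡ᴿ-trans
      (≡ᴿ-⊕ (≡ᴿ-· (reg-x^ 1) (𝓛-on α a ρ (f ∘ ((true , μ) ∷_)) λ τ lt → p _ (ℕₚ.+-monoʳ-< (1 + 1 * μ) lt)))
            (reg⇒≡ᴿ0 (reg-⊕ (reg-𝓛 false σ λ τ le → p _ (drop-< μ σ τ le)) (reg-emits μ σ f p (𝓛-true-on α a ρ)))))
      (≈⇒≡ᴿ (≈-trans (SR.+-identityʳ _) (≈-trans (≈-sym (SR.*-assoc (x^ 1) (x^ (length α)) _)) (SR.*-congʳ (≈-sym (x^-+ 1 (length α))))))))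
    where σ = on α ++ (true , a) ∷ ρ

  private
    light : ∀ σ → wt 1 σ < W → Reg (F σ)
    light σ lt = reg-F-light σ (ℕₚ.≤-pred lt)

    config : List ℕ → ℕ → List ℕ → Config
    config α a τ = on α ++ (true , a) ∷ off τ

    wt-config : ∀ α ρ → wt 1 (on α ++ ρ) ≡ length α + sum α + wt 1 ρ
    wt-config α ρ = trans (wt-++ 1 (on α) ρ) (cong (_+ wt 1 ρ) (wt-on α))

    lighter : ∀ α {ρ ρ′} → wt 1 ρ′ < wt 1 ρ → wt 1 (on α ++ ρ) ≡ W → wt 1 (on α ++ ρ′) < W
    lighter α {ρ} {ρ′} lt e = subst₂ _<_ (sym (wt-++ 1 (on α) ρ′)) (trans (sym (wt-++ 1 (on α) ρ)) e) (ℕₚ.+-monoʳ-< (wt 1 (on α)) lt)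

    expand : ∀ α a τ → wt 1 (config α a τ) ≡ W →
      F (config α a τ) ≡ᴿ x^ (suc (length α)) · F (config α a τ) ⊕ x^ (length α) · ⅀ (emits a (off τ)) (λ ρ → x^ (alive ρ) · F (on α ++ ρ))
    expand α a τ e = ≡ᴿ-trans (≈⇒≡ᴿ (F-eq (config α a τ))) (≡ᴿ-trans (𝓛-on α a (off τ) F λ ρ lt → light ρ (subst (wt 1 ρ <_) e lt))
      (≡ᴿ-trans (≡ᴿ-· (reg-x^ (length α)) (≡ᴿ-trans (≈⇒≡ᴿ (𝓛-alive false a (off τ) (F ∘ (on α ++_))))
          (≡ᴿ-⊕ (≈⇒≡ᴿ (SR.*-congˡ (𝓛-off τ _)))
            (≡ᴿ-⊕ (reg⇒≡ᴿ0 (reg-𝓛 false (off τ) λ ρ le → light _ (lighter α (drop-< a (off τ) ρ le) e))) (≈⇒≡ᴿ ≈-refl)))))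
        (≈⇒≡ᴿ (≈-trans (SR.*-congˡ (SR.+-congˡ (SR.+-identityˡ _)))
          (≈-trans (solve 4 (λ l x f m → l :* (x :* f :+ m) := (x :* l) :* f :+ l :* m) ≈-refl (x^ (length α)) (x^ 1) (F (config α a τ)) _)
            (SR.+-congʳ (SR.*-congʳ (≈-sym (x^-+ 1 (length α))))))))))
      where open S-Solver

    on-∷ʳ : ∀ α b ρ → on (α ++ [ b ]) ++ ρ ≡ on α ++ (true , b) ∷ ρ
    on-∷ʳ [] b ρ = refl
    on-∷ʳ (a ∷ α) b ρ = cong ((true , a) ∷_) (on-∷ʳ α b ρ)

    emitted : ∀ α b τ → Series
    emitted α b τ = 𝓛 true (off τ) (λ ρ → F (on α ++ (true , b) ∷ ρ))

    expand-emit : ∀ α b τ → wt 1 (config α (suc b) τ) ≡ W →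
      F (config α (suc b) τ) ≡ᴿ x^ (suc (length α)) · F (config α (suc b) τ) ⊕ x^ (suc (length α)) · emitted α b τ
    expand-emit α b τ e = ≡ᴿ-trans (expand α (suc b) τ e) (≡ᴿ-⊕ (≈⇒≡ᴿ ≈-refl)
        (≡ᴿ-trans (≡ᴿ-· (reg-x^ (length α)) (≡ᴿ-trans (≈⇒≡ᴿ (⅀-emits b (off τ) (F ∘ (on α ++_))))
            (≡ᴿ-⊕ (≈⇒≡ᴿ ≈-refl) (reg⇒≡ᴿ0 (reg-𝓛 true (off τ) λ ρ le → light _ (lighter α (bound ρ le) e))))))
          (≈⇒≡ᴿ (≈-trans (SR.*-congˡ (SR.+-identityʳ _)) (≈-trans (solve 3 (λ l x m → l :* (x :* m) := (x :* l) :* m) ≈-refl (x^ (length α)) (x^ 1) (emitted α b τ))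
            (SR.*-congʳ (≈-sym (x^-+ 1 (length α)))))))))
      where
        open S-Solver
        module NS = +-*-Solver
        bound : ∀ ρ → wt 1 ρ ≤ wt 1 (off τ) + 1 → wt 1 ((false , b) ∷ ρ) < wt 1 ((true , suc b) ∷ off τ)
        bound ρ le = s≤s (ℕₚ.≤-trans (ℕₚ.+-monoʳ-≤ (1 * b) le) (ℕₚ.≤-reflexive
          (NS.solve 2 (λ n w → NS.con 1 NS.:* n NS.:+ (w NS.:+ NS.con 1) NS.:= NS.con 1 NS.:* (NS.con 1 NS.:+ n) NS.:+ w) refl b (wt 1 (off τ)))))

    next-wt : ∀ α b t τ → wt 1 (config (α ++ [ b ]) t τ) ≡ wt 1 (config α (suc b) (t ∷ τ))
    next-wt α b t τ = trans (cong (wt 1) (on-∷ʳ α b ((true , t) ∷ off τ))) (trans (wt-++ 1 (on α) _)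
      (trans (cong (wt 1 (on α) +_) (solve 3 (λ b t w → con 1 :+ con 1 :* b :+ (con 1 :+ con 1 :* t :+ w) := con 1 :+ con 1 :* (con 1 :+ b) :+ (con 1 :* t :+ w)) refl b t (wt 1 (off τ))))
        (sym (wt-++ 1 (on α) _))))
      where open +-*-Solver

    next-expand : ∀ α b t τ → wt 1 (config (α ++ [ b ]) t τ) ≡ W → F (config (α ++ [ b ]) t τ) ≡ᴿ x^ (suc (length α)) · emitted α b (t ∷ τ)
    next-expand α b t τ e = ≡ᴿ-trans (≈⇒≡ᴿ (F-eq (config (α ++ [ b ]) t τ))) (≡ᴿ-trans
      (𝓛-on (α ++ [ b ]) t (off τ) F λ ρ lt → light ρ (subst (wt 1 ρ <_) e lt))
      (≈⇒≡ᴿ (SR.*-cong (SR.reflexive (cong x^ (trans (Listₚ.length-++ α) (ℕₚ.+-comm (length α) 1))))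
        (𝓛-cong false ((true , t) ∷ off τ) λ ρ → SR.reflexive (cong F (on-∷ʳ α b ρ))))))

    oneMinus-≡ᴿ : ∀ j f g → f ≡ᴿ x^ j · f ⊕ g → oneMinus j · f ≡ᴿ g
    oneMinus-≡ᴿ j f g p = reg-≈ (solve 3 (λ v f g → f :- (v :* f :+ g) := (con 1ℚ :- v) :* f :- g) ≈-refl (x^ j) f g) p
      where open S-Solver

    advance : ∀ α b t τ → wt 1 (config α (suc b) (t ∷ τ)) ≡ W →
      oneMinus (suc (length α)) · F (config α (suc b) (t ∷ τ)) ≡ᴿ F (config (α ++ [ b ]) t τ)
    advance α b t τ e = oneMinus-≡ᴿ _ _ _ (≡ᴿ-trans (expand-emit α b (t ∷ τ) e)
      (≡ᴿ-⊕ (≈⇒≡ᴿ ≈-refl) (≡ᴿ-sym (next-expand α b t τ (trans (next-wt α b t τ) e)))))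

    stuck₀ : ∀ α τ → wt 1 (config α 0 τ) ≡ W → Reg (oneMinus (suc (length α)) · F (config α 0 τ))
    stuck₀ α τ e = reg-≡ᴿ (oneMinus-≡ᴿ _ _ _ (≡ᴿ-trans (expand α 0 τ e) (≡ᴿ-⊕ (≈⇒≡ᴿ ≈-refl) (≈⇒≡ᴿ (SR.zeroʳ _))))) reg-zero

    stuck₁ : ∀ α b → wt 1 (config α (suc b) []) ≡ W → Reg (oneMinus (suc (length α)) · F (config α (suc b) []))
    stuck₁ α b e = reg-≡ᴿ (oneMinus-≡ᴿ _ _ _ (expand-emit α b [] e)) (reg-· (reg-x^ _)
      (reg-≈ (≈-sym (≈-trans (SR.+-identityʳ _) (x^0· _))) (light _ (lighter α {(true , suc b) ∷ []} (s≤s (ℕₚ.+-monoˡ-≤ 0 (ℕₚ.*-monoʳ-< 1 (ℕₚ.n<1+n b)))) e))))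

  E : ℕ → Series
  E zero = 𝟙
  E (suc i) = E i · oneMinus (k′ ∸ i)

  unit-E : ∀ i → i ≤ k′ → Unit (E i)
  unit-E zero _ = unit-𝟙
  unit-E (suc i) i<k′ = unit-· (unit-E i (ℕₚ.<⇒≤ i<k′)) (unit-oneMinus (k′ ∸ i) (ℕₚ.m<n⇒0<n∸m i<k′) (s≤s (ℕₚ.m∸n≤m k′ i)))

  private
    Special : ℕ → List ℕ → ℕ → List ℕ → Set
    Special i α a τ = All (1 ≤_) α × Σ ℕ λ r → a ∷ τ ≡ replicate i 2 ++ 0 ∷ replicate r 0

    Multiple : ℕ → Config → Set → Set
    Multiple i σ S = Σ ℕ λ n → (E i · F σ ≡ᴿ const (ℕtoℚ n) · fₖ) × (S → 1 ≤ n)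

    const0· : ∀ f → const (ℕtoℚ 0) · f ≈ zeroS
    const0· f = ≈-trans (SR.*-congʳ const-0) (SR.zeroˡ f)

    full : ∀ α a τ → length α ≡ k′ → wt 1 (config α a τ) ≡ W → Multiple 0 (config α a τ) (Special 0 α a τ)
    full α a τ len e = cases (find-zero α)
      where
        open +-*-Solver
        sums : sum α + (a + sum τ) ≡ k′
        sums = ℕₚ.+-cancelˡ-≡ (suc k′) _ _ (trans
          (trans (cong (λ l → suc l + (sum α + (a + sum τ))) (sym len))
            (trans (solve 4 (λ l s a t → con 1 :+ l :+ (s :+ (a :+ t)) := l :+ s :+ (con 1 :+ con 1 :* a :+ t)) refl (length α) (sum α) a (sum τ))
              (sym (trans (wt-config α ((true , a) ∷ off τ)) (cong (λ t → length α + sum α + (1 + 1 * a + t)) (wt-off τ))))))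
          e)
        cases : All (1 ≤_) α ⊎ (Σ (List ℕ) λ α₁ → Σ (List ℕ) λ α₂ → α ≡ α₁ ++ 0 ∷ α₂) → Multiple 0 (config α a τ) (Special 0 α a τ)
        cases (inj₁ ps) = 1 , ≈⇒≡ᴿ (≈-trans (SR.*-identityˡ _) (≈-trans F≈ (≈-sym (SR.*-identityˡ fₖ)))) , λ _ → s≤s z≤n
          where
            ones = all-ones α {a + sum τ} ps (trans sums (sym len))
            a≡0 : a ≡ 0
            a≡0 = ℕₚ.m+n≡0⇒m≡0 a (proj₂ ones)
            F≈ : F (config α a τ) ≈ fₖ
            F≈ = begin
              F (config α a τ) ≈⟨ SR.reflexive (cong₂ (λ α a → F (config α a τ)) (trans (proj₁ ones) (cong (λ l → replicate l 1) len)) a≡0) ⟩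
              F (on (replicate k′ 1) ++ (true , 0) ∷ off τ) ≈⟨ SR.reflexive (cong F (sym (Listₚ.++-assoc (on (replicate k′ 1)) ((true , 0) ∷ []) (off τ)))) ⟩
              F (ones-config k′ ++ off τ) ≈⟨ F-++ (ones-closed k′) (off τ) ⟩
              fₖ · F (off τ) ≈⟨ SR.*-congˡ (≈-trans (F-dead (off τ) (alive-off τ)) (δ₀-off-zeros τ (ℕₚ.m+n≡0⇒n≡0 a (proj₂ ones)))) ⟩
              fₖ · 𝟙 ≈⟨ SR.*-identityʳ fₖ ⟩
              fₖ ∎
        cases (inj₂ (α₁ , α₂ , refl)) = 0 , ≡ᴿ-trans (reg⇒≡ᴿ0 (reg-≈ (≈-sym (SR.*-identityˡ _)) regular)) (≈⇒≡ᴿ (≈-sym (const0· fₖ))) ,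
            λ (ps , _) → ⊥-elim (ℕₚ.<-irrefl refl (All.head (Allₚ.++⁻ʳ α₁ ps)))
          where
            len′ : length α₁ + suc (length α₂) ≡ k′
            len′ = trans (sym (Listₚ.length-++ α₁)) len
            sums′ : sum α₁ + sum α₂ + (a + sum τ) ≡ k′
            sums′ = trans (cong (_+ (a + sum τ)) (sym (sum-++ α₁ (0 ∷ α₂)))) sums
            assoc : config (α₁ ++ 0 ∷ α₂) a τ ≡ (on α₁ ++ (true , 0) ∷ []) ++ config α₂ a τ
            assoc = trans (cong (_++ (true , a) ∷ off τ) (Listₚ.map-++ (true ,_) α₁ (0 ∷ α₂)))
              (trans (Listₚ.++-assoc (on α₁) (on (0 ∷ α₂)) _) (sym (Listₚ.++-assoc (on α₁) ((true , 0) ∷ []) (config α₂ a τ))))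
            regular : Reg (F (config (α₁ ++ 0 ∷ α₂) a τ))
            regular = reg-≈ (≈-trans (≈-sym (F-++ (Closed-∷ʳ α₁) (config α₂ a τ))) (SR.reflexive (cong F (sym assoc)))) (reg-·
              (reg-F-light _ (subst (_≤ k′ + k′) (sym (trans (wt-config α₁ ((true , 0) ∷ [])) (solve 2 (λ l s → l :+ s :+ con 1 := (l :+ con 1) :+ s) refl (length α₁) (sum α₁))))
                (ℕₚ.+-mono-≤ (subst (length α₁ + 1 ≤_) len′ (ℕₚ.+-monoʳ-≤ (length α₁) (s≤s z≤n)))
                  (subst (sum α₁ ≤_) sums′ (ℕₚ.≤-trans (ℕₚ.m≤m+n _ _) (ℕₚ.m≤m+n _ _))))))
              (reg-F-light _ (subst (_≤ k′ + k′) (sym (trans (wt-config α₂ ((true , a) ∷ off τ)) (trans (cong (λ t → length α₂ + sum α₂ + (1 + 1 * a + t)) (wt-off τ))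
                    (solve 4 (λ l s a t → l :+ s :+ (con 1 :+ con 1 :* a :+ t) := (con 1 :+ l) :+ (s :+ (a :+ t))) refl (length α₂) (sum α₂) a (sum τ)))))
                (ℕₚ.+-mono-≤ (subst (suc (length α₂) ≤_) len′ (ℕₚ.m≤n+m _ _))
                  (subst (sum α₂ + (a + sum τ) ≤_) (trans (sym (ℕₚ.+-assoc (sum α₁) (sum α₂) _)) sums′) (ℕₚ.m≤n+m _ (sum α₁)))))))

    reg-multiple : ∀ i {σ S} → Reg (E i · F σ) → ¬ S → Multiple i σ S
    reg-multiple i p ¬s = 0 , ≡ᴿ-trans (reg⇒≡ᴿ0 p) (≈⇒≡ᴿ (≈-sym (const0· fₖ))) , λ s → ⊥-elim (¬s s)

    multiple : ∀ i α a τ → length α + i ≡ k′ → wt 1 (config α a τ) ≡ W → Multiple i (config α a τ) (Special i α a τ)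
    multiple zero α a τ len e = full α a τ (trans (sym (ℕₚ.+-identityʳ _)) len) e
    multiple (suc i) α a τ len e = go a τ e
      where
        j≡ : k′ ∸ i ≡ suc (length α)
        j≡ = trans (cong (_∸ i) (trans (sym len) (ℕₚ.+-suc (length α) i))) (ℕₚ.m+n∸n≡m (suc (length α)) i)
        uE : Unit (E i)
        uE = unit-E i (subst (i ≤_) len (ℕₚ.≤-trans (ℕₚ.n≤1+n i) (ℕₚ.m≤n+m (suc i) (length α))))
        regroup : ∀ f → E (suc i) · f ≈ E i · (oneMinus (suc (length α)) · f)
        regroup f = ≈-trans (SR.*-assoc (E i) _ f) (SR.*-congˡ (SR.*-congʳ (SR.reflexive (cong oneMinus j≡))))
        go : ∀ a τ → wt 1 (config α a τ) ≡ W → Multiple (suc i) (config α a τ) (Special (suc i) α a τ)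
        go zero τ e = reg-multiple (suc i) (reg-≈ (≈-sym (regroup _)) (reg-· (reg-poly (isPoly uE)) (stuck₀ α τ e))) λ { (_ , _ , ()) }
        go (suc b) [] e = reg-multiple (suc i) (reg-≈ (≈-sym (regroup _)) (reg-· (reg-poly (isPoly uE)) (stuck₁ α b e))) (impossible i)
          where
            impossible : ∀ i → ¬ Special (suc i) α (suc b) []
            impossible zero (_ , _ , ())
            impossible (suc i) (_ , _ , ())
        go (suc b) (t ∷ τ) e with multiple i (α ++ [ b ]) t τ
               (trans (cong (_+ i) (Listₚ.length-++ α)) (trans (ℕₚ.+-assoc (length α) 1 i) len)) (trans (next-wt α b t τ) e)
        ... | n , eq , sp = n , ≡ᴿ-trans (≈⇒≡ᴿ (regroup _)) (≡ᴿ-trans (≡ᴿ-· (reg-poly (isPoly uE)) (advance α b t τ e)) eq) , sp′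
          where
            sp′ : Special (suc i) α (suc b) (t ∷ τ) → 1 ≤ n
            sp′ (ps , r , eq′) with Listₚ.∷-injective eq′
            ... | refl , eq″ = sp (Allₚ.++⁺ ps (s≤s z≤n ∷ []) , r , eq″)

  root-multiple : ∀ a τ → a + sum τ ≡ k′ + k′ →
    Σ ℕ λ n → (E k′ · F (root (a ∷ τ)) ≡ᴿ const (ℕtoℚ n) · fₖ) × ((Σ ℕ λ r → a ∷ τ ≡ replicate k′ 2 ++ 0 ∷ replicate r 0) → 1 ≤ n)
  root-multiple a τ e with multiple k′ [] a τ refl (cong suc (trans (cong₂ _+_ (ℕₚ.*-identityˡ a) (wt-off τ)) e))
  ... | n , eq , sp = n , eq , λ s → sp ([] , s)

module _ {A : Set} where

  Σ⊆ : (List A → ℕ) → List A → ℕ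
  Σ⊆ f [] = f []
  Σ⊆ f (b ∷ bs) = Σ⊆ f bs + Σ⊆ (f ∘ (b ∷_)) bs

  Σ⊆-cong : ∀ bs {f g} → (∀ S → S ⊆ bs → f S ≡ g S) → Σ⊆ f bs ≡ Σ⊆ g bs
  Σ⊆-cong [] e = e [] []
  Σ⊆-cong (b ∷ bs) e = cong₂ _+_ (Σ⊆-cong bs λ S s → e S (b ∷ʳ s)) (Σ⊆-cong bs λ S s → e (b ∷ S) (refl ∷ s))

  Σ⊆-zero : ∀ bs {f} → (∀ S → f S ≡ 0) → Σ⊆ f bs ≡ 0
  Σ⊆-zero [] e = e []
  Σ⊆-zero (b ∷ bs) e = cong₂ _+_ (Σ⊆-zero bs e) (Σ⊆-zero bs λ S → e (b ∷ S))

  Σ⊆-↭ : ∀ {bs bs′} → bs ↭ bs′ → ∀ {f} → (∀ {S S′} → S ↭ S′ → f S ≡ f S′) → Σ⊆ f bs ≡ Σ⊆ f bs′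
  Σ⊆-↭ Perm.refl inv = refl
  Σ⊆-↭ (prep x p) inv = cong₂ _+_ (Σ⊆-↭ p inv) (Σ⊆-↭ p λ q → inv (prep x q))
  Σ⊆-↭ (swap {xs} {ys} x y p) {f} inv = trans
    (cong₂ _+_ (cong₂ _+_ (Σ⊆-↭ p inv) (Σ⊆-↭ p λ q → inv (prep y q)))
               (cong₂ _+_ (Σ⊆-↭ p λ q → inv (prep x q)) (trans (Σ⊆-↭ p λ q → inv (prep x (prep y q))) (Σ⊆-cong ys λ S _ → inv (swap x y ↭-refl)))))
    (solve 4 (λ a b c d → (a :+ b) :+ (c :+ d) := (a :+ c) :+ (b :+ d)) refl (Σ⊆ f ys) (Σ⊆ (f ∘ (y ∷_)) ys) (Σ⊆ (f ∘ (x ∷_)) ys) _)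
    where open +-*-Solver
  Σ⊆-↭ (Perm.trans p q) inv = trans (Σ⊆-↭ p inv) (Σ⊆-↭ q inv)

  length-filter-++ : ∀ (p : A → Bool) xs ys → length (filterᵇ p (xs ++ ys)) ≡ length (filterᵇ p xs) + length (filterᵇ p ys)
  length-filter-++ p xs ys = trans (cong length (Listₚ.filter-++ (λ x → T? (p x)) xs ys)) (Listₚ.length-++ (filterᵇ p xs))

  count : (A → Bool) → List A → ℕ
  count p xs = length (filterᵇ p xs)

  count-∷ : ∀ p x xs → count p (x ∷ xs) ≡ bit (p x) + count p xs
  count-∷ p x xs with p x
  ... | true = refl
  ... | false = refl

count-map : ∀ {A B : Set} (p : B → Bool) (f : A → B) xs → count p (map f xs) ≡ count (p ∘ f) xs
count-map p f [] = refl
count-map p f (x ∷ xs) = trans (count-∷ p (f x) (map f xs)) (trans (cong (bit (p (f x)) +_) (count-map p f xs)) (sym (count-∷ (p ∘ f) x xs)))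

count-subsets : ∀ {A : Set} (p : List A → Bool) bs → count p (subsets bs) ≡ Σ⊆ (bit ∘ p) bs
count-subsets p [] = trans (count-∷ p [] []) (ℕₚ.+-identityʳ _)
count-subsets p (b ∷ bs) = trans (length-filter-++ p (subsets bs) (map (b ∷_) (subsets bs)))
  (cong₂ _+_ (count-subsets p bs) (trans (count-map p (b ∷_) (subsets bs)) (count-subsets (p ∘ (b ∷_)) bs)))

-- Reachability as a Boolean recursion

∨-true : ∀ a b → a ∨ b ≡ true → a ≡ true ⊎ b ≡ true
∨-true true b e = inj₁ refl
∨-true false b e = inj₂ e

∧-true : ∀ a b → a ∧ b ≡ true → a ≡ true × b ≡ true
∧-true true b e = refl , e

∨-left : ∀ {a} b → a ≡ true → a ∨ b ≡ true
∨-left b refl = refl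

∨-right : ∀ a {b} → b ≡ true → a ∨ b ≡ true
∨-right true e = refl
∨-right false e = e

bool-iff : ∀ {a b} → (a ≡ true → b ≡ true) → (b ≡ true → a ≡ true) → a ≡ b
bool-iff {true} {b} f g = sym (f refl)
bool-iff {false} {true} f g = g refl
bool-iff {false} {false} f g = refl

≡ᵇ-refl : ∀ n → (n ≡ᵇ n) ≡ true
≡ᵇ-refl zero = refl
≡ᵇ-refl (suc n) = ≡ᵇ-refl n

≡ᵇ-false : ∀ m n → m ≢ n → (m ≡ᵇ n) ≡ false
≡ᵇ-false zero zero ne = ⊥-elim (ne refl)
≡ᵇ-false zero (suc n) ne = refl
≡ᵇ-false (suc m) zero ne = refl
≡ᵇ-false (suc m) (suc n) ne = ≡ᵇ-false m n (ne ∘ cong suc)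

≡ᵇ-true : ∀ m n → (m ≡ᵇ n) ≡ true → m ≡ n
≡ᵇ-true zero zero e = refl
≡ᵇ-true (suc m) (suc n) e = cong suc (≡ᵇ-true m n e)

eqV-refl : ∀ v → eqV v v ≡ true
eqV-refl (a , b) = cong₂ _∧_ (≡ᵇ-refl a) (≡ᵇ-refl b)

eqV-true : ∀ u v → eqV u v ≡ true → u ≡ v
eqV-true (a , b) (c , d) e with ∧-true (a ≡ᵇ c) (b ≡ᵇ d) e
... | e₁ , e₂ = cong₂ _,_ (≡ᵇ-true a c e₁) (≡ᵇ-true b d e₂)

module _ {A : Set} where

  any-cong : ∀ {p q : A → Bool} xs → (∀ x → p x ≡ q x) → any p xs ≡ any q xs
  any-cong [] e = refl
  any-cong (x ∷ xs) e = cong₂ _∨_ (e x) (any-cong xs e)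

  any-++ : ∀ (p : A → Bool) xs ys → any p (xs ++ ys) ≡ any p xs ∨ any p ys
  any-++ p [] ys = refl
  any-++ p (x ∷ xs) ys = trans (cong (p x ∨_) (any-++ p xs ys)) (sym (Boolₚ.∨-assoc (p x) _ _))

  any-↭ : ∀ (p : A → Bool) {xs ys} → xs ↭ ys → any p xs ≡ any p ys
  any-↭ p Perm.refl = refl
  any-↭ p (prep x q) = cong (p x ∨_) (any-↭ p q)
  any-↭ p (swap {xs} {ys} x y q) = trans (cong (λ t → p x ∨ (p y ∨ t)) (any-↭ p q))
    (trans (sym (Boolₚ.∨-assoc (p x) (p y) _)) (trans (cong (_∨ any p ys) (Boolₚ.∨-comm (p x) (p y))) (Boolₚ.∨-assoc (p y) (p x) _)))
  any-↭ p (Perm.trans q r) = trans (any-↭ p q) (any-↭ p r)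

  all-cong : ∀ {p q : A → Bool} xs → (∀ x → p x ≡ q x) → all p xs ≡ all q xs
  all-cong [] e = refl
  all-cong (x ∷ xs) e = cong₂ _∧_ (e x) (all-cong xs e)

  all-↭ : ∀ (p : A → Bool) {xs ys} → xs ↭ ys → all p xs ≡ all p ys
  all-↭ p Perm.refl = refl
  all-↭ p (prep x q) = cong (p x ∧_) (all-↭ p q)
  all-↭ p (swap {xs} {ys} x y q) = trans (cong (λ t → p x ∧ (p y ∧ t)) (all-↭ p q))
    (trans (sym (Boolₚ.∧-assoc (p x) (p y) _)) (trans (cong (_∧ all p ys) (Boolₚ.∧-comm (p x) (p y))) (Boolₚ.∧-assoc (p y) (p x) _)))
  all-↭ p (Perm.trans q r) = trans (all-↭ p q) (all-↭ p r)

  count-↭ : ∀ (p : A → Bool) {xs ys} → xs ↭ ys → count p xs ≡ count p ys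
  count-↭ p Perm.refl = refl
  count-↭ p (prep {xs} {ys} x q) = trans (count-∷ p x xs) (trans (cong (bit (p x) +_) (count-↭ p q)) (sym (count-∷ p x ys)))
  count-↭ p (swap {xs} {ys} x y q) = trans (count₂ x y xs)
    (trans (cong (λ t → bit (p x) + (bit (p y) + t)) (count-↭ p q))
    (trans (solve 3 (λ a b c → a :+ (b :+ c) := b :+ (a :+ c)) refl (bit (p x)) (bit (p y)) (count p ys)) (sym (count₂ y x ys))))
    where
      open +-*-Solver
      count₂ : ∀ x y zs → count p (x ∷ y ∷ zs) ≡ bit (p x) + (bit (p y) + count p zs)
      count₂ x y zs = trans (count-∷ p x (y ∷ zs)) (cong (bit (p x) +_) (count-∷ p y zs))
  count-↭ p (Perm.trans q r) = trans (count-↭ p q) (count-↭ p r)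

  any-true : ∀ (p : A → Bool) xs → any p xs ≡ true → Σ A λ x → x ∈ xs × p x ≡ true
  any-true p (x ∷ xs) e with ∨-true (p x) (any p xs) e
  ... | inj₁ e′ = x , here refl , e′
  ... | inj₂ e′ with any-true p xs e′
  ...   | y , y∈ , e″ = y , there y∈ , e″

  any-intro : ∀ (p : A → Bool) {x xs} → x ∈ xs → p x ≡ true → any p xs ≡ true
  any-intro p {x} {_ ∷ xs} (here refl) e = ∨-left (any p xs) e
  any-intro p {x} {y ∷ xs} (there x∈) e = ∨-right (p y) (any-intro p x∈ e)

  all-true : ∀ (p : A → Bool) xs → all p xs ≡ true → ∀ x → x ∈ xs → p x ≡ true
  all-true p (x ∷ xs) e .x (here refl) = proj₁ (∧-true (p x) _ e)
  all-true p (x ∷ xs) e y (there y∈) = all-true p xs (proj₂ (∧-true (p x) _ e)) y y∈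

  all-intro : ∀ (p : A → Bool) xs → (∀ x → x ∈ xs → p x ≡ true) → all p xs ≡ true
  all-intro p [] e = refl
  all-intro p (x ∷ xs) e = cong₂ _∧_ (e x (here refl)) (all-intro p xs λ y y∈ → e y (there y∈))

origins : List Vertex
origins = (0 , 0) ∷ []

reach : ℕ → List Bond → Vertex → Bool
reach zero S v = memV v origins
reach (suc K) S v = reach K S v ∨ any (λ b → reach K S (start b) ∧ eqV v (end b)) S

private
  any-end-filter : ∀ (q : Bond → Bool) v S → memV v (map end (filterᵇ q S)) ≡ any (λ b → q b ∧ eqV v (end b)) S
  any-end-filter q v [] = refl
  any-end-filter q v (b ∷ S) with q b
  ... | true = cong (eqV v (end b) ∨_) (any-end-filter q v S)
  ... | false = any-end-filter q v S

mem-iter : ∀ K S v → memV v (iter K (step S) origins) ≡ reach K S v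
mem-iter zero S v = refl
mem-iter (suc K) S v = trans (any-++ (eqV v) (iter K (step S) origins) _)
  (cong₂ _∨_ (mem-iter K S v) (trans (any-end-filter (λ b → memV (start b) (iter K (step S) origins)) v S)
    (any-cong S λ b → cong (_∧ eqV v (end b)) (mem-iter K S (start b)))))

reach-↭ : ∀ K {S S′} → S ↭ S′ → ∀ v → reach K S v ≡ reach K S′ v
reach-↭ zero p v = refl
reach-↭ (suc K) {S} {S′} p v = cong₂ _∨_ (reach-↭ K p v)
  (trans (any-cong S λ b → cong (_∧ eqV v (end b)) (reach-↭ K p (start b))) (any-↭ _ p))

directed-reach : ∀ S → isDirectedRooted S ≡ all (λ b → reach (suc (length S)) S (start b)) S
directed-reach S = all-cong S λ b → mem-iter (suc (length S)) S (start b)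

directed-↭ : ∀ {S S′} → S ↭ S′ → isDirectedRooted S ≡ isDirectedRooted S′
directed-↭ {S} {S′} p = trans (directed-reach S) (trans
  (trans (all-cong S λ b → trans (cong (λ l → reach (suc l) S (start b)) (Permₚ.↭-length p)) (reach-↭ (suc (length S′)) p (start b))) (all-↭ _ p))
  (sym (directed-reach S′)))

-- The animal condition checked bond by bond

infixl 5 _∪_
_∪_ : (Vertex → Bool) → Vertex → Vertex → Bool
(R ∪ w) v = R v ∨ eqV v w

ok : (Vertex → Bool) → List Bond → Bool
ok R [] = true
ok R (b ∷ S) = R (start b) ∧ ok (R ∪ end b) S

R₀ : Vertex → Bool
R₀ v = memV v origins

reach-mono : ∀ d {K} S v → reach K S v ≡ true → reach (d + K) S v ≡ true
reach-mono zero S v e = e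
reach-mono (suc d) S v e = ∨-left _ (reach-mono d S v e)

ok⇒reach : ∀ S K rest R → (∀ v → R v ≡ true → reach K S v ≡ true) → (∀ b → b ∈ rest → b ∈ S) → ok R rest ≡ true →
  ∀ b → b ∈ rest → reach (length rest + K) S (start b) ≡ true
ok⇒reach S K (b₀ ∷ rest) R inv sub e b b∈ = go b∈
  where
    e₁ = proj₁ (∧-true (R (start b₀)) _ e)
    e₂ = proj₂ (∧-true (R (start b₀)) _ e)
    inv′ : ∀ v → (R ∪ end b₀) v ≡ true → reach (suc K) S v ≡ true
    inv′ v t with ∨-true (R v) _ t
    ... | inj₁ t′ = ∨-left _ (inv v t′)
    ... | inj₂ t′ = ∨-right (reach K S v) (any-intro _ (sub b₀ (here refl)) (cong₂ _∧_ (inv (start b₀) e₁) t′))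
    go : b ∈ b₀ ∷ rest → reach (length (b₀ ∷ rest) + K) S (start b) ≡ true
    go (here refl) = reach-mono (length (b₀ ∷ rest)) S (start b₀) (inv (start b₀) e₁)
    go (there b∈′) = subst (λ n → reach n S (start b) ≡ true) (ℕₚ.+-suc (length rest) K)
      (ok⇒reach S (suc K) rest (R ∪ end b₀) inv′ (λ b b∈ → sub b (there b∈)) e₂ b b∈′)

Sorted : List Bond → Set
Sorted = AllPairs (λ b b′ → end b′ ≢ start b)

end≢start : ∀ b → end b ≢ start b
end≢start (x , y , hor) e = ℕₚ.1+n≢n (cong proj₁ e)
end≢start (x , y , ver) e = ℕₚ.1+n≢n (cong proj₂ e)

-- In a sorted list the bond that reaches the start of b comes before b.
reach⇒ok : ∀ (Q : Vertex → Bool) rest R → Sorted rest → (∀ v → Q v ≡ true → All (λ b → end b ≢ v) rest → R v ≡ true) →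
  (∀ b → b ∈ rest → Q (start b) ≡ true) → ok R rest ≡ true
reach⇒ok Q [] R _ inv starts = refl
reach⇒ok Q (b₀ ∷ rest) R (p ∷ sorted) inv starts =
  cong₂ _∧_ (inv (start b₀) (starts b₀ (here refl)) (end≢start b₀ ∷ p))
    (reach⇒ok Q rest (R ∪ end b₀) sorted inv′ (λ b b∈ → starts b (there b∈)))
  where
    inv′ : ∀ v → Q v ≡ true → All (λ b → end b ≢ v) rest → (R ∪ end b₀) v ≡ true
    inv′ v qv ne with eqV v (end b₀) in eq
    ... | true = ∨-right (R v) refl
    ... | false = ∨-left false (inv v qv ((λ e → false≢true (trans (sym eq) (subst (λ w → eqV v w ≡ true) (sym e) (eqV-refl v)))) ∷ ne))
      where
        false≢true : false ≢ true
        false≢true ()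

reach-last : ∀ K S v → reach K S v ≡ true → All (λ b → end b ≢ v) S → R₀ v ≡ true
reach-last zero S v e ne = e
reach-last (suc K) S v e ne with ∨-true (reach K S v) _ e
... | inj₁ e′ = reach-last K S v e′ ne
... | inj₂ e′ with any-true _ S e′
...   | b , b∈ , e″ = ⊥-elim (All.lookup ne b∈ (sym (eqV-true v (end b) (proj₂ (∧-true (reach K S (start b)) _ e″)))))

directed≡ok : ∀ S → Sorted S → isDirectedRooted S ≡ ok R₀ S
directed≡ok S sorted = trans (directed-reach S) (bool-iff
  (λ e → reach⇒ok (reach (suc (length S)) S) S R₀ sorted (reach-last (suc (length S)) S) (all-true _ S e))
  (λ e → all-intro _ S λ b b∈ → subst (λ n → reach n S (start b) ≡ true) (ℕₚ.+-comm (length S) 1)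
    (ok⇒reach S 1 S R₀ (λ v e → ∨-left _ e) (λ b b∈ → b∈) e b b∈)))

-- Reordering the box column by column

rng : ℕ → ℕ → List ℕ
rng a zero = []
rng a (suc c) = a ∷ rng (suc a) c

upTo≡rng : ∀ n → upTo n ≡ rng 0 n
upTo≡rng n = go (λ i → i) 0 n (λ i → refl)
  where
    go : ∀ f a n → (∀ i → f i ≡ a + i) → applyUpTo f n ≡ rng a n
    go f a zero e = refl
    go f a (suc n) e = cong₂ _∷_ (trans (e 0) (ℕₚ.+-identityʳ a)) (go (f ∘ suc) (suc a) n λ i → trans (e (suc i)) (ℕₚ.+-suc a i))

horBond verBond : ℕ → ℕ → Bond
horBond x y = (x , y , hor)
verBond x y = (x , y , ver)

horIf : Bool → ℕ → ℕ → List Bond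
horIf true x y = horBond x y ∷ []
horIf false x y = []

-- The bonds leaving the vertices (x , y) , … , (x , y + r), without the vertical one of the
-- last vertex; the flag says whether horizontal bonds are present.
column : Bool → ℕ → ℕ → ℕ → List Bond
column b x y zero = horIf b x y
column b x y (suc r) = verBond x y ∷ (horIf b x y ++ column b x (suc y) r)

columns : ℕ → ℕ → ℕ → List Bond
columns n x zero = column false x 0 n ++ []
columns n x (suc t) = column true x 0 n ++ columns n (suc x) t

column-↭ : ∀ x y r → column true x y r ↭ map (horBond x) (rng y (suc r)) ++ map (verBond x) (rng y r)
column-↭ x y zero = ↭-refl
column-↭ x y (suc r) = ↭-trans (prep _ (prep _ (column-↭ x (suc y) r)))
  (↭-sym (Permₚ.shift (verBond x y) (map (horBond x) (rng y (suc (suc r)))) (map (verBond x) (rng (suc y) r))))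

column-ver : ∀ x y r → column false x y r ≡ map (verBond x) (rng y r)
column-ver x y zero = refl
column-ver x y (suc r) = cong (verBond x y ∷_) (column-ver x (suc y) r)

columns-↭ : ∀ n x t → columns n x t ↭
  concatMap (λ x → map (horBond x) (rng 0 (suc n))) (rng x t) ++ concatMap (λ x → map (verBond x) (rng 0 n)) (rng x (suc t))
columns-↭ n x zero = ↭-reflexive (cong (_++ []) (column-ver x 0 n))
columns-↭ n x (suc t) = ↭-trans (Permₚ.++⁺ (column-↭ x 0 n) (columns-↭ n (suc x) t))
  (↭-trans (↭-reflexive (Listₚ.++-assoc Hx Vx (Hs ++ Vs))) (↭-trans (Permₚ.++⁺ˡ Hx (Permₚ.shifts Vx Hs)) (↭-reflexive (sym (Listₚ.++-assoc Hx Hs (Vx ++ Vs))))))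
  where
    Hx = map (horBond x) (rng 0 (suc n))
    Vx = map (verBond x) (rng 0 n)
    Hs = concatMap (λ x → map (horBond x) (rng 0 (suc n))) (rng (suc x) t)
    Vs = concatMap (λ x → map (verBond x) (rng 0 n)) (rng (suc x) (suc t))

box-↭ : ∀ m n → boxBonds m n ↭ columns n 0 m
box-↭ m n = ↭-trans (↭-reflexive (cong₂ _++_
    (trans (cong (concatMap (λ x → map (horBond x) (upTo (suc n)))) (upTo≡rng m)) (cong (λ l → concatMap (λ x → map (horBond x) l) (rng 0 m)) (upTo≡rng (suc n))))
    (trans (cong (concatMap (λ x → map (verBond x) (upTo n))) (upTo≡rng (suc m))) (cong (λ l → concatMap (λ x → map (verBond x) l) (rng 0 (suc m))) (upTo≡rng n)))))
  (↭-sym (columns-↭ n 0 m))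

_⊑_ : Bond → Bond → Set
(x , y , _) ⊑ (x′ , y′ , _) = x < x′ ⊎ (x ≡ x′ × y ≤ y′)

⊑⇒≢ : ∀ b b′ → b ⊑ b′ → end b′ ≢ start b
⊑⇒≢ (x , y , _) (x′ , y′ , hor) (inj₁ lt) e = ℕₚ.<-irrefl (sym (cong proj₁ e)) (ℕₚ.<-trans lt (ℕₚ.n<1+n x′))
⊑⇒≢ (x , y , _) (x′ , y′ , hor) (inj₂ (refl , _)) e = ℕₚ.1+n≢n (cong proj₁ e)
⊑⇒≢ (x , y , _) (x′ , y′ , ver) (inj₁ lt) e = ℕₚ.<-irrefl (sym (cong proj₁ e)) lt
⊑⇒≢ (x , y , _) (x′ , y′ , ver) (inj₂ (_ , le)) e = ℕₚ.<-irrefl (sym (cong proj₂ e)) (s≤s le)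

InColumn : ℕ → ℕ → ℕ → Bond → Set
InColumn n x y (x′ , y′ , d) = x ≡ x′ × y ≤ y′ × (d ≡ ver → y′ < n)

horIf-All : ∀ n b x y → All (InColumn n x y) (horIf b x y)
horIf-All n true x y = (refl , ℕₚ.≤-refl , λ ()) ∷ []
horIf-All n false x y = []

column-All : ∀ n b x y r → y + r ≤ n → All (InColumn n x y) (column b x y r)
column-All n b x y zero le = horIf-All n b x y
column-All n b x y (suc r) le = (refl , ℕₚ.≤-refl , λ _ → ℕₚ.≤-trans (s≤s (ℕₚ.m≤m+n y r)) le′)
  ∷ Allₚ.++⁺ (horIf-All n b x y) (All.map (λ { {x′ , y′ , d} (a , b , c) → a , ℕₚ.<⇒≤ b , c }) (column-All n b x (suc y) r le′))
  where
    le′ : suc y + r ≤ n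
    le′ = subst (_≤ n) (ℕₚ.+-suc y r) le

column-sorted : ∀ b x y r → AllPairs _⊑_ (column b x y r)
column-sorted b x y zero = horIf-sorted b
  where
    horIf-sorted : ∀ b → AllPairs _⊑_ (horIf b x y)
    horIf-sorted true = [] ∷ []
    horIf-sorted false = []
column-sorted b x y (suc r) = Allₚ.++⁺ (All.map (λ {b′} → up {b′} {y + r}) (horIf-All (y + r) b x y)) (All.map (λ {b′} → up {b′} {suc (y + r)} ∘ weaken {b′} {suc (y + r)}) tailAll)
    ∷ AllPairsₚ.++⁺ (horIf-sorted b) (column-sorted b x (suc y) r) (horIf-below b)
  where
    tailAll = column-All (suc (y + r)) b x (suc y) r ℕₚ.≤-refl
    up : ∀ {b′ n} → InColumn n x y b′ → verBond x y ⊑ b′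
    up (refl , le , _) = inj₂ (refl , le)
    weaken : ∀ {b′ n} → InColumn n x (suc y) b′ → InColumn n x y b′
    weaken (e , le , v) = e , ℕₚ.<⇒≤ le , v
    horIf-sorted : ∀ b → AllPairs _⊑_ (horIf b x y)
    horIf-sorted true = [] ∷ []
    horIf-sorted false = []
    horIf-below : ∀ b′ → All (λ h → All (h ⊑_) (column b x (suc y) r)) (horIf b′ x y)
    horIf-below true = All.map (λ {b′} → up {b′} {suc (y + r)} ∘ weaken {b′} {suc (y + r)}) tailAll ∷ []
    horIf-below false = []

columns-All : ∀ n x t → All (λ b → x ≤ proj₁ b × (proj₂ (proj₂ b) ≡ ver → proj₁ (proj₂ b) < n)) (columns n x t)
columns-All n x zero = Allₚ.++⁺ (All.map (λ { (refl , _ , v) → ℕₚ.≤-refl , v }) (column-All n false x 0 n ℕₚ.≤-refl)) []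
columns-All n x (suc t) = Allₚ.++⁺ (All.map (λ { (refl , _ , v) → ℕₚ.≤-refl , v }) (column-All n true x 0 n ℕₚ.≤-refl))
  (All.map (λ (le , v) → ℕₚ.<⇒≤ le , v) (columns-All n (suc x) t))

columns-⊑ : ∀ n x t → AllPairs _⊑_ (columns n x t)
columns-⊑ n x zero = AllPairsₚ.++⁺ (column-sorted false x 0 n) [] (All.universal (λ _ → []) _)
columns-⊑ n x (suc t) = AllPairsₚ.++⁺ (column-sorted true x 0 n) (columns-⊑ n (suc x) t)
  (All.map (λ { (refl , _) → All.map (λ (le , _) → inj₁ le) (columns-All n (suc x) t) }) (column-All n true x 0 n ℕₚ.≤-refl))

AllPairs-⊆ : ∀ {A : Set} {R R′ : A → A → Set} → (∀ a b → R a b → R′ a b) → ∀ {xs ys} → xs ⊆ ys → AllPairs R ys → AllPairs R′ xs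
AllPairs-⊆ f [] [] = []
AllPairs-⊆ f (y ∷ʳ s) (_ ∷ ps) = AllPairs-⊆ f s ps
AllPairs-⊆ f (refl ∷ s) (p ∷ ps) = All.map (f _ _) (All-resp-⊆ s p) ∷ AllPairs-⊆ f s ps

-- The distributions of v vertical bonds over the rows 0 , … , n, none of them above row n

increment : List ℕ → List ℕ
increment [] = []
increment (a ∷ μ) = suc a ∷ μ

comps : ℕ → ℕ → List (List ℕ)
comps zero zero = (0 ∷ []) ∷ []
comps zero (suc v) = []
comps (suc n) zero = map (0 ∷_) (comps n zero)
comps (suc n) (suc v) = map (0 ∷_) (comps n (suc v)) ++ map increment (comps (suc n) v)

data Shape : ℕ → List ℕ → Set where
  top  : Shape zero (0 ∷ [])
  cons : ∀ {n a μ} → Shape n μ → Shape (suc n) (a ∷ μ)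

shape-increment : ∀ {n μ} → Shape (suc n) μ → Shape (suc n) (increment μ)
shape-increment (cons s) = cons s

sum-increment : ∀ {n μ} → Shape n μ → sum (increment μ) ≡ suc (sum μ)
sum-increment top = refl
sum-increment (cons s) = refl

comps-All : ∀ n v → All (λ μ → Shape n μ × sum μ ≡ v) (comps n v)
comps-All zero zero = (top , refl) ∷ []
comps-All zero (suc v) = []
comps-All (suc n) zero = Allₚ.map⁺ (All.map (λ (s , e) → cons s , e) (comps-All n zero))
comps-All (suc n) (suc v) = Allₚ.++⁺ (Allₚ.map⁺ (All.map (λ (s , e) → cons s , e) (comps-All n (suc v))))
  (Allₚ.map⁺ (All.map (λ (s , e) → shape-increment s , trans (sum-increment s) (cong suc e)) (comps-All (suc n) v)))

comps-complete : ∀ {n μ} → Shape n μ → μ ∈ comps n (sum μ)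
comps-complete top = here refl
comps-complete (cons {n} {zero} {μ} s) = go (sum μ) (comps-complete s)
  where
    go : ∀ v → μ ∈ comps n v → 0 ∷ μ ∈ comps (suc n) v
    go zero p = ∈ₚ.∈-map⁺ (0 ∷_) p
    go (suc v) p = ∈ₚ.∈-++⁺ˡ (∈ₚ.∈-map⁺ (0 ∷_) p)
comps-complete (cons {n} {suc a} {μ} s) =
  ∈ₚ.∈-++⁺ʳ (map (0 ∷_) (comps n (suc (a + sum μ)))) (∈ₚ.∈-map⁺ increment (comps-complete (cons {n} {a} {μ} s)))

decrement : ℕ → List ℕ → Maybe (List ℕ)
decrement y [] = nothing
decrement zero (zero ∷ μ) = nothing
decrement zero (suc a ∷ μ) = just (a ∷ μ)
decrement (suc y) (a ∷ μ) = Maybe.map (a ∷_) (decrement y μ)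

Σᴺ : {A : Set} → List A → (A → ℕ) → ℕ
Σᴺ xs f = sum (map f xs)

module _ {A : Set} where

  Σᴺ-++ : ∀ xs ys (f : A → ℕ) → Σᴺ (xs ++ ys) f ≡ Σᴺ xs f + Σᴺ ys f
  Σᴺ-++ [] ys f = refl
  Σᴺ-++ (x ∷ xs) ys f = trans (cong (f x +_) (Σᴺ-++ xs ys f)) (sym (ℕₚ.+-assoc (f x) _ _))

  Σᴺ-map : ∀ {B : Set} (h : B → A) xs (f : A → ℕ) → Σᴺ (map h xs) f ≡ Σᴺ xs (f ∘ h)
  Σᴺ-map h xs f = cong sum (sym (Listₚ.map-∘ xs))

  Σᴺ-cong-All : ∀ {xs} {f g : A → ℕ} → All (λ a → f a ≡ g a) xs → Σᴺ xs f ≡ Σᴺ xs g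
  Σᴺ-cong-All [] = refl
  Σᴺ-cong-All (e ∷ es) = cong₂ _+_ e (Σᴺ-cong-All es)

  Σᴺ-cong : ∀ xs {f g : A → ℕ} → (∀ a → f a ≡ g a) → Σᴺ xs f ≡ Σᴺ xs g
  Σᴺ-cong xs e = Σᴺ-cong-All (All.universal e xs)

  Σᴺ-zero : ∀ xs {f : A → ℕ} → (∀ a → f a ≡ 0) → Σᴺ xs f ≡ 0
  Σᴺ-zero [] e = refl
  Σᴺ-zero (x ∷ xs) e = cong₂ _+_ (e x) (Σᴺ-zero xs e)

  Σᴺ-+ : ∀ xs (f g : A → ℕ) → Σᴺ xs (λ a → f a + g a) ≡ Σᴺ xs f + Σᴺ xs g
  Σᴺ-+ [] f g = refl
  Σᴺ-+ (x ∷ xs) f g = trans (cong (f x + g x +_) (Σᴺ-+ xs f g))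
    (solve 4 (λ a b c d → (a :+ b) :+ (c :+ d) := (a :+ c) :+ (b :+ d)) refl (f x) (g x) (Σᴺ xs f) (Σᴺ xs g))
    where open +-*-Solver

Σ⊆-Σᴺ : ∀ {A B : Set} (ms : List B) (g : B → List A → ℕ) bs → Σ⊆ (λ S → Σᴺ ms λ μ → g μ S) bs ≡ Σᴺ ms λ μ → Σ⊆ (g μ) bs
Σ⊆-Σᴺ ms g [] = refl
Σ⊆-Σᴺ ms g (b ∷ bs) = trans (cong₂ _+_ (Σ⊆-Σᴺ ms g bs) (Σ⊆-Σᴺ ms (λ μ → g μ ∘ (b ∷_)) bs)) (sym (Σᴺ-+ ms _ _))

val : (List ℕ → ℕ) → Maybe (List ℕ) → ℕ
val g = maybe′ g 0

val-map : ∀ g h m → val g (Maybe.map h m) ≡ val (g ∘ h) m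
val-map g h (just _) = refl
val-map g h nothing = refl

decrement-zero : ∀ n y g → Σᴺ (comps n 0) (λ μ → val g (decrement y μ)) ≡ 0
decrement-zero zero zero g = refl
decrement-zero zero (suc y) g = refl
decrement-zero (suc n) zero g = trans (Σᴺ-map (0 ∷_) (comps n 0) _) (Σᴺ-zero (comps n 0) λ _ → refl)
decrement-zero (suc n) (suc y) g = trans (Σᴺ-map (0 ∷_) (comps n 0) _)
  (trans (Σᴺ-cong (comps n 0) λ μ → val-map g (0 ∷_) (decrement y μ)) (decrement-zero n y (g ∘ (0 ∷_))))

decrement-comps : ∀ n v y g → y < n → Σᴺ (comps n (suc v)) (λ μ → val g (decrement y μ)) ≡ Σᴺ (comps n v) g
decrement-comps (suc n) v zero g _ = trans (Σᴺ-++ (map (0 ∷_) (comps n (suc v))) _ _) (cong₂ _+_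
  (trans (Σᴺ-map (0 ∷_) (comps n (suc v)) _) (Σᴺ-zero (comps n (suc v)) λ _ → refl))
  (trans (Σᴺ-map increment (comps (suc n) v) _) (Σᴺ-cong-All (All.map (λ { (cons s , _) → refl }) (comps-All (suc n) v)))))
decrement-comps (suc n) v (suc y) g (s≤s y<n) = trans (Σᴺ-++ (map (0 ∷_) (comps n (suc v))) _ _)
  (trans (cong₂ _+_
    (trans (Σᴺ-map (0 ∷_) (comps n (suc v)) _) (trans (Σᴺ-cong (comps n (suc v)) λ μ → val-map g (0 ∷_) (decrement y μ)) (decrement-comps n v y (g ∘ (0 ∷_)) y<n)))
    (trans (Σᴺ-map increment (comps (suc n) v) _) (Σᴺ-cong-All (All.map (λ { (cons {a = a} {μ} s , _) → commute a μ }) (comps-All (suc n) v)))))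
    (collect v))
  where
    commute : ∀ a μ → val g (decrement (suc y) (suc a ∷ μ)) ≡ val (g ∘ increment) (decrement (suc y) (a ∷ μ))
    commute a μ = trans (val-map g (suc a ∷_) (decrement y μ)) (sym (val-map (g ∘ increment) (a ∷_) (decrement y μ)))
    collect : ∀ v → Σᴺ (comps n v) (g ∘ (0 ∷_)) + Σᴺ (comps (suc n) v) (λ μ → val (g ∘ increment) (decrement (suc y) μ)) ≡ Σᴺ (comps (suc n) v) g
    collect zero = trans (cong (Σᴺ (comps n 0) (g ∘ (0 ∷_)) +_) (decrement-zero (suc n) (suc y) (g ∘ increment))) (trans (ℕₚ.+-identityʳ _) (sym (Σᴺ-map (0 ∷_) (comps n 0) g)))
    collect (suc v) = trans (cong (Σᴺ (comps n (suc v)) (g ∘ (0 ∷_)) +_) (decrement-comps (suc n) v (suc y) (g ∘ increment) (s≤s y<n)))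
      (sym (trans (Σᴺ-++ (map (0 ∷_) (comps n (suc v))) _ g) (cong₂ _+_ (Σᴺ-map (0 ∷_) (comps n (suc v)) g) (Σᴺ-map increment (comps (suc n) v) g))))

zeros : List ℕ → Bool
zeros [] = true
zeros (zero ∷ μ) = zeros μ
zeros (suc _ ∷ μ) = false

zeros-comps : ∀ n v → Σᴺ (comps n v) (bit ∘ zeros) ≡ bit (0 ≡ᵇ v)
zeros-comps zero zero = refl
zeros-comps zero (suc v) = refl
zeros-comps (suc n) zero = trans (Σᴺ-map (0 ∷_) (comps n 0) _) (zeros-comps n 0)
zeros-comps (suc n) (suc v) = trans (Σᴺ-++ (map (0 ∷_) (comps n (suc v))) _ _) (cong₂ _+_
  (trans (Σᴺ-map (0 ∷_) (comps n (suc v)) _) (zeros-comps n (suc v)))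
  (trans (Σᴺ-map increment (comps (suc n) v) _) (trans (Σᴺ-cong-All {g = λ _ → 0} (All.map (λ { (cons s , _) → refl }) (comps-All (suc n) v))) (Σᴺ-zero (comps (suc n) v) λ _ → refl))))

-- `good R h μ S` is 1 if S extends the reached set R with h horizontal bonds and with μ_y
-- vertical bonds on top of each row y, and 0 otherwise.
good : (Vertex → Bool) → ℕ → List ℕ → List Bond → ℕ
goodHor : (Vertex → Bool) → ℕ → List ℕ → List Bond → ℕ
goodVer : (Vertex → Bool) → ℕ → Maybe (List ℕ) → List Bond → ℕ
good R h μ [] = bit (0 ≡ᵇ h) * bit (zeros μ)
good R h μ ((x , y , hor) ∷ S) = if R (x , y) then goodHor (R ∪ (suc x , y)) h μ S else 0
good R h μ ((x , y , ver) ∷ S) = if R (x , y) then goodVer (R ∪ (x , suc y)) h (decrement y μ) S else 0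
goodHor R zero μ S = 0
goodHor R (suc h) μ S = good R h μ S
goodVer R h nothing S = 0
goodVer R h (just μ) S = good R h μ S

animal : (Vertex → Bool) → ℕ → ℕ → List Bond → Bool
animal R h v S = ok R S ∧ (count isHor S ≡ᵇ h) ∧ (count isVer S ≡ᵇ v)

Below : ℕ → Bond → Set
Below n (_ , y , d) = d ≡ ver → y < n

animal-good : ∀ n S → All (Below n) S → ∀ R h v → bit (animal R h v S) ≡ Σᴺ (comps n v) (λ μ → good R h μ S)
animal-good n [] [] R h v = trans (split (0 ≡ᵇ h) (0 ≡ᵇ v)) (trans (cong (bit (0 ≡ᵇ h) *_) (sym (zeros-comps n v))) (scale (bit (0 ≡ᵇ h)) (comps n v)))
  where
    split : ∀ a b → bit (true ∧ a ∧ b) ≡ bit a * bit b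
    split true true = refl
    split true false = refl
    split false b = refl
    scale : ∀ c xs → c * Σᴺ xs (bit ∘ zeros) ≡ Σᴺ xs (λ μ → c * bit (zeros μ))
    scale c [] = ℕₚ.*-zeroʳ c
    scale c (x ∷ xs) = trans (ℕₚ.*-distribˡ-+ c (bit (zeros x)) _) (cong (c * bit (zeros x) +_) (scale c xs))
animal-good n ((x , y , hor) ∷ S) (_ ∷ bel) R h v with R (x , y)
... | false = sym (Σᴺ-zero (comps n v) λ _ → refl)
... | true = go h
  where
    go : ∀ h → bit (ok (R ∪ (suc x , y)) S ∧ (suc (count isHor S) ≡ᵇ h) ∧ (count isVer S ≡ᵇ v)) ≡ Σᴺ (comps n v) (λ μ → goodHor (R ∪ (suc x , y)) h μ S)
    go zero = trans (cong bit (Boolₚ.∧-zeroʳ (ok (R ∪ (suc x , y)) S))) (sym (Σᴺ-zero (comps n v) λ _ → refl))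
    go (suc h) = animal-good n S bel (R ∪ (suc x , y)) h v
animal-good n ((x , y , ver) ∷ S) (b ∷ bel) R h v with R (x , y)
... | false = sym (Σᴺ-zero (comps n v) λ _ → refl)
... | true = go v
  where
    R′ = R ∪ (x , suc y)
    asVal : ∀ m → goodVer R′ h m S ≡ val (λ μ → good R′ h μ S) m
    asVal (just _) = refl
    asVal nothing = refl
    go : ∀ v → bit (ok R′ S ∧ (count isHor S ≡ᵇ h) ∧ (suc (count isVer S) ≡ᵇ v)) ≡ Σᴺ (comps n v) (λ μ → goodVer R′ h (decrement y μ) S)
    go zero = trans (cong bit (trans (cong (ok R′ S ∧_) (Boolₚ.∧-zeroʳ (count isHor S ≡ᵇ h))) (Boolₚ.∧-zeroʳ (ok R′ S))))
      (sym (trans (Σᴺ-cong (comps n 0) λ μ → asVal (decrement y μ)) (decrement-zero n y _)))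
    go (suc v) = trans (animal-good n S bel R′ h v) (sym (trans (Σᴺ-cong (comps n (suc v)) λ μ → asVal (decrement y μ)) (decrement-comps n v y _ (b refl))))

numAnimals-good : ∀ n m → numAnimals n m ≡ Σᴺ (comps n n) λ μ → Σ⊆ (good R₀ m μ) (columns n 0 m)
numAnimals-good n m = trans (count-subsets P (boxBonds m n)) (trans (Σ⊆-↭ (box-↭ m n) (cong bit ∘ P-↭))
    (trans (Σ⊆-cong (columns n 0 m) pointwise) (Σ⊆-Σᴺ (comps n n) (λ μ → good R₀ m μ) (columns n 0 m))))
  where
    P : List Bond → Bool
    P S = isDirectedRooted S ∧ (count isHor S ≡ᵇ m) ∧ (count isVer S ≡ᵇ n)
    P-↭ : ∀ {S S′} → S ↭ S′ → P S ≡ P S′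
    P-↭ p = cong₂ _∧_ (directed-↭ p) (cong₂ _∧_ (cong (_≡ᵇ m) (count-↭ isHor p)) (cong (_≡ᵇ n) (count-↭ isVer p)))
    pointwise : ∀ S → S ⊆ columns n 0 m → bit (P S) ≡ Σᴺ (comps n n) (λ μ → good R₀ m μ S)
    pointwise S s = trans (cong (λ t → bit (t ∧ (count isHor S ≡ᵇ m) ∧ (count isVer S ≡ᵇ n))) (directed≡ok S (AllPairs-⊆ ⊑⇒≢ s (columns-⊑ n 0 m))))
      (animal-good n S (All-resp-⊆ s (All.map proj₂ (columns-All n 0 m))) R₀ m n)

-- Summing column by column

μs : Config → List ℕ
μs = map proj₂

μs-snoc : ∀ π r τ → μs (π ++ [ r ]) ++ τ ≡ μs π ++ proj₂ r ∷ τ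
μs-snoc [] r τ = refl
μs-snoc (_ ∷ π) r τ = cong (_ ∷_) (μs-snoc π r τ)

decrement-at : ∀ π ν τ → decrement (length π) (μs π ++ suc ν ∷ τ) ≡ just (μs π ++ ν ∷ τ)
decrement-at [] ν τ = refl
decrement-at ((_ , a) ∷ π) ν τ = cong (Maybe.map (a ∷_)) (decrement-at π ν τ)

decrement-empty : ∀ π τ → decrement (length π) (μs π ++ 0 ∷ τ) ≡ nothing
decrement-empty [] τ = refl
decrement-empty ((_ , a) ∷ π) τ = cong (Maybe.map (a ∷_)) (decrement-empty π τ)

∪-other : ∀ R v w → v ≢ w → (R ∪ w) v ≡ R v
∪-other R v w ne with eqV v w in eq
... | true = ⊥-elim (ne (eqV-true v w eq))
... | false = Boolₚ.∨-identityʳ (R v)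

∪-same : ∀ R w → (R ∪ w) w ≡ true
∪-same R w = ∨-right (R w) (eqV-refl w)

Match : (Vertex → Bool) → ℕ → ℕ → Config → Set
Match R x y [] = ⊤
Match R x y ((s , _) ∷ σ) = R (x , y) ≡ s × Match R x (suc y) σ

match-∪ : ∀ R x y σ w → (∀ i → i < length σ → (x , y + i) ≢ w) → Match R x y σ → Match (R ∪ w) x y σ
match-∪ R x y [] w ne m = _
match-∪ R x y ((s , _) ∷ σ) w ne (e , m) =
  trans (∪-other R (x , y) w λ eq → ne 0 (s≤s z≤n) (trans (cong (x ,_) (ℕₚ.+-identityʳ y)) eq)) e ,
  match-∪ R x (suc y) σ w (λ i lt eq → ne (suc i) (s≤s lt) (trans (cong (x ,_) (ℕₚ.+-suc y i)) eq)) m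

match-snoc : ∀ R x y π s {μ} → Match R x y π → R (x , y + length π) ≡ s → Match R x y (π ++ [ (s , μ) ])
match-snoc R x y [] s m e = trans (cong (λ t → R (x , t)) (sym (ℕₚ.+-identityʳ y))) e , _
match-snoc R x y (_ ∷ π) s (e′ , m) e = e′ , match-snoc R x (suc y) π s m (trans (cong (λ t → R (x , t)) (sym (ℕₚ.+-suc y (length π)))) e)

Fresh : (Vertex → Bool) → ℕ → Set
Fresh R x = ∀ x′ y → x < x′ → R (x′ , y) ≡ false

Shape-snoc : ∀ {y r} π s {μ τ} → length π ≡ y → Shape r (μ ∷ τ) → Shape (y + r) (μs (π ++ [ (s , μ) ]) ++ τ)
Shape-snoc {y} {r} π s {μ} {τ} len sh = subst (Shape (y + r)) (sym (μs-snoc π (s , μ) τ)) (subst (λ y → Shape (y + r) (μs π ++ μ ∷ τ)) len (go π))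
  where
    go : ∀ π → Shape (length π + r) (μs π ++ μ ∷ τ)
    go [] = sh
    go (_ ∷ π) = cons (go π)

Σ⊆-if : ∀ {A : Set} c (f : List A → ℕ) bs → c ≡ true → Σ⊆ (λ S → if c then f S else 0) bs ≡ Σ⊆ f bs
Σ⊆-if c f bs refl = refl

Σ⊆-ifn : ∀ {A : Set} c (f : List A → ℕ) bs → c ≡ false → Σ⊆ (λ S → if c then f S else 0) bs ≡ 0
Σ⊆-ifn c f bs refl = Σ⊆-zero bs λ _ → refl

module Column (n : ℕ) (b : Bool) (x : ℕ) (bs : List Bond) (f : Config → Series)
  (f-dead : b ≡ false → ∀ π → alive π ≢ 0 → f π ≈ zeroS)
  (continue : ∀ R h π → Shape n (μs π) → (b ≡ false → alive π ≡ 0) → Match R (suc x) 0 π → Fresh R (suc x) → ℕtoℚ (Σ⊆ (good R h (μs π)) bs) ≡ f π h)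
  where

  record State (R : Vertex → Bool) (y : ℕ) (π : Config) : Set where
    field
      len   : length π ≡ y
      match : Match R (suc x) 0 π
      above : ∀ y′ → y ≤ y′ → R (suc x , y′) ≡ false
      fresh : Fresh R (suc x)
      dead  : b ≡ false → alive π ≡ 0
  open State

  Ready : (Vertex → Bool) → ℕ → Bool → Config → Set
  Ready R y c [] = ⊤
  Ready R y c ((s , _) ∷ σ) = R (x , y) ≡ s ∨ c × Match R x (suc y) σ

  length-snoc : ∀ π (r : Row) {y} → length π ≡ y → length (π ++ [ r ]) ≡ suc y
  length-snoc π r e = trans (Listₚ.length-++ π) (trans (ℕₚ.+-comm (length π) 1) (cong suc e))

  state-drop : ∀ {R y π} μ → State R y π → State R (suc y) (π ++ [ (false , μ) ])
  state-drop {R} {y} {π} μ st = record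
    { len = length-snoc π _ (len st)
    ; match = match-snoc R (suc x) 0 π false (match st) (above st (length π) (ℕₚ.≤-reflexive (sym (len st))))
    ; above = λ y′ le → above st y′ (ℕₚ.<⇒≤ le)
    ; fresh = fresh st
    ; dead = λ e → trans (alive-++ π _) (cong (_+ 0) (dead st e)) }

  state-keep : ∀ {R y π} μ → b ≡ true → State R y π → State (R ∪ (suc x , y)) (suc y) (π ++ [ (true , μ) ])
  state-keep {R} {y} {π} μ b≡ st = record
    { len = length-snoc π _ (len st)
    ; match = match-snoc (R ∪ (suc x , y)) (suc x) 0 π true
        (match-∪ R (suc x) 0 π (suc x , y) (λ i lt eq → ℕₚ.<-irrefl (trans (cong proj₂ eq) (sym (len st))) lt) (match st))
        (subst (λ y′ → (R ∪ (suc x , y)) (suc x , y′) ≡ true) (sym (len st)) (∪-same R (suc x , y)))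
    ; above = λ y′ le → trans (∪-other R (suc x , y′) (suc x , y) λ eq → ℕₚ.<-irrefl (sym (cong proj₂ eq)) le) (above st y′ (ℕₚ.<⇒≤ le))
    ; fresh = λ x′ y′ lt → trans (∪-other R (x′ , y′) (suc x , y) λ eq → ℕₚ.<-irrefl (sym (cong proj₁ eq)) lt) (fresh st x′ y′ lt)
    ; dead = λ e → ⊥-elim (true≢false (trans (sym b≡) e)) }
    where
      true≢false : true ≢ false
      true≢false ()

  state-emit : ∀ {R y π} → State R y π → State (R ∪ (x , suc y)) y π
  state-emit {R} {y} {π} st = record
    { len = len st
    ; match = match-∪ R (suc x) 0 π (x , suc y) (λ i _ eq → ℕₚ.1+n≢n (cong proj₁ eq)) (match st)
    ; above = λ y′ le → trans (∪-other R _ _ λ eq → ℕₚ.1+n≢n (cong proj₁ eq)) (above st y′ le)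
    ; fresh = λ x′ y′ lt → trans (∪-other R _ _ λ eq → ℕₚ.<-irrefl (sym (cong proj₁ eq)) (ℕₚ.<-trans (ℕₚ.n<1+n x) lt)) (fresh st x′ y′ lt)
    ; dead = dead st }

  ready-keep : ∀ {R y c} y′ σ → Ready R y c σ → Ready (R ∪ (suc x , y′)) y c σ
  ready-keep y′ [] _ = _
  ready-keep {R} {y} y′ (_ ∷ σ) (e , m) = trans (∪-other R _ _ λ eq → ℕₚ.1+n≢n (sym (cong proj₁ eq))) e ,
    match-∪ R x (suc y) σ (suc x , y′) (λ i _ eq → ℕₚ.1+n≢n (sym (cong proj₁ eq))) m

  ready-emit : ∀ {R y} σ → Ready R y false σ → Ready (R ∪ (x , y)) y true σ
  ready-emit [] _ = _
  ready-emit {R} {y} ((s , _) ∷ σ) (e , m) = trans (∪-same R (x , y)) (sym (Boolₚ.∨-zeroʳ s)) ,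
    match-∪ R x (suc y) σ (x , y) (λ i _ eq → ℕₚ.<-irrefl (sym (cong proj₂ eq)) (s≤s (ℕₚ.m≤m+n y i))) m

  module Row (y : ℕ) (π σ : Config) (L : List Bond)
    (next : ∀ s μ c R h → Shape (n ∸ y) (μ ∷ μs σ) → State R (suc y) (π ++ [ (s , μ) ]) → Ready R (suc y) c σ →
      ℕtoℚ (Σ⊆ (good R h (μs π ++ μ ∷ μs σ)) L) ≡ 𝓛 c σ (λ τ → f (π ++ (s , μ) ∷ τ)) h)
    where

    g : Bool → ℕ → Config → Series
    g s μ τ = f (π ++ (s , μ) ∷ τ)

    g-dead : b ≡ false → ∀ μ c → 𝓛 c σ (g true μ) ≈ zeroS
    g-dead e μ c = 𝓛-zero c σ λ τ → f-dead e (π ++ (true , μ) ∷ τ) λ z → ℕₚ.1+n≢0 (trans (sym (ℕₚ.+-suc (alive π) (alive τ))) (trans (sym (alive-++ π _)) z))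

    row-alive : ∀ μ c R h → Shape (n ∸ y) (μ ∷ μs σ) → State R y π → R (x , y) ≡ true → Ready R (suc y) c σ →
      ℕtoℚ (Σ⊆ (good R h (μs π ++ μ ∷ μs σ)) (horIf b x y ++ L)) ≡ (x^ 1 · 𝓛 c σ (g true μ) ⊕ 𝓛 c σ (g false μ)) h
    row-alive μ c R h sh st r rd = trans (cases b refl h) (sym (⊕-at _ _ h))
      where
        M = μs π ++ μ ∷ μs σ
        keep : b ≡ true → ∀ h → ℕtoℚ (Σ⊆ (goodHor (R ∪ (suc x , y)) h M) L) ≡ (x^ 1 · 𝓛 c σ (g true μ)) h
        keep b≡ zero = trans (cong ℕtoℚ (Σ⊆-zero L λ _ → refl)) (sym (x^-suc-zero 0 (𝓛 c σ (g true μ))))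
        keep b≡ (suc h) = trans (next true μ c (R ∪ (suc x , y)) h sh (state-keep μ b≡ st) (ready-keep y σ rd))
          (sym (trans (x^-suc-suc 0 (𝓛 c σ (g true μ)) h) (at (x^0· _) h)))
        cases : ∀ b′ → b ≡ b′ → ∀ h → ℕtoℚ (Σ⊆ (good R h M) (horIf b′ x y ++ L)) ≡ (x^ 1 · 𝓛 c σ (g true μ)) h +ℚ 𝓛 c σ (g false μ) h
        cases true e h = trans (ℕtoℚ-+ (Σ⊆ (good R h M) L) (Σ⊆ (good R h M ∘ (horBond x y ∷_)) L))
          (trans (cong₂ _+ℚ_ (next false μ c R h sh (state-drop μ st) rd)
                             (trans (cong ℕtoℚ (Σ⊆-if (R (x , y)) (goodHor (R ∪ (suc x , y)) h M) L r)) (keep e h)))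
                 (ℚₚ.+-comm (𝓛 c σ (g false μ) h) ((x^ 1 · 𝓛 c σ (g true μ)) h)))
        cases false e h = trans (next false μ c R h sh (state-drop μ st) rd) (sym (trans (cong (_+ℚ 𝓛 c σ (g false μ) h)
          (at (≈-trans (SR.*-congˡ (g-dead e μ c)) (SR.zeroʳ _)) h)) (ℚₚ.+-identityˡ _)))

    row-dead : ∀ μ c R h → Shape (n ∸ y) (μ ∷ μs σ) → State R y π → R (x , y) ≡ false → Ready R (suc y) c σ →
      ℕtoℚ (Σ⊆ (good R h (μs π ++ μ ∷ μs σ)) (horIf b x y ++ L)) ≡ 𝓛 c σ (g false μ) h
    row-dead μ c R h sh st r rd = trans (cases b) (next false μ c R h sh (state-drop μ st) rd)
      where
        M = μs π ++ μ ∷ μs σ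
        cases : ∀ b′ → ℕtoℚ (Σ⊆ (good R h M) (horIf b′ x y ++ L)) ≡ ℕtoℚ (Σ⊆ (good R h M) L)
        cases true = cong ℕtoℚ (trans (cong (Σ⊆ (good R h M) L +_) (Σ⊆-ifn (R (x , y)) (goodHor (R ∪ (suc x , y)) h M) L r)) (ℕₚ.+-identityʳ _))
        cases false = refl

    row-emit : ∀ μ R h → Shape (n ∸ y) (μ ∷ μs σ) → State R y π → R (x , y) ≡ true → Ready R (suc y) false σ →
      ℕtoℚ (Σ⊆ (goodVer (R ∪ (x , suc y)) h (decrement y (μs π ++ μ ∷ μs σ))) (horIf b x y ++ L)) ≡ ⅀ (emits μ σ) (λ τ → x^ (alive τ) · f (π ++ τ)) h
    row-emit zero R h sh st r rd = cong ℕtoℚ (trans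
      (cong (λ m → Σ⊆ (goodVer (R ∪ (x , suc y)) h m) (horIf b x y ++ L)) (subst (λ y → decrement y (μs π ++ 0 ∷ μs σ) ≡ nothing) (len st) (decrement-empty π (μs σ))))
      (Σ⊆-zero (horIf b x y ++ L) λ _ → refl))
    row-emit (suc ν) R h sh st r rd = trans
      (cong (λ m → ℕtoℚ (Σ⊆ (goodVer (R ∪ (x , suc y)) h m) (horIf b x y ++ L))) (subst (λ y → decrement y (μs π ++ suc ν ∷ μs σ) ≡ just (μs π ++ ν ∷ μs σ)) (len st) (decrement-at π ν (μs σ))))
      (trans (row-alive ν true (R ∪ (x , suc y)) h (lower sh) (state-emit st) (∨-left _ r) (ready-emit σ rd))
        (sym (at (⅀-emits ν σ (λ τ → f (π ++ τ))) h)))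
      where
        lower : ∀ {m τ} → Shape m (suc ν ∷ τ) → Shape m (ν ∷ τ)
        lower (cons s) = cons s

    row-last : ∀ s c R h → Shape (n ∸ y) (0 ∷ μs σ) → State R y π → R (x , y) ≡ s ∨ c → Ready R (suc y) false σ →
      ℕtoℚ (Σ⊆ (good R h (μs π ++ 0 ∷ μs σ)) (horIf b x y ++ L)) ≡ 𝓛 c ((s , 0) ∷ σ) (λ τ → f (π ++ τ)) h
    row-last s c R h sh st r rd = go (s ∨ c) r
      where
        go : ∀ v → R (x , y) ≡ v → ℕtoℚ (Σ⊆ (good R h (μs π ++ 0 ∷ μs σ)) (horIf b x y ++ L)) ≡ ⅀ (rowSuccs v 0 σ) (λ τ → x^ (alive τ) · f (π ++ τ)) h
        go false r = trans (row-dead 0 false R h sh st r rd) (sym (at (𝓛-dead 0 σ (λ τ → f (π ++ τ))) h))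
        go true r = trans (row-alive 0 false R h sh st r rd) (sym (at (≈-trans (𝓛-alive false 0 σ (λ τ → f (π ++ τ))) (SR.+-congˡ (SR.+-identityʳ _))) h))

    row-full : ∀ s μ c R h → Shape (n ∸ y) (μ ∷ μs σ) → State R y π → R (x , y) ≡ s ∨ c → Ready R (suc y) false σ →
      ℕtoℚ (Σ⊆ (good R h (μs π ++ μ ∷ μs σ)) (verBond x y ∷ (horIf b x y ++ L))) ≡ 𝓛 c ((s , μ) ∷ σ) (λ τ → f (π ++ τ)) h
    row-full s μ c R h sh st r rd = go (s ∨ c) r
      where
        M = μs π ++ μ ∷ μs σ
        go : ∀ v → R (x , y) ≡ v → ℕtoℚ (Σ⊆ (good R h M) (verBond x y ∷ (horIf b x y ++ L))) ≡ ⅀ (rowSuccs v μ σ) (λ τ → x^ (alive τ) · f (π ++ τ)) h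
        go false r = trans (cong ℕtoℚ (trans (cong (Σ⊆ (good R h M) (horIf b x y ++ L) +_) (Σ⊆-ifn (R (x , y)) (goodVer (R ∪ (x , suc y)) h (decrement y M)) (horIf b x y ++ L) r)) (ℕₚ.+-identityʳ _)))
          (trans (row-dead μ false R h sh st r rd) (sym (at (𝓛-dead μ σ (λ τ → f (π ++ τ))) h)))
        go true r = trans (ℕtoℚ-+ (Σ⊆ (good R h M) (horIf b x y ++ L)) (Σ⊆ (good R h M ∘ (verBond x y ∷_)) (horIf b x y ++ L)))
          (trans (cong₂ _+ℚ_ (row-alive μ false R h sh st r rd) (trans (cong ℕtoℚ (Σ⊆-if (R (x , y)) (goodVer (R ∪ (x , suc y)) h (decrement y M)) (horIf b x y ++ L) r)) (row-emit μ R h sh st r rd)))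
            (sym (trans (at (≈-trans (𝓛-alive false μ σ (λ τ → f (π ++ τ))) (≈-sym (SR.+-assoc _ _ _))) h) (⊕-at _ _ h))))

  rows : ∀ r y π c s μ σ R h → Shape r (μ ∷ μs σ) → y + r ≡ n → State R y π → Ready R y c ((s , μ) ∷ σ) →
    ℕtoℚ (Σ⊆ (good R h (μs π ++ μ ∷ μs σ)) (column b x y r ++ bs)) ≡ 𝓛 c ((s , μ) ∷ σ) (λ τ → f (π ++ τ)) h
  rows zero y π c s .0 [] R h top e st (r , _) = Row.row-last y π [] bs next s c R h (subst (λ m → Shape m (0 ∷ [])) (sym n∸y) top) st r _
    where
      y≡n : y ≡ n
      y≡n = trans (sym (ℕₚ.+-identityʳ y)) e
      n∸y : n ∸ y ≡ 0
      n∸y = trans (cong (n ∸_) y≡n) (ℕₚ.n∸n≡0 n)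
      next : ∀ s μ c R h → Shape (n ∸ y) (μ ∷ []) → State R (suc y) (π ++ [ (s , μ) ]) → Ready R (suc y) c [] →
        ℕtoℚ (Σ⊆ (good R h (μs π ++ μ ∷ [])) bs) ≡ 𝓛 c [] (λ τ → f (π ++ (s , μ) ∷ τ)) h
      next s μ c R h sh st _ = trans (cong (λ M → ℕtoℚ (Σ⊆ (good R h M) bs)) (sym (Listₚ.map-++ proj₂ π [ (s , μ) ])))
        (trans (continue R h (π ++ [ (s , μ) ]) shape (dead st) (match st) (fresh st)) (sym (at (≈-trans (SR.+-identityʳ _) (x^0· _)) h)))
        where
          shape : Shape n (μs (π ++ [ (s , μ) ]))
          shape = subst₂′ e (Listₚ.++-identityʳ _) (Shape-snoc π s {μ} {[]} (ℕₚ.suc-injective (trans (sym (length-snoc π (s , μ) refl)) (len st))) (subst (λ m → Shape m (μ ∷ [])) n∸y sh))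
            where
              subst₂′ : ∀ {a b l l′} → a ≡ b → l ≡ l′ → Shape a l → Shape b l′
              subst₂′ refl refl z = z
  rows (suc r) y π c s μ ((s′ , μ′) ∷ σ) R h (cons sh) e st (rxy , m) =
    trans (cong (λ l → ℕtoℚ (Σ⊆ (good R h (μs π ++ μ ∷ μ′ ∷ μs σ)) (verBond x y ∷ l))) (Listₚ.++-assoc (horIf b x y) _ bs))
      (Row.row-full y π ((s′ , μ′) ∷ σ) (column b x (suc y) r ++ bs) next s μ c R h (subst (λ m → Shape m (μ ∷ μ′ ∷ μs σ)) (sym n∸y) (cons sh)) st rxy
        (trans (proj₁ m) (sym (Boolₚ.∨-identityʳ s′)) , proj₂ m))
    where
      n∸y : n ∸ y ≡ suc r
      n∸y = trans (cong (_∸ y) (sym e)) (ℕₚ.m+n∸m≡n y (suc r))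
      tail-shape : ∀ {k μ τ} → k ≡ suc r → Shape k (μ ∷ τ) → Shape r τ
      tail-shape refl (cons z) = z
      next : ∀ t ν c R h → Shape (n ∸ y) (ν ∷ μ′ ∷ μs σ) → State R (suc y) (π ++ [ (t , ν) ]) → Ready R (suc y) c ((s′ , μ′) ∷ σ) →
        ℕtoℚ (Σ⊆ (good R h (μs π ++ ν ∷ μ′ ∷ μs σ)) (column b x (suc y) r ++ bs)) ≡ 𝓛 c ((s′ , μ′) ∷ σ) (λ τ → f (π ++ (t , ν) ∷ τ)) h
      next t ν c R h sh′ st′ rd = trans (cong (λ M → ℕtoℚ (Σ⊆ (good R h M) (column b x (suc y) r ++ bs))) (sym (μs-snoc π (t , ν) (μ′ ∷ μs σ))))
        (trans (rows r (suc y) (π ++ [ (t , ν) ]) c s′ μ′ σ R h (tail-shape n∸y sh′) (trans (sym (ℕₚ.+-suc y r)) e) st′ rd)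
          (at (𝓛-cong c ((s′ , μ′) ∷ σ) λ τ → SR.reflexive (cong f (Listₚ.++-assoc π [ (t , ν) ] τ))) h))

  column-sum : ∀ σ R h → Shape n (μs σ) → Match R x 0 σ → Fresh R x → ℕtoℚ (Σ⊆ (good R h (μs σ)) (column b x 0 n ++ bs)) ≡ 𝓛 false σ f h
  column-sum [] R h () m fr
  column-sum ((s , μ) ∷ σ) R h sh (e , m) fr = rows n 0 [] false s μ σ R h sh refl
    (record { len = refl ; match = _ ; above = λ y′ _ → fr (suc x) y′ ℕₚ.≤-refl ; fresh = λ x′ y′ lt → fr x′ y′ (ℕₚ.<⇒≤ lt) ; dead = λ _ → refl })
    (trans e (sym (Boolₚ.∨-identityʳ s)) , m)

δ₀-zeros : ∀ π → alive π ≡ 0 → ∀ R h → ℕtoℚ (good R h (μs π) []) ≡ δ₀ π h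
δ₀-zeros [] _ R zero = refl
δ₀-zeros [] _ R (suc h) = refl
δ₀-zeros ((false , zero) ∷ π) e R h = δ₀-zeros π e R h
δ₀-zeros ((false , suc _) ∷ π) e R h = cong ℕtoℚ (ℕₚ.*-zeroʳ (bit (0 ≡ᵇ h)))

δ₀-alive : ∀ π → alive π ≢ 0 → δ₀ π ≈ zeroS
δ₀-alive [] ne = ⊥-elim (ne refl)
δ₀-alive ((false , zero) ∷ π) ne = δ₀-alive π ne
δ₀-alive ((false , suc _) ∷ π) ne = ≈-refl
δ₀-alive ((true , _) ∷ π) ne = ≈-refl

columns-sum : ∀ n t x R h σ → Shape n (μs σ) → Match R x 0 σ → Fresh R x → ℕtoℚ (Σ⊆ (good R h (μs σ)) (columns n x t)) ≡ Fn (suc t) σ h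
columns-sum n zero x R h σ = λ sh m fr → Column.column-sum n false x [] δ₀ (λ _ → δ₀-alive)
  (λ R h π _ dead _ _ → δ₀-zeros π (dead refl) R h) σ R h sh m fr
columns-sum n (suc t) x R h σ = λ sh m fr → Column.column-sum n true x (columns n (suc x) t) (Fn (suc t)) (λ ())
  (λ R h π sh _ m fr → columns-sum n t (suc x) R h π sh m fr) σ R h sh m fr

H-formula : ∀ n → H n ≈ ⅀ (comps n n) (λ μ → F (root μ))
H-formula n = mk≈ λ m → trans (cong ℕtoℚ (numAnimals-good n m)) (go m (comps n n) (comps-All n n))
  where
    μs-off : ∀ τ → μs (off τ) ≡ τ
    μs-off [] = refl
    μs-off (a ∷ τ) = cong (a ∷_) (μs-off τ)
    match-off : ∀ y τ → Match R₀ 0 (suc y) (off τ)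
    match-off y [] = _
    match-off y (_ ∷ τ) = refl , match-off (suc y) τ
    one : ∀ m μ → Shape n μ → ℕtoℚ (Σ⊆ (good R₀ m μ) (columns n 0 m)) ≡ F (root μ) m
    one m (a ∷ τ) sh = trans (cong (λ μ → ℕtoℚ (Σ⊆ (good R₀ m (a ∷ μ)) (columns n 0 m))) (sym (μs-off τ)))
      (trans (columns-sum n m 0 R₀ m (root (a ∷ τ)) (subst (λ μ → Shape n (a ∷ μ)) (sym (μs-off τ)) sh) (refl , match-off 0 τ) fresh₀) (sym (F-at (root (a ∷ τ)) m)))
      where
        fresh₀ : Fresh R₀ 0
        fresh₀ (suc x′) y lt = refl
    go : ∀ m ms → All (λ μ → Shape n μ × sum μ ≡ n) ms → ℕtoℚ (Σᴺ ms λ μ → Σ⊆ (good R₀ m μ) (columns n 0 m)) ≡ ⅀ ms (λ μ → F (root μ)) m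
    go m [] [] = refl
    go m (μ ∷ ms) ((sh , _) ∷ shs) = trans (ℕtoℚ-+ (Σ⊆ (good R₀ m μ) (columns n 0 m)) _) (trans (cong₂ _+ℚ_ (one m μ sh) (go m ms shs)) (sym (⊕-at _ _ m)))

-- The distribution 2 , … , 2 , 0 , … , 0 is the only one whose animals contribute a pole.
twos : ℕ → List ℕ
twos k′ = replicate k′ 2 ++ 0 ∷ replicate k′ 0

twos-shape : ∀ k′ → Shape (k′ + k′) (twos k′)
twos-shape k′ = go k′
  where
    zeros-shape : ∀ r → Shape r (0 ∷ replicate r 0)
    zeros-shape zero = top
    zeros-shape (suc r) = cons (zeros-shape r)
    go : ∀ j → Shape (j + k′) (replicate j 2 ++ 0 ∷ replicate k′ 0)
    go zero = zeros-shape k′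
    go (suc j) = cons (go j)

twos-sum : ∀ k′ → sum (twos k′) ≡ k′ + k′
twos-sum k′ = trans (sum-++ (replicate k′ 2) _) (trans (cong₂ _+_ (twice k′) (none k′)) (ℕₚ.+-identityʳ _))
  where
    twice : ∀ j → sum (replicate j 2) ≡ j + j
    twice zero = refl
    twice (suc j) = cong suc (trans (cong suc (twice j)) (sym (ℕₚ.+-suc j j)))
    none : ∀ j → sum (replicate j 0) ≡ 0
    none zero = refl
    none (suc j) = none j

module Conclusion (Ψ : ℕ → Poly) (cyc : IsCyclotomic Ψ) (k′ : ℕ) where

  open Singular Ψ cyc k′

  sum-multiple : ∀ ms → All (λ μ → Shape (k′ + k′) μ × sum μ ≡ k′ + k′) ms →
    Σ ℕ λ n → (E k′ · ⅀ ms (λ μ → F (root μ)) ≡ᴿ const (ℕtoℚ n) · fₖ) × (twos k′ ∈ ms → 1 ≤ n)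
  sum-multiple [] [] = 0 , ≈⇒≡ᴿ (≈-trans (SR.zeroʳ (E k′)) (≈-sym (≈-trans (SR.*-congʳ const-0) (SR.zeroˡ fₖ)))) , λ ()
  sum-multiple ([] ∷ ms) ((() , _) ∷ ps)
  sum-multiple ((a ∷ τ) ∷ ms) ((_ , e) ∷ ps) = combine (root-multiple a τ e) (sum-multiple ms ps)
    where
      combine : (Σ ℕ λ n → (E k′ · F (root (a ∷ τ)) ≡ᴿ const (ℕtoℚ n) · fₖ) × ((Σ ℕ λ r → a ∷ τ ≡ replicate k′ 2 ++ 0 ∷ replicate r 0) → 1 ≤ n)) →
        (Σ ℕ λ n → (E k′ · ⅀ ms (λ μ → F (root μ)) ≡ᴿ const (ℕtoℚ n) · fₖ) × (twos k′ ∈ ms → 1 ≤ n)) →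
        Σ ℕ λ n → (E k′ · ⅀ ((a ∷ τ) ∷ ms) (λ μ → F (root μ)) ≡ᴿ const (ℕtoℚ n) · fₖ) × (twos k′ ∈ (a ∷ τ) ∷ ms → 1 ≤ n)
      combine (n₁ , eq₁ , sp₁) (n₂ , eq₂ , sp₂) = n₁ + n₂ ,
        ≡ᴿ-trans (≈⇒≡ᴿ (SR.distribˡ (E k′) (F (root (a ∷ τ))) _)) (≡ᴿ-trans (≡ᴿ-⊕ eq₁ eq₂)
          (≈⇒≡ᴿ (≈-trans (≈-sym (SR.distribʳ fₖ _ _)) (SR.*-congʳ (≈-trans (≈-sym (const-+ (ℕtoℚ n₁) (ℕtoℚ n₂))) (SR.reflexive (cong const (sym (ℕtoℚ-+ n₁ n₂))))))))) ,
        λ { (here eq) → ℕₚ.≤-trans (sp₁ (k′ , sym eq)) (ℕₚ.m≤m+n n₁ n₂) ; (there t) → ℕₚ.≤-trans (sp₂ t) (ℕₚ.m≤n+m n₂ n₁) }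

  pole-H : Pole (H (k′ + k′))
  pole-H = go (sum-multiple (comps (k′ + k′) (k′ + k′)) (comps-All (k′ + k′) (k′ + k′)))
    where
      go : (Σ ℕ λ n → (E k′ · ⅀ (comps (k′ + k′) (k′ + k′)) (λ μ → F (root μ)) ≡ᴿ const (ℕtoℚ n) · fₖ) × (twos k′ ∈ comps (k′ + k′) (k′ + k′) → 1 ≤ n)) → Pole (H (k′ + k′))
      go (n , eq , sp) = pole-≈ (≈-sym (H-formula (k′ + k′))) (pole-/ (unit-E k′ ℕₚ.≤-refl) (pole-≡ᴿ eq (pole-· (unit-const (ℕtoℚ-≢0 n
        (sp (subst (λ v → twos k′ ∈ comps (k′ + k′) v) (twos-sum k′) (comps-complete (twos-shape k′)))))) pole-fₖ)))

  coprime-reduction : ∀ {f} → Pole f → HasUncancelledDenomFactor f (Ψ k)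
  coprime-reduction {f} (pole D U uD uU eq) = fromBezout (bezout (isPoly uU) (poly-· (isPoly uD) poly-P))
    where
      open S-Solver
      not-unit : ∀ {h} → IsPoly h → ¬ (P · h ≈ 𝟙)
      not-unit ph e = ψ-nonconstant k (s≤s z≤n) (unit⇒deg0 poly-P ph e)
      fromBezout : Bezout U (D · P) → HasUncancelledDenomFactor f (Ψ k)
      fromBezout z = proj₁ num , proj₁ den ,
          (λ m → trans (sym (·-at _ f m)) (at (≈-trans (SR.*-congʳ (proj₂ den)) (≈-trans b′·f (≈-sym (proj₂ num)))) m)) ,
          coprimeP , P∣den , λ P∣num → nonconstant (coprimeP (Ψ k) P∣num P∣den)
        where
          open Bezout z
          num = toPoly poly-a′
          den = toPoly poly-b′
          g≢0 : Σ ℕ λ n → g n ≢ 0ℚ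
          g≢0 = cases (findDeg _ {g} (proj₂ poly-g)) (isCoprime uU)
            where
              cases : (g ≈ zeroS) ⊎ Σ ℕ (HasDeg g) → Coprime U P → Σ ℕ λ n → g n ≢ 0ℚ
              cases (inj₂ (n , ne , _)) _ = n , ne
              cases (inj₁ g≈0) (s , t , _ , pt , st) = ⊥-elim (not-unit pt (begin
                P · t          ≈⟨ SR.*-comm P t ⟩
                t · P          ≈⟨ ≈-sym (SR.+-identityˡ (t · P)) ⟩
                zeroS ⊕ t · P  ≈⟨ SR.+-congʳ (≈-sym (≈-trans (SR.*-congˡ (≈-trans a≈ (≈-trans (SR.*-congˡ g≈0) (SR.zeroʳ a′)))) (SR.zeroʳ s))) ⟩
                s · U ⊕ t · P  ≈⟨ st ⟩
                𝟙 ∎))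
          b′·f : b′ · f ≈ a′
          b′·f = cancel-· (proj₁ g≢0) {g} (proj₂ g≢0) (begin
            g · (b′ · f)   ≈⟨ solve 3 (λ g b f → g :* (b :* f) := (b :* g) :* f) ≈-refl g b′ f ⟩
            b′ · g · f     ≈⟨ SR.*-congʳ (≈-sym b≈) ⟩
            D · P · f      ≈⟨ SR.*-assoc D P f ⟩
            D · (P · f)    ≈⟨ eq ⟩
            U              ≈⟨ a≈ ⟩
            a′ · g         ≈⟨ SR.*-comm a′ g ⟩
            g · a′ ∎)
          combination : u · a′ ⊕ v · b′ ≈ 𝟙
          combination = cancel-· (proj₁ g≢0) {g} (proj₂ g≢0) (begin
            g · (u · a′ ⊕ v · b′)           ≈⟨ solve 5 (λ g u a v b → g :* (u :* a :+ v :* b) := u :* (a :* g) :+ v :* (b :* g)) ≈-refl g u a′ v b′ ⟩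
            u · (a′ · g) ⊕ v · (b′ · g)     ≈⟨ SR.+-cong (SR.*-congˡ (≈-sym a≈)) (SR.*-congˡ (≈-sym b≈)) ⟩
            u · U ⊕ v · (D · P)             ≈⟨ ≈-sym g≈ ⟩
            g                               ≈⟨ ≈-sym (SR.*-identityʳ g) ⟩
            g · 𝟙 ∎)
          coprimeP : CoprimeP (proj₁ num) (proj₁ den)
          coprimeP C (E₁ , e₁) (E₂ , e₂) m 1≤m = proj₂ (unit⇒deg0 (poly-coeff C)
              (poly-⊕ (poly-· poly-u (poly-coeff E₁)) (poly-· poly-v (poly-coeff E₂))) (begin
                c · (u · coeff E₁ ⊕ v · coeff E₂)            ≈⟨ solve 5 (λ c u a v b → c :* (u :* a :+ v :* b) := u :* (c :* a) :+ v :* (c :* b)) ≈-refl c u (coeff E₁) v (coeff E₂) ⟩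
                u · (c · coeff E₁) ⊕ v · (c · coeff E₂)      ≈⟨ SR.+-cong (SR.*-congˡ (≈-trans (mk≈ λ m → trans (·-at c _ m) (e₁ m)) (proj₂ num)))
                                                                           (SR.*-congˡ (≈-trans (mk≈ λ m → trans (·-at c _ m) (e₂ m)) (proj₂ den))) ⟩
                u · a′ ⊕ v · b′                              ≈⟨ combination ⟩
                𝟙 ∎)) m 1≤m
            where c = coeff C
          P∣den : Ψ k ∣ₚ proj₁ den
          P∣den = cases (isCoprime uU)
            where
              cases : Coprime U P → Ψ k ∣ₚ proj₁ den
              cases (s , t , ps , pt , st) = proj₁ quot , λ m → trans (sym (·-at P _ m)) (at (≈-trans (SR.*-congˡ (proj₂ quot)) (≈-trans P·quot (≈-sym (proj₂ den)))) m)
                where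
                  q = s · a′ · D ⊕ b′ · t
                  quot : Σ Poly λ r → coeff r ≈ q
                  quot = toPoly (poly-⊕ (poly-· (poly-· ps poly-a′) (isPoly uD)) (poly-· poly-b′ pt))
                  P·quot : P · q ≈ b′
                  P·quot = begin
                    P · (s · a′ · D ⊕ b′ · t)         ≈⟨ solve 6 (λ P s a D b t → P :* (s :* a :* D :+ b :* t) := s :* a :* (D :* P) :+ b :* (t :* P)) ≈-refl P s a′ D b′ t ⟩
                    s · a′ · (D · P) ⊕ b′ · (t · P)   ≈⟨ SR.+-congʳ (SR.*-congˡ b≈) ⟩
                    s · a′ · (b′ · g) ⊕ b′ · (t · P)  ≈⟨ solve 6 (λ s a b g t P → s :* a :* (b :* g) :+ b :* (t :* P) := b :* (s :* (a :* g) :+ t :* P)) ≈-refl s a′ b′ g t P ⟩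
                    b′ · (s · (a′ · g) ⊕ t · P)       ≈⟨ SR.*-congˡ (≈-trans (SR.+-congʳ (SR.*-congˡ (≈-sym a≈))) st) ⟩
                    b′ · 𝟙                            ≈⟨ SR.*-identityʳ b′ ⟩
                    b′ ∎
          nonconstant : ¬ IsConstant (Ψ k)
          nonconstant const-Ψ = cases (degψ k (s≤s z≤n))
            where
              cases : Σ ℕ (HasDeg P) → ⊥
              cases (zero , d) = ψ-nonconstant k (s≤s z≤n) d
              cases (suc a , ne , _) = ne (const-Ψ (suc a) (s≤s z≤n))

mainTheorem1 : (Ψ : ℕ → Poly) → IsCyclotomic Ψ →
    ∀ k → 1 ≤ k → HasUncancelledDenomFactor (H (2 * k ∸ 2)) (Ψ k)
mainTheorem1 Ψ cyc (suc k′) 1≤k = subst (λ n → HasUncancelledDenomFactor (H n) (Ψ (suc k′))) (sym index) (coprime-reduction pole-H)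
  where
    open Conclusion Ψ cyc k′
    index : 2 * suc k′ ∸ 2 ≡ k′ + k′
    index = trans (cong (_∸ 1) (ℕₚ.+-suc k′ (k′ + 0))) (cong (k′ +_) (ℕₚ.+-identityʳ k′))
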